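{- Let $G$ be a simple graph on the vertex set $[d]$ without isolated vertices, and let $\delta(\mathcal{P}(G),t)=\delta_0+\delta_1t+\cdots+\delta_{d-1}t^{d-1}$. Then $$E(\mathrm{FRAC}(G),t)=\frac{\delta(\mathcal{P}(G),t^2)+t^{2d-1}\delta(\mathcal{P}(G),1/t^2)}{(1-t^2)^{d+1}}=\frac{\delta_0+\delta_{d-1}t+\delta_1t^2+\delta_{d-2}t^3+\cdots+\delta_{d-1}t^{2d-2}+\delta_0t^{2d-1}}{(1-t^2)^{d+1}},$$ where the sequence $(\delta_0,\delta_{d-1},\delta_1,\delta_{d-2},\ldots,\delta_{d-1},\delta_0)$ is symmetric and unimodal. In addition, for all integers $k$, $$i^{\mathrm{odd}}(\mathrm{FRAC}(G),2k+1)=(-1)^d\,i^{\mathrm{even}}(\mathrm{FRAC}(G),-2k-4)=(-1)^d\,i(\mathcal{P}(G),-k-2).$$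
   Context: $\mathrm{FRAC}(G)=\{(x_1,\ldots,x_d)\in\mathbb{R}^d : x_i\ge 0\ (1\le i\le d),\ x_i+x_j\le 1\ ((i,j)\in E(G))\}$ with $E(G)$ the edge set, and $\mathcal{P}(G)=2\,\mathrm{FRAC}(G)$, a $d$-dimensional lattice polytope. For a rational polytope $P\subset\mathbb{R}^d$, $i(P,n)=\#(nP\cap\mathbb{Z}^d)$ and the Ehrhart series is $E(P,t)=1+\sum_{n\ge1}i(P,n)t^n$. For a lattice polytope $P$ of dimension $d$, $i(P,n)$ is a polynomial in $n$ and $E(P,t)=\delta(P,t)/(1-t)^{d+1}$ with $\delta(P,t)$ a polynomial (the $\delta$-polynomial). The function $i(\mathrm{FRAC}(G),n)$ is a quasi-polynomial of period at most $2$: there are polynomials $i^{\mathrm{odd}}(\mathrm{FRAC}(G),n)$ and $i^{\mathrm{even}}(\mathrm{FRAC}(G),n)$ of degree $d$ with $i(\mathrm{FRAC}(G),n)=i^{\mathrm{odd}}(\mathrm{FRAC}(G),n)$ for odd $n\ge1$ and $=i^{\mathrm{even}}(\mathrm{FRAC}(G),n)$ for even $n\ge0$; these polynomials are evaluated at arbitrary integers. A sequence $(c_0,\ldots,c_m)$ is symmetric if $c_i=c_{m-i}$, and unimodal if $c_0\le\cdots\le c_k\ge\cdots\ge c_m$ for some $k$. -}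

module Defs where

open import Data.Bool using (Bool; true; false; not; _∨_; _∧_; if_then_else_)
open import Data.Nat as ℕ using (ℕ; zero; suc; _≤ᵇ_; ⌊_/2⌋; _∸_)
open import Data.Nat.Combinatorics using (_C_)
open import Data.Integer as ℤ using (ℤ; +_)
open import Data.Rational as ℚ using (ℚ)
open import Data.Fin using (Fin)
open import Data.Vec using (Vec; []; _∷_; lookup)
open import Data.List using (List; []; _∷_; [_]; map; concatMap; upTo; allFin; filterᵇ; length; foldr)
open import Data.Product using (∃-syntax; _×_)
open import Relation.Binary.PropositionalEquality using (_≡_)

Adj : ℕ → Set
Adj d = Fin d → Fin d → Bool

IsSimpleGraph : ∀ {d} → Adj d → Set
IsSimpleGraph {d} A = (∀ i j → A i j ≡ A j i) × (∀ i → A i i ≡ false)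

NoIsolatedVertices : ∀ {d} → Adj d → Set
NoIsolatedVertices {d} A = ∀ i → ∃[ j ] A i j ≡ true

allᵇ : {X : Set} → (X → Bool) → List X → Bool
allᵇ p []       = true
allᵇ p (x ∷ xs) = p x ∧ allᵇ p xs

box : (d n : ℕ) → List (Vec ℕ d)
box zero    n = [ [] ]
box (suc d) n = concatMap (λ k → map (k ∷_) (box d n)) (upTo (suc n))

-- x ∈ n·FRAC(G) for x ∈ ℕ^d (nonnegativity is built in):  x_i + x_j ≤ n for every edge
inDilatedFRAC : ∀ {d} → Adj d → ℕ → Vec ℕ d → Bool
inDilatedFRAC {d} A n x =
  allᵇ (λ i → allᵇ (λ j → not (A i j) ∨ (lookup x i ℕ.+ lookup x j ≤ᵇ n)) (allFin d)) (allFin d)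

-- i(FRAC(G), n) = #(n·FRAC(G) ∩ ℤ^d).  (Coordinates of such points are ≤ n when G has
-- no isolated vertices, so enumerating the box {0..n}^d is exhaustive.)
iFRAC : ∀ {d} → Adj d → ℕ → ℕ
iFRAC {d} A n = length (filterᵇ (inDilatedFRAC A n) (box d n))

-- i(P(G), n) with P(G) = 2·FRAC(G), i.e. n·P(G) = (2n)·FRAC(G)
iP : ∀ {d} → Adj d → ℕ → ℕ
iP A n = iFRAC A (2 ℕ.* n)

ehrCoeff : (ℕ → ℕ) → ℕ → ℤ
ehrCoeff i zero    = + 1
ehrCoeff i (suc n) = + i (suc n)

sgn : ℕ → ℤ
sgn zero    = + 1
sgn (suc j) = ℤ.- sgn j

sumℤ : List ℤ → ℤ
sumℤ = foldr ℤ._+_ (+ 0)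

mulOneMinusPow : (p s : ℕ) → (ℕ → ℤ) → ℕ → ℤ
mulOneMinusPow p s f m =
  sumℤ (map (λ j → if s ℕ.* j ≤ᵇ m then sgn j ℤ.* (+ (p C j)) ℤ.* f (m ∸ s ℕ.* j) else + 0)
            (upTo (suc p)))

δP : ∀ {d} → Adj d → ℕ → ℤ
δP {d} A = mulOneMinusPow (suc d) 1 (ehrCoeff (iP A))

fracNumer : ∀ {d} → Adj d → ℕ → ℤ
fracNumer {d} A = mulOneMinusPow (suc d) 2 (ehrCoeff (iFRAC A))

isEven : ℕ → Bool
isEven zero = true
isEven (suc n) = not (isEven n)

-- coefficient of t^m in δ(t^2) + t^{2d-1} δ(1/t^2)   (δ given by coefficients, degree ≤ d-1)
firstForm : ℕ → (ℕ → ℤ) → ℕ → ℤ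
firstForm d δ m =
  (if isEven m then δ ⌊ m /2⌋ else + 0)
  ℤ.+ (if not (isEven m) ∧ (m ≤ᵇ 2 ℕ.* d ∸ 1) then δ ⌊ (2 ℕ.* d ∸ 1 ∸ m) /2⌋ else + 0)

interleave : ℕ → (ℕ → ℤ) → ℕ → ℤ
interleave d δ m = if isEven m then δ ⌊ m /2⌋ else δ (d ∸ 1 ∸ ⌊ m /2⌋)

secondForm : ℕ → (ℕ → ℤ) → ℕ → ℤ
secondForm d δ m = if suc m ≤ᵇ 2 ℕ.* d then interleave d δ m else + 0

Symmetric : ℕ → (ℕ → ℤ) → Set
Symmetric m c = ∀ i → i ℕ.≤ m → c i ≡ c (m ∸ i)

Unimodal : ℕ → (ℕ → ℤ) → Set
Unimodal m c = ∃[ k ] (k ℕ.≤ m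
  × (∀ i → i ℕ.< k → c i ℤ.≤ c (suc i))
  × (∀ i → k ℕ.≤ i → i ℕ.< m → c (suc i) ℤ.≤ c i))

evalℚ : List ℚ → ℤ → ℚ
evalℚ []       x = ℚ.0ℚ
evalℚ (a ∷ as) x = a ℚ.+ (x ℚ./ 1) ℚ.* evalℚ as x

ℕtoℚ : ℕ → ℚ
ℕtoℚ n = (+ n) ℚ./ 1

signℚ : ℕ → ℚ
signℚ d = sgn d ℚ./ 1

{-# OPTIONS --safe #-}

-- In the coordinates z = n - 2x the polytope n·FRAC(G) is the cone z_i + z_j ≥ 0 truncated by z_i ≤ n.
-- Peel off a lattice point layer by layer: first the positive coordinates of maximal absolute value, then
-- the negative ones (which must be isolated in the graph that is left), and so on.  Grouping the layers into
-- maximal blocks of equal sign, a block of b vertices contributes the Eulerian factor A_b(t), and each step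
-- from a negative block up to a positive one a factor t; only a negative innermost block distinguishes
-- even from odd dilations.  Hence δ(P(G),t) = α + tβ and (1-t)^(d+1) Σ i(FRAC(G),2m+1) t^m = α + β, where α and β are
-- ℕ-combinations of the t^a (1+t)^b centred at (d-1)/2 and (d-2)/2; this gives symmetry and unimodality.
-- Reciprocity says that the two numerators are mirror images of one another.
module Submission where

open import Algebra.Bundles using (CommutativeMonoid; CommutativeRing)
import Algebra.Properties.CommutativeSemigroup
import Algebra.Solver.Ring
open import Algebra.Solver.Ring.AlmostCommutativeRing using (fromCommutativeRing; _-Raw-AlmostCommutative⟶_)
open import Data.Bool using (Bool; true; false; not; _∨_; _∧_; if_then_else_; T)
open import Data.Fin using (Fin; zero; suc)
open import Data.Integer as ℤ using (ℤ; +_; -[1+_])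
import Data.Integer.Properties as ℤₚ
open import Data.Integer.Tactic.RingSolver using (solve-∀)
open import Data.List as List using (List; []; _∷_; map; concatMap; allFin; filterᵇ; length; _++_; applyUpTo)
open import Data.Maybe using (Maybe; nothing; just)
open import Data.Nat as ℕ using (ℕ; zero; suc; _∸_; s≤s; z≤n; _≤ᵇ_; _<ᵇ_; ⌊_/2⌋)
open import Data.Nat.Combinatorics using (_C_; nCk+nC[k+1]≡[n+1]C[k+1]; k>n⇒nCk≡0)
import Data.Nat.Properties as ℕₚ
open import Data.Product using (∃-syntax; _×_; _,_; proj₁; proj₂)
open import Data.Rational as ℚ using (ℚ; 0ℚ)
import Data.Rational.Properties as ℚₚ
open import Data.Rational.Solver using (module +-*-Solver)
import Data.Rational.Unnormalised as ℚᵘ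
import Data.Rational.Unnormalised.Properties as ℚᵘₚ
open import Data.Sum using (inj₁; inj₂)
open import Data.Vec using (Vec; []; _∷_; lookup; tabulate; replicate)
open import Data.Vec.Properties using (lookup-replicate; lookup∘tabulate)
open import Function using (_∘_; id)
open import Level using (0ℓ)
open import Relation.Binary.PropositionalEquality as ≡
  using (_≡_; _≗_; refl; sym; trans; cong; cong₂; subst; subst₂; module ≡-Reasoning)
import Relation.Binary.Reasoning.Setoid
open import Relation.Nullary using (Dec; yes; no; contradiction)

open import Defs

-- Let E delete an arbitrary set of vertices and B a set of isolated ones. One layer is the operator
-- EB, so the generating series is governed by (1 - tEB)^-1. The obstacle is that powers of EB have
-- no closed form: every E changes which vertices are isolated. Powers of E alone do have one, since
-- E^k counts a deletion of b vertices k^b times; so do powers of B alone, because deleting isolated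
-- vertices isolates no further vertex. The series is therefore re-expressed through (1 - tE)^-1 and
-- (1 - tB)^-1, and the Eulerian polynomials enter as the numerators of the sums of k^b t^k. One
-- pair α, β has to serve both parities at once. Reversal of sequences of length d fixes α and
-- exchanges β with tβ, so the numerators α + tβ and α + β are mirror images. Interlacing them
-- compares neighbours in which either α or β cancels, so each inequality follows from the rise of
-- the other one. Polynomials in n are accessed only through vanishing iterated differences on all
-- of ℤ.

-- The ring of formal power series over the integers.

module PowerSeries where
  record Series : Set where
    no-eta-equality
    constructor series
    field coeff : ℕ → ℤ
  open Series public

  infix 4 _≈_
  record _≈_ (x y : Series) : Set where
    constructor ext
    field at : ∀ n → coeff x n ≡ coeff y n
  open _≈_ public

  convolve : (ℕ → ℤ) → (ℕ → ℤ) → ℕ → ℤ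
  convolve x y zero    = x 0 ℤ.* y 0
  convolve x y (suc n) = x 0 ℤ.* y (suc n) ℤ.+ convolve (λ k → x (suc k)) y n

  const : ℤ → Series
  coeff (const a) zero    = a
  coeff (const a) (suc _) = + 0

  infixl 6 _+_
  infixl 7 _*_
  infix 8 -_

  _+_ _*_ : Series → Series → Series
  coeff (x + y) n = coeff x n ℤ.+ coeff y n
  coeff (x * y)   = convolve (coeff x) (coeff y)

  -_ : Series → Series
  coeff (- x) n = ℤ.- coeff x n

  convolve-cong : ∀ {x x′ y y′} → x ≗ x′ → y ≗ y′ → convolve x y ≗ convolve x′ y′
  convolve-cong p q zero    = cong₂ ℤ._*_ (p 0) (q 0)
  convolve-cong p q (suc n) =
    cong₂ ℤ._+_ (cong₂ ℤ._*_ (p 0) (q (suc n))) (convolve-cong (λ k → p (suc k)) q n)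

  convolve-distribʳ : ∀ z x y → convolve (λ k → x k ℤ.+ y k) z ≗ λ n → convolve x z n ℤ.+ convolve y z n
  convolve-distribʳ z x y zero    = ℤₚ.*-distribʳ-+ (z 0) (x 0) (y 0)
  convolve-distribʳ z x y (suc n)
    rewrite convolve-distribʳ z (λ k → x (suc k)) (λ k → y (suc k)) n =
    lemma (x 0) (y 0) (z (suc n)) _ _
    where
    lemma : ∀ a b c u v → (a ℤ.+ b) ℤ.* c ℤ.+ (u ℤ.+ v) ≡ (a ℤ.* c ℤ.+ u) ℤ.+ (b ℤ.* c ℤ.+ v)
    lemma = solve-∀

  convolve-scaleˡ : ∀ a x y → convolve (λ k → a ℤ.* x k) y ≗ λ n → a ℤ.* convolve x y n
  convolve-scaleˡ a x y zero    = ℤₚ.*-assoc a (x 0) (y 0)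
  convolve-scaleˡ a x y (suc n) rewrite convolve-scaleˡ a (λ k → x (suc k)) y n =
    lemma a (x 0) (y (suc n)) _
    where
    lemma : ∀ a b c u → (a ℤ.* b) ℤ.* c ℤ.+ a ℤ.* u ≡ a ℤ.* (b ℤ.* c ℤ.+ u)
    lemma = solve-∀

  convolve-assoc : ∀ x y z → convolve (convolve x y) z ≗ convolve x (convolve y z)
  convolve-assoc x y z zero    = ℤₚ.*-assoc (x 0) (y 0) (z 0)
  convolve-assoc x y z (suc n)
    rewrite convolve-distribʳ z (λ k → x 0 ℤ.* y (suc k)) (convolve (λ k → x (suc k)) y) n
          | convolve-scaleˡ (x 0) (λ k → y (suc k)) z n
          | convolve-assoc (λ k → x (suc k)) y z n =
    lemma (x 0) (y 0) (z (suc n)) _ _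
    where
    lemma : ∀ a b c u v → (a ℤ.* b) ℤ.* c ℤ.+ (a ℤ.* u ℤ.+ v) ≡ a ℤ.* (b ℤ.* c ℤ.+ u) ℤ.+ v
    lemma = solve-∀

  convolve-sucʳ : ∀ x y n → convolve x y (suc n) ≡ x (suc n) ℤ.* y 0 ℤ.+ convolve x (λ k → y (suc k)) n
  convolve-sucʳ x y zero    = ℤₚ.+-comm (x 0 ℤ.* y 1) (x 1 ℤ.* y 0)
  convolve-sucʳ x y (suc n) rewrite convolve-sucʳ (λ k → x (suc k)) y n =
    lemma (x 0 ℤ.* y (suc (suc n))) (x (suc (suc n)) ℤ.* y 0) _
    where
    lemma : ∀ a b c → a ℤ.+ (b ℤ.+ c) ≡ b ℤ.+ (a ℤ.+ c)
    lemma = solve-∀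

  convolve-comm : ∀ x y → convolve x y ≗ convolve y x
  convolve-comm x y zero    = ℤₚ.*-comm (x 0) (y 0)
  convolve-comm x y (suc n) rewrite convolve-sucʳ y x n | convolve-comm (λ k → x (suc k)) y n =
    cong (ℤ._+ convolve y (λ k → x (suc k)) n) (ℤₚ.*-comm (x 0) (y (suc n)))

  convolve-zeroˡ : ∀ y → convolve (λ _ → + 0) y ≗ λ _ → + 0
  convolve-zeroˡ y zero    = refl
  convolve-zeroˡ y (suc n) = trans (ℤₚ.+-identityˡ _) (convolve-zeroˡ y n)

  convolve-constˡ : ∀ a y → convolve (coeff (const a)) y ≗ λ n → a ℤ.* y n
  convolve-constˡ a y zero    = refl
  convolve-constˡ a y (suc n) rewrite convolve-zeroˡ y n = ℤₚ.+-identityʳ _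

  -- Leibniz rule for t d/dt: in every term of the convolution the weight n is the sum of the two
  -- indices.
  convolve-θ : ∀ x y n → + n ℤ.* convolve x y n ≡
    convolve (λ k → + k ℤ.* x k) y n ℤ.+ convolve x (λ k → + k ℤ.* y k) n
  convolve-θ x y zero    = lemma (x 0) (y 0)
    where
    lemma : ∀ a b → + 0 ℤ.* (a ℤ.* b) ≡ (+ 0 ℤ.* a) ℤ.* b ℤ.+ a ℤ.* (+ 0 ℤ.* b)
    lemma = solve-∀
  convolve-θ x y (suc n) = begin
    + suc n ℤ.* (x 0 ℤ.* y (suc n) ℤ.+ convolve x′ y n)
      ≡⟨ step₁ (+ n) (x 0 ℤ.* y (suc n)) (convolve x′ y n) ⟩
    (+ suc n ℤ.* (x 0 ℤ.* y (suc n)) ℤ.+ convolve x′ y n) ℤ.+ + n ℤ.* convolve x′ y n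
      ≡⟨ cong (ℤ._+_ (+ suc n ℤ.* (x 0 ℤ.* y (suc n)) ℤ.+ convolve x′ y n)) (convolve-θ x′ y n) ⟩
    (+ suc n ℤ.* (x 0 ℤ.* y (suc n)) ℤ.+ convolve x′ y n)
      ℤ.+ (convolve (λ k → + k ℤ.* x′ k) y n ℤ.+ convolve x′ (λ k → + k ℤ.* y k) n)
      ≡⟨ step₂ (+ suc n) (x 0) (y (suc n)) _ _ _ ⟩
    (+ 0 ℤ.* x 0) ℤ.* y (suc n) ℤ.+ (convolve x′ y n ℤ.+ convolve (λ k → + k ℤ.* x′ k) y n)
      ℤ.+ (x 0 ℤ.* (+ suc n ℤ.* y (suc n)) ℤ.+ convolve x′ (λ k → + k ℤ.* y k) n)
      ≡⟨ cong (λ z → (+ 0 ℤ.* x 0) ℤ.* y (suc n) ℤ.+ z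
             ℤ.+ (x 0 ℤ.* (+ suc n ℤ.* y (suc n)) ℤ.+ convolve x′ (λ k → + k ℤ.* y k) n))
           (trans (sym (convolve-distribʳ y x′ (λ k → + k ℤ.* x′ k) n))
                  (convolve-cong {y = y} (λ k → suc-* (+ k) (x′ k)) (λ _ → refl) n)) ⟩
    (+ 0 ℤ.* x 0) ℤ.* y (suc n) ℤ.+ convolve (λ k → + suc k ℤ.* x′ k) y n
      ℤ.+ (x 0 ℤ.* (+ suc n ℤ.* y (suc n)) ℤ.+ convolve x′ (λ k → + k ℤ.* y k) n)
      ∎
    where
    open ≡-Reasoning
    x′ : ℕ → ℤ
    x′ k = x (suc k)
    step₁ : ∀ m a b → (+ 1 ℤ.+ m) ℤ.* (a ℤ.+ b) ≡ ((+ 1 ℤ.+ m) ℤ.* a ℤ.+ b) ℤ.+ m ℤ.* b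
    step₁ = solve-∀
    step₂ : ∀ m a b u v w → (m ℤ.* (a ℤ.* b) ℤ.+ u) ℤ.+ (v ℤ.+ w) ≡
            (+ 0 ℤ.* a) ℤ.* b ℤ.+ (u ℤ.+ v) ℤ.+ (a ℤ.* (m ℤ.* b) ℤ.+ w)
    step₂ = solve-∀
    suc-* : ∀ m a → a ℤ.+ m ℤ.* a ≡ (+ 1 ℤ.+ m) ℤ.* a
    suc-* = solve-∀

  ℤ[[t]] : CommutativeRing 0ℓ 0ℓ
  ℤ[[t]] = record
    { Carrier = Series ; _≈_ = _≈_ ; _+_ = _+_ ; _*_ = _*_ ; -_ = -_ ; 0# = const (+ 0) ; 1# = const (+ 1)
    ; isCommutativeRing = record
      { isRing = record
        { +-isAbelianGroup = record
          { isGroup = record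
            { isMonoid = record
              { isSemigroup = record
                { isMagma = record
                  { isEquivalence = record
                    { refl = ext λ _ → refl ; sym = λ p → ext λ n → sym (at p n)
                    ; trans = λ p q → ext λ n → trans (at p n) (at q n) }
                  ; ∙-cong = λ p q → ext λ n → cong₂ ℤ._+_ (at p n) (at q n) }
                ; assoc = λ x y z → ext λ n → ℤₚ.+-assoc (coeff x n) (coeff y n) (coeff z n) }
              ; identity = (λ x → ext λ { zero → ℤₚ.+-identityˡ _ ; (suc n) → ℤₚ.+-identityˡ _ })
                         , (λ x → ext λ { zero → ℤₚ.+-identityʳ _ ; (suc n) → ℤₚ.+-identityʳ _ }) }
            ; inverse = (λ x → ext λ { zero → ℤₚ.+-inverseˡ (coeff x 0) ; (suc n) → ℤₚ.+-inverseˡ (coeff x (suc n)) })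
                      , (λ x → ext λ { zero → ℤₚ.+-inverseʳ (coeff x 0) ; (suc n) → ℤₚ.+-inverseʳ (coeff x (suc n)) })
            ; ⁻¹-cong = λ p → ext λ n → cong ℤ.-_ (at p n) }
          ; comm = λ x y → ext λ n → ℤₚ.+-comm (coeff x n) (coeff y n) }
        ; *-cong = λ p q → ext (convolve-cong (at p) (at q))
        ; *-assoc = λ x y z → ext (convolve-assoc (coeff x) (coeff y) (coeff z))
        ; *-identity = (λ x → ext λ n → trans (convolve-constˡ (+ 1) (coeff x) n) (ℤₚ.*-identityˡ _))
                     , (λ x → ext λ n → trans (convolve-comm (coeff x) _ n)
                                        (trans (convolve-constˡ (+ 1) (coeff x) n) (ℤₚ.*-identityˡ _)))
        ; distrib = (λ x y z → ext λ n → trans (convolve-comm (coeff x) _ n)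
                      (trans (convolve-distribʳ (coeff x) (coeff y) (coeff z) n)
                        (cong₂ ℤ._+_ (convolve-comm (coeff y) (coeff x) n) (convolve-comm (coeff z) (coeff x) n))))
                  , (λ x y z → ext (convolve-distribʳ (coeff x) (coeff y) (coeff z))) }
      ; *-comm = λ x y → ext (convolve-comm (coeff x) (coeff y)) } }

  module ℤ[[t]] = CommutativeRing ℤ[[t]]

  +≈ˡ : ∀ {x y z} → y ≈ z → x + y ≈ x + z
  +≈ˡ {x} p = ext λ n → cong (ℤ._+_ (coeff x n)) (at p n)

  +≈ʳ : ∀ {x y z} → y ≈ z → y + x ≈ z + x
  +≈ʳ {x} p = ext λ n → cong (ℤ._+ coeff x n) (at p n)

  *≈ˡ : ∀ {x y z} → y ≈ z → x * y ≈ x * z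
  *≈ˡ {x} p = ext (convolve-cong {coeff x} (λ _ → refl) (at p))

  *≈ʳ : ∀ {x y z} → y ≈ z → y * x ≈ z * x
  *≈ʳ {x} p = ext (convolve-cong {y = coeff x} (at p) (λ _ → refl))

  const-homo : CommutativeRing.rawRing ℤₚ.+-*-commutativeRing -Raw-AlmostCommutative⟶ fromCommutativeRing ℤ[[t]]
  const-homo = record
    { ⟦_⟧ = const
    ; +-homo = λ a b → ext λ { zero → refl ; (suc _) → refl }
    ; *-homo = λ a b → ext λ { zero → refl ; (suc n) → sym (trans (convolve-constˡ a _ (suc n)) (ℤₚ.*-zeroʳ a)) }
    ; -‿homo = λ a → ext λ { zero → refl ; (suc _) → refl }
    ; 0-homo = ℤ[[t]].refl
    ; 1-homo = ℤ[[t]].refl }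

  const-≟ : ∀ a b → Maybe (const a ≈ const b)
  const-≟ a b with a ℤ.≟ b
  ... | yes refl = just ℤ[[t]].refl
  ... | no _     = nothing

  module Solver = Algebra.Solver.Ring _ (fromCommutativeRing ℤ[[t]]) const-homo const-≟

  t 1# 0# : Series
  1# = const (+ 1)
  0# = const (+ 0)
  coeff t zero    = + 0
  coeff t (suc n) = coeff 1# n

-- Gamma-positive polynomials and the Eulerian recursion.

module GammaPositive where
  open PowerSeries
  open Solver using (solve; _:=_; _:+_; _:*_; _:-_; :-_; con)
  open ℤ[[t]] using () renaming
    (refl to ≈-refl; sym to ≈-sym; trans to ≈-trans; +-cong to +≈; *-cong to *≈)
  open Relation.Binary.Reasoning.Setoid ℤ[[t]].setoid

  coeff-1* : ∀ x n → coeff (1# * x) n ≡ coeff x n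
  coeff-1* x n = trans (convolve-constˡ (+ 1) (coeff x) n) (ℤₚ.*-identityˡ _)

  coeff-t*-zero : ∀ x → coeff (t * x) 0 ≡ + 0
  coeff-t*-zero x = ℤₚ.*-zeroˡ (coeff x 0)

  coeff-t*-suc : ∀ x n → coeff (t * x) (suc n) ≡ coeff x n
  coeff-t*-suc x n = trans (cong (ℤ._+ convolve (coeff 1#) (coeff x) n) (ℤₚ.*-zeroˡ (coeff x (suc n))))
    (trans (ℤₚ.+-identityˡ _) (coeff-1* x n))

  t-cancel : ∀ {x y} → t * x ≈ t * y → x ≈ y
  t-cancel {x} {y} p = ext λ n → trans (sym (coeff-t*-suc x n)) (trans (at p (suc n)) (coeff-t*-suc y n))

  -- The derivation t d/dt.
  θ : Series → Series
  coeff (θ x) n = + n ℤ.* coeff x n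

  θ-cong : ∀ {x y} → x ≈ y → θ x ≈ θ y
  θ-cong p = ext λ n → cong (ℤ._*_ (+ n)) (at p n)

  θ-+ : ∀ x y → θ (x + y) ≈ θ x + θ y
  θ-+ x y = ext λ n → ℤₚ.*-distribˡ-+ (+ n) (coeff x n) (coeff y n)

  θ-* : ∀ x y → θ (x * y) ≈ θ x * y + x * θ y
  θ-* x y = ext (convolve-θ (coeff x) (coeff y))

  θ-0 : θ 0# ≈ 0#
  θ-0 = ext λ { zero → refl ; (suc n) → ℤₚ.*-zeroʳ (+ suc n) }

  θ-1 : θ 1# ≈ 0#
  θ-1 = ext λ { zero → refl ; (suc n) → ℤₚ.*-zeroʳ (+ suc n) }

  θ-t : θ t ≈ t
  θ-t = ext λ { zero → refl ; (suc zero) → refl ; (suc (suc n)) → ℤₚ.*-zeroʳ (+ suc (suc n)) }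

  1+t 1-t : Series
  1+t = 1# + t
  1-t = 1# + - t

  [1-t]^ : ℕ → Series
  [1-t]^ zero    = 1#
  [1-t]^ (suc n) = 1-t * [1-t]^ n

  [1-t]^-+ : ∀ m n → [1-t]^ (m ℕ.+ n) ≈ [1-t]^ m * [1-t]^ n
  [1-t]^-+ zero    n = ≈-sym (ℤ[[t]].*-identityˡ ([1-t]^ n))
  [1-t]^-+ (suc m) n = ≈-trans (*≈ˡ ([1-t]^-+ m n)) (≈-sym (ℤ[[t]].*-assoc 1-t ([1-t]^ m) ([1-t]^ n)))

  -- Pos s e x: x is an ℕ-combination of the t^a (1+t)^b with 2a + b + s = e.  With s = 1, e is the length of the
  -- coefficient sequence, so that Pos 1 0 contains only the zero series.
  data Pos (s : ℕ) : ℕ → Series → Set where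
    unit  : Pos s s 1#
    zero  : ∀ {e} → Pos s e 0#
    add   : ∀ {e x y} → Pos s e x → Pos s e y → Pos s e (x + y)
    1+t*_ : ∀ {e x} → Pos s e x → Pos s (suc e) (1+t * x)
    t*_   : ∀ {e x} → Pos s e x → Pos s (suc (suc e)) (t * x)
    resp  : ∀ {e x y} → x ≈ y → Pos s e x → Pos s e y

  Pos-* : ∀ {s e f x y} → Pos 0 e x → Pos s f y → Pos s (e ℕ.+ f) (x * y)
  Pos-* {y = y} unit q = resp (≈-sym (ℤ[[t]].*-identityˡ y)) q
  Pos-* {y = y} zero q = resp (≈-sym (ℤ[[t]].zeroˡ y)) zero
  Pos-* {y = y} (add {x = x} {x′} p p′) q = resp (≈-sym (ℤ[[t]].distribʳ y x x′)) (add (Pos-* p q) (Pos-* p′ q))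
  Pos-* {y = y} (1+t*_ {x = x} p) q = resp (≈-sym (ℤ[[t]].*-assoc 1+t x y)) (1+t* (Pos-* p q))
  Pos-* {y = y} (t*_ {x = x} p) q = resp (≈-sym (ℤ[[t]].*-assoc t x y)) (t* (Pos-* p q))
  Pos-* (resp r p) q = resp (*≈ʳ r) (Pos-* p q)

  Pos-0 : ∀ {e x} → Pos (suc e) 0 x → x ≈ 0#
  Pos-0 zero = ≈-refl
  Pos-0 (add p q) = ≈-trans (+≈ (Pos-0 p) (Pos-0 q)) (ℤ[[t]].+-identityˡ 0#)
  Pos-0 (resp r p) = ≈-trans (≈-sym r) (Pos-0 p)

  const-suc : ∀ m → const (+ suc m) ≈ 1# + const (+ m)
  const-suc m = ext λ { zero → refl ; (suc _) → refl }

  -- If x = (1-t)^(e+2) f then eulerStep e x = (1-t)^(e+3) (f + θ f); this is the recursion of the Eulerian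
  -- polynomials, which are (1-t)^(b+1) κ b.
  eulerStep : ℕ → Series → Series
  eulerStep e x = (1# + const (+ suc e) * t) * x + 1-t * θ x

  eulerStep-cong : ∀ e {x y} → x ≈ y → eulerStep e x ≈ eulerStep e y
  eulerStep-cong e p = +≈ (*≈ˡ p) (*≈ˡ (θ-cong p))

  -- Since θ is a derivation, the step sends (1+t)x to (1+t) times the step of x plus 2tx, and tx to
  -- t times (the step of x plus (1+t)x). No minus sign survives, although `1-t` occurs in the
  -- definition.
  Pos-eulerStep : ∀ {e x} → Pos 0 e x → Pos 0 (suc e) (eulerStep e x)
  Pos-eulerStep unit = resp
    (begin
      1+t * 1#                                     ≈⟨ solve 1 (λ t → (con (+ 1) :+ t) :* con (+ 1) :=
                                                        (con (+ 1) :+ con (+ 1) :* t) :* con (+ 1) :+ (con (+ 1) :- t) :* con (+ 0)) ≈-refl t ⟩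
      (1# + 1# * t) * 1# + 1-t * 0#                ≈⟨ +≈ˡ (*≈ˡ (≈-sym θ-1)) ⟩
      eulerStep 0 1#                               ∎)
    (1+t* unit)
  Pos-eulerStep {e} zero = resp
    (≈-sym (begin
      eulerStep e 0#                               ≈⟨ +≈ˡ (*≈ˡ θ-0) ⟩
      (1# + const (+ suc e) * t) * 0# + 1-t * 0#   ≈⟨ solve 2 (λ t m → (con (+ 1) :+ m :* t) :* con (+ 0) :+ (con (+ 1) :- t) :* con (+ 0) := con (+ 0)) ≈-refl t (const (+ suc e)) ⟩
      0#                                           ∎))
    zero
  Pos-eulerStep {e} (add {x = x} {y} p q) = resp
    (≈-sym (begin
      eulerStep e (x + y)  ≈⟨ +≈ˡ (*≈ˡ (θ-+ x y)) ⟩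
      _                    ≈⟨ solve 6 (λ a b x y u v → a :* (x :+ y) :+ b :* (u :+ v) := (a :* x :+ b :* u) :+ (a :* y :+ b :* v))
                                ≈-refl (1# + const (+ suc e) * t) 1-t x y (θ x) (θ y) ⟩
      eulerStep e x + eulerStep e y ∎))
    (add (Pos-eulerStep p) (Pos-eulerStep q))
  Pos-eulerStep (1+t*_ {e} {x} p) = resp
    (≈-sym (begin
      eulerStep (suc e) (1+t * x)
        ≈⟨ +≈ (*≈ʳ (+≈ˡ (*≈ʳ (const-suc (suc e)))))
              (*≈ˡ (≈-trans (θ-* 1+t x) (+≈ʳ (*≈ʳ (≈-trans (θ-+ 1# t) (+≈ θ-1 θ-t)))))) ⟩
      (1# + (1# + const (+ suc e)) * t) * (1+t * x) + 1-t * ((0# + t) * x + 1+t * θ x)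
        ≈⟨ solve 4 (λ t m x u → (con (+ 1) :+ (con (+ 1) :+ m) :* t) :* ((con (+ 1) :+ t) :* x)
                      :+ (con (+ 1) :- t) :* ((con (+ 0) :+ t) :* x :+ (con (+ 1) :+ t) :* u) :=
                    (con (+ 1) :+ t) :* ((con (+ 1) :+ m :* t) :* x :+ (con (+ 1) :- t) :* u) :+ (t :* x :+ t :* x))
             ≈-refl t (const (+ suc e)) x (θ x) ⟩
      1+t * eulerStep e x + (t * x + t * x) ∎))
    (add (1+t* Pos-eulerStep p) (add (t* p) (t* p)))
  Pos-eulerStep (t*_ {e} {x} p) = resp
    (≈-sym (begin
      eulerStep (suc (suc e)) (t * x)
        ≈⟨ +≈ (*≈ʳ (+≈ˡ (*≈ʳ (≈-trans (const-suc (suc (suc e))) (+≈ˡ (const-suc (suc e)))))))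
              (*≈ˡ (≈-trans (θ-* t x) (+≈ʳ (*≈ʳ θ-t)))) ⟩
      (1# + (1# + (1# + const (+ suc e))) * t) * (t * x) + 1-t * (t * x + t * θ x)
        ≈⟨ solve 4 (λ t m x u → (con (+ 1) :+ (con (+ 1) :+ (con (+ 1) :+ m)) :* t) :* (t :* x)
                      :+ (con (+ 1) :- t) :* (t :* x :+ t :* u) :=
                    t :* (((con (+ 1) :+ m :* t) :* x :+ (con (+ 1) :- t) :* u) :+ (con (+ 1) :+ t) :* x))
             ≈-refl t (const (+ suc e)) x (θ x) ⟩
      t * (eulerStep e x + 1+t * x) ∎))
    (t* add (Pos-eulerStep p) (1+t* p))
  Pos-eulerStep {e} (resp r p) = resp (eulerStep-cong e r) (Pos-eulerStep p)

  -- The extra factor `1-t` on the left avoids the exponent n - 1, so n = 0 is no exception.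
  θ-[1-t]^ : ∀ n → 1-t * θ ([1-t]^ n) ≈ - (const (+ n) * (t * [1-t]^ n))
  θ-[1-t]^ zero = begin
    1-t * θ 1#               ≈⟨ *≈ˡ θ-1 ⟩
    1-t * 0#                 ≈⟨ solve 1 (λ t → (con (+ 1) :- t) :* con (+ 0) := :- (con (+ 0) :* (t :* con (+ 1)))) ≈-refl t ⟩
    - (0# * (t * 1#))        ∎
  θ-[1-t]^ (suc n) = begin
    1-t * θ (1-t * [1-t]^ n)
      ≈⟨ *≈ˡ (≈-trans (θ-* 1-t ([1-t]^ n)) (+≈ʳ (*≈ʳ θ-1-t))) ⟩
    1-t * (- t * [1-t]^ n + 1-t * θ ([1-t]^ n))
      ≈⟨ *≈ˡ (+≈ˡ (θ-[1-t]^ n)) ⟩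
    1-t * (- t * [1-t]^ n + - (const (+ n) * (t * [1-t]^ n)))
      ≈⟨ solve 3 (λ t m x → (con (+ 1) :- t) :* ((:- t) :* x :+ :- (m :* (t :* x))) :=
                   :- ((con (+ 1) :+ m) :* (t :* ((con (+ 1) :- t) :* x)))) ≈-refl t (const (+ n)) ([1-t]^ n) ⟩
    - ((1# + const (+ n)) * (t * (1-t * [1-t]^ n)))
      ≈⟨ ℤ[[t]].-‿cong (*≈ʳ (≈-sym (const-suc n))) ⟩
    - (const (+ suc n) * (t * (1-t * [1-t]^ n))) ∎
    where
    θ-1-t : θ 1-t ≈ - t
    θ-1-t = ext λ { zero → refl ; (suc zero) → refl ; (suc (suc n)) → ℤₚ.*-zeroʳ (+ suc (suc n)) }

  κ : ℕ → Series
  coeff (κ b) n = (+ suc n) ℤ.^ b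

  κ-suc : ∀ b → κ (suc b) ≈ κ b + θ (κ b)
  κ-suc b = ext λ n → lemma (+ n) _
    where
    lemma : ∀ n x → (+ 1 ℤ.+ n) ℤ.* x ≡ x ℤ.+ n ℤ.* x
    lemma = solve-∀

  1-t* : ∀ x → 1-t * x ≈ x + - (t * x)
  1-t* x = solve 2 (λ t x → (con (+ 1) :- t) :* x := x :- t :* x) ≈-refl t x

  1-t*κ0 : 1-t * κ 0 ≈ 1#
  1-t*κ0 = ≈-trans (1-t* (κ 0))
    (ext λ { zero    → cong (λ z → + 1 ℤ.+ ℤ.- z) (coeff-t*-zero (κ 0))
           ; (suc n) → cong (λ z → + 1 ℤ.+ ℤ.- z) (coeff-t*-suc (κ 0) n) })

  1-t*κ1 : 1-t * κ 1 ≈ κ 0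
  1-t*κ1 = ≈-trans (1-t* (κ 1))
    (ext λ { zero    → cong (λ z → + 1 ℤ.+ ℤ.- z) (coeff-t*-zero (κ 1))
           ; (suc n) → trans (cong (λ z → + suc (suc n) ℤ.* + 1 ℤ.+ ℤ.- z) (coeff-t*-suc (κ 1) n)) (lemma (+ n)) })
    where
    lemma : ∀ n → (+ 1 ℤ.+ (+ 1 ℤ.+ n)) ℤ.* + 1 ℤ.+ ℤ.- ((+ 1 ℤ.+ n) ℤ.* + 1) ≡ + 1
    lemma = solve-∀

  eulerStep-[1-t]^ : ∀ e f → eulerStep e ([1-t]^ (2 ℕ.+ e) * f) ≈ [1-t]^ (3 ℕ.+ e) * (f + θ f)
  eulerStep-[1-t]^ e f = begin
    eulerStep e (P * f)
      ≈⟨ +≈ˡ (*≈ˡ (θ-* P f)) ⟩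
    (1# + M * t) * (P * f) + 1-t * (θ P * f + P * θ f)
      ≈⟨ solve 6 (λ t m p f dp df → (con (+ 1) :+ m :* t) :* (p :* f) :+ (con (+ 1) :- t) :* (dp :* f :+ p :* df) :=
                    (con (+ 1) :+ m :* t) :* (p :* f) :+ (((con (+ 1) :- t) :* dp) :* f :+ (con (+ 1) :- t) :* (p :* df)))
           ≈-refl t M P f (θ P) (θ f) ⟩
    (1# + M * t) * (P * f) + (1-t * θ P * f + 1-t * (P * θ f))
      ≈⟨ +≈ˡ (+≈ʳ (*≈ʳ (≈-trans (θ-[1-t]^ (2 ℕ.+ e)) (ℤ[[t]].-‿cong (*≈ʳ (const-suc (suc e))))))) ⟩
    (1# + M * t) * (P * f) + (- ((1# + M) * (t * P)) * f + 1-t * (P * θ f))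
      ≈⟨ solve 5 (λ t m p f df → (con (+ 1) :+ m :* t) :* (p :* f) :+ ((:- ((con (+ 1) :+ m) :* (t :* p))) :* f
                     :+ (con (+ 1) :- t) :* (p :* df)) := ((con (+ 1) :- t) :* p) :* (f :+ df))
           ≈-refl t M P f (θ f) ⟩
    1-t * P * (f + θ f) ∎
    where
    P = [1-t]^ (2 ℕ.+ e)
    M = const (+ suc e)

  -- Gamma-positivity of the Eulerian polynomials, by their recursion: f + θ f raises the exponent
  -- of n + 1 in `κ` by one. The index starts at 1 because κ 0 = 1/(1-t) breaks the pattern of
  -- degrees and pole orders; empty deletions are split off for this reason below.
  eulerian-Pos : ∀ b → Pos 0 b ([1-t]^ (2 ℕ.+ b) * κ (suc b))
  eulerian-Pos zero = resp (≈-sym (begin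
    [1-t]^ 2 * κ 1
      ≈⟨ solve 2 (λ u x → (u :* (u :* con (+ 1))) :* x := u :* (u :* x)) ≈-refl 1-t (κ 1) ⟩
    1-t * (1-t * κ 1)
      ≈⟨ *≈ˡ 1-t*κ1 ⟩
    1-t * κ 0
      ≈⟨ 1-t*κ0 ⟩
    1# ∎)) unit
  eulerian-Pos (suc b) = resp (≈-trans (eulerStep-[1-t]^ b (κ (suc b))) (*≈ˡ (≈-sym (κ-suc (suc b))))) (Pos-eulerStep (eulerian-Pos b))

-- Sums over the deletions of a subset of vertices.

module SubsetSums where
  Subset : ℕ → Set
  Subset = Vec Bool

  full : ∀ d → Subset d
  full d = replicate d true

  size : ∀ {d} → Subset d → ℕ
  size []          = 0
  size (true ∷ S)  = suc (size S)
  size (false ∷ S) = size S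

  size-full : ∀ d → size (full d) ≡ d
  size-full zero    = refl
  size-full (suc d) = cong suc (size-full d)

  -- Removal M S b S′: S′ arises from S by deleting b elements, all of which lie in M.
  data Removal : ∀ {d} → Subset d → Subset d → ℕ → Subset d → Set where
    []   : Removal [] [] 0 []
    keep : ∀ {d m s b} {M S S′ : Subset d} → Removal M S b S′ → Removal (m ∷ M) (s ∷ S) b (s ∷ S′)
    drop : ∀ {d b} {M S S′ : Subset d} → Removal M S b S′ → Removal (true ∷ M) (true ∷ S) (suc b) (false ∷ S′)

  Removal-size : ∀ {d b} {M S S′ : Subset d} → Removal M S b S′ → b ℕ.+ size S′ ≡ size S
  Removal-size []                             = refl
  Removal-size (keep {s = true} {b = b} r)    = ≡.trans (ℕₚ.+-suc b _) (cong suc (Removal-size r))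
  Removal-size (keep {s = false} r)           = Removal-size r
  Removal-size (drop r)                       = cong suc (Removal-size r)

  Removal-⊆ : ∀ {d b} {M S S′ : Subset d} → Removal M S b S′ → ∀ i → lookup S′ i ≡ true → lookup S i ≡ true
  Removal-⊆ (keep r) zero    p = p
  Removal-⊆ (keep r) (suc i) p = Removal-⊆ r i p
  Removal-⊆ (drop r) (suc i) p = Removal-⊆ r i p

  Removal-mask : ∀ {d b} {M S S′ : Subset d} → Removal M S b S′ →
                 ∀ i → lookup S i ≡ true → lookup S′ i ≡ false → lookup M i ≡ true
  Removal-mask (keep {s = true} r)  zero _  ()
  Removal-mask (keep {s = false} r) zero () _
  Removal-mask (drop r) zero    _ _ = refl
  Removal-mask (keep r) (suc i) p q = Removal-mask r i p q
  Removal-mask (drop r) (suc i) p q = Removal-mask r i p q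

  module SubsetSum (𝓜 : CommutativeMonoid 0ℓ 0ℓ) where
    open CommutativeMonoid 𝓜 renaming (Carrier to X; refl to ≈-refl; sym to ≈-sym; trans to ≈-trans)
    open Algebra.Properties.CommutativeSemigroup commutativeSemigroup using (interchange)
    open Relation.Binary.Reasoning.Setoid setoid

    -- the sum of F ∣U∣ (S ∖ U) over all U ⊆ M ∩ S
    sumSub : ∀ {d} → Subset d → Subset d → (ℕ → Subset d → X) → X
    sumSub []          []          F = F 0 []
    sumSub (false ∷ M) (s ∷ S)     F = sumSub M S (λ b S′ → F b (s ∷ S′))
    sumSub (true ∷ M)  (false ∷ S) F = sumSub M S (λ b S′ → F b (false ∷ S′))
    sumSub (true ∷ M)  (true ∷ S)  F =
      sumSub M S (λ b S′ → F b (true ∷ S′)) ∙ sumSub M S (λ b S′ → F (suc b) (false ∷ S′))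

    -- The index type `I` lets a single induction treat properties that relate several sums: two
    -- sides of a congruence, or the even and the odd series with a common decomposition.
    sumSub-closed : ∀ {I : Set} (P : (I → X) → Set) → (∀ {x y} → P x → P y → P (λ i → x i ∙ y i)) →
      ∀ {d} (M S : Subset d) {F : I → ℕ → Subset d → X} →
      (∀ {b S′} → Removal M S b S′ → P (λ i → F i b S′)) → P (λ i → sumSub M S (F i))
    sumSub-closed P add []          []          p = p []
    sumSub-closed P add (false ∷ M) (s ∷ S)     p = sumSub-closed P add M S (λ r → p (keep r))
    sumSub-closed P add (true ∷ M)  (false ∷ S) p = sumSub-closed P add M S (λ r → p (keep r))
    sumSub-closed P add (true ∷ M)  (true ∷ S)  p =
      add (sumSub-closed P add M S (λ r → p (keep r))) (sumSub-closed P add M S (λ r → p (drop r)))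

    sumSub-cong : ∀ {d} (M S : Subset d) {F G : ℕ → Subset d → X} →
      (∀ {b S′} → Removal M S b S′ → F b S′ ≈ G b S′) → sumSub M S F ≈ sumSub M S G
    sumSub-cong M S {F} {G} p =
      sumSub-closed (λ x → x true ≈ x false) ∙-cong M S {λ { true → F ; false → G }} p

    sumSub-ε : ∀ {d} (M S : Subset d) → sumSub M S (λ _ _ → ε) ≈ ε
    sumSub-ε M S = sumSub-closed (λ x → x true ≈ ε) (λ p q → ≈-trans (∙-cong p q) (identityˡ ε)) M S {λ (_ : Bool) _ _ → ε} (λ _ → ≈-refl)

    sumSub-∙ : ∀ {d} (M S : Subset d) (F G : ℕ → Subset d → X) →
      sumSub M S (λ b S′ → F b S′ ∙ G b S′) ≈ sumSub M S F ∙ sumSub M S G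
    sumSub-∙ []          []          F G = ≈-refl
    sumSub-∙ (false ∷ M) (s ∷ S)     F G = sumSub-∙ M S _ _
    sumSub-∙ (true ∷ M)  (false ∷ S) F G = sumSub-∙ M S _ _
    sumSub-∙ (true ∷ M)  (true ∷ S)  F G = ≈-trans (∙-cong (sumSub-∙ M S _ _) (sumSub-∙ M S _ _)) (interchange _ _ _ _)

    sumSub-hom : (h : X → X) → (∀ x y → h (x ∙ y) ≈ h x ∙ h y) →
      ∀ {d} (M S : Subset d) (F : ℕ → Subset d → X) → h (sumSub M S F) ≈ sumSub M S (λ b S′ → h (F b S′))
    sumSub-hom h +h []          []          F = ≈-refl
    sumSub-hom h +h (false ∷ M) (s ∷ S)     F = sumSub-hom h +h M S _
    sumSub-hom h +h (true ∷ M)  (false ∷ S) F = sumSub-hom h +h M S _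
    sumSub-hom h +h (true ∷ M)  (true ∷ S)  F =
      ≈-trans (+h _ _) (∙-cong (sumSub-hom h +h M S _) (sumSub-hom h +h M S _))

    sumSub-mask : ∀ {d} (M M′ S : Subset d) (F : ℕ → Subset d → X) →
      (∀ i → lookup S i ≡ true → lookup M i ≡ lookup M′ i) → sumSub M S F ≡ sumSub M′ S F
    sumSub-mask [] [] [] F p = refl
    sumSub-mask (m ∷ M) (m′ ∷ M′) (true ∷ S) F p with m | m′ | p zero refl
    ... | false | .false | refl = sumSub-mask M M′ S _ (λ i → p (suc i))
    ... | true  | .true  | refl = ≡.cong₂ _∙_ (sumSub-mask M M′ S _ (λ i → p (suc i))) (sumSub-mask M M′ S _ (λ i → p (suc i)))
    sumSub-mask (false ∷ M) (false ∷ M′) (false ∷ S) F p = sumSub-mask M M′ S _ (λ i → p (suc i))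
    sumSub-mask (false ∷ M) (true  ∷ M′) (false ∷ S) F p = sumSub-mask M M′ S _ (λ i → p (suc i))
    sumSub-mask (true  ∷ M) (false ∷ M′) (false ∷ S) F p = sumSub-mask M M′ S _ (λ i → p (suc i))
    sumSub-mask (true  ∷ M) (true  ∷ M′) (false ∷ S) F p = sumSub-mask M M′ S _ (λ i → p (suc i))

    sumSub-none : ∀ {d} (M S : Subset d) (F : ℕ → Subset d → X) → (∀ i → lookup M i ≡ false) → sumSub M S F ≡ F 0 S
    sumSub-none []          []      F p = refl
    sumSub-none (false ∷ M) (s ∷ S) F p = sumSub-none M S _ (λ i → p (suc i))
    sumSub-none (true ∷ M)  S       F p with () ← p zero

    positive : ∀ {d} → (ℕ → Subset d → X) → ℕ → Subset d → X
    positive F zero    _ = ε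
    positive F (suc b) S = F (suc b) S

    sumSub-split : ∀ {d} (M S : Subset d) (F : ℕ → Subset d → X) →
      sumSub M S F ≈ F 0 S ∙ sumSub M S (positive F)
    sumSub-split [] [] F = ≈-sym (identityʳ _)
    sumSub-split (false ∷ M) (s ∷ S) F =
      ≈-trans (sumSub-split M S _) (∙-congˡ (sumSub-cong M S λ { {zero} _ → ≈-refl ; {suc b} _ → ≈-refl }))
    sumSub-split (true ∷ M) (false ∷ S) F =
      ≈-trans (sumSub-split M S _) (∙-congˡ (sumSub-cong M S λ { {zero} _ → ≈-refl ; {suc b} _ → ≈-refl }))
    sumSub-split (true ∷ M) (true ∷ S) F = ≈-trans
      (∙-congʳ (≈-trans (sumSub-split M S _) (∙-congˡ (sumSub-cong M S λ { {zero} _ → ≈-refl ; {suc b} _ → ≈-refl }))))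
      (assoc _ _ _)

    -- This is the sum over k of (b choose k) copies of `F k S`, unfolded by Pascal's rule.
    binomial : ∀ {d} → (ℕ → Subset d → X) → ℕ → Subset d → X
    binomial F zero    S = F 0 S
    binomial F (suc b) S = binomial F b S ∙ binomial (λ k → F (suc k)) b S

    binomial-∘ : ∀ {d e} (g : Subset e → Subset d) (F : ℕ → Subset d → X) b S →
      binomial F b (g S) ≡ binomial (λ k S → F k (g S)) b S
    binomial-∘ g F zero    S = refl
    binomial-∘ g F (suc b) S = ≡.cong₂ _∙_ (binomial-∘ g F b S) (binomial-∘ g _ b S)

    -- Two successive deletions are one deletion of b elements together with the choice of the k
    -- elements that went in the second round; there are (b choose k) such choices.
    sumSub-sumSub : ∀ {d} (M S : Subset d) (F : ℕ → Subset d → X) →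
      sumSub M S (λ _ S′ → sumSub M S′ F) ≈ sumSub M S (binomial F)
    sumSub-sumSub [] [] F = ≈-refl
    sumSub-sumSub (false ∷ M) (s ∷ S) F =
      ≈-trans (sumSub-sumSub M S _) (sumSub-cong M S λ {b} {S′} _ → reflexive (≡.sym (binomial-∘ (s ∷_) F b S′)))
    sumSub-sumSub (true ∷ M) (false ∷ S) F =
      ≈-trans (sumSub-sumSub M S _) (sumSub-cong M S λ {b} {S′} _ → reflexive (≡.sym (binomial-∘ (false ∷_) F b S′)))
    sumSub-sumSub (true ∷ M) (true ∷ S) F = begin
      sumSub M S (λ _ S′ → sumSub M S′ (λ b T → F b (true ∷ T)) ∙ sumSub M S′ (λ b T → F (suc b) (false ∷ T)))
        ∙ sumSub M S (λ _ S′ → sumSub M S′ (λ b T → F b (false ∷ T)))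
        ≈⟨ ∙-congʳ (sumSub-∙ M S _ _) ⟩
      (sumSub M S (λ _ S′ → sumSub M S′ (λ b T → F b (true ∷ T)))
        ∙ sumSub M S (λ _ S′ → sumSub M S′ (λ b T → F (suc b) (false ∷ T))))
        ∙ sumSub M S (λ _ S′ → sumSub M S′ (λ b T → F b (false ∷ T)))
        ≈⟨ ∙-cong (∙-cong (sumSub-sumSub M S _) (sumSub-sumSub M S _)) (sumSub-sumSub M S _) ⟩
      (sumSub M S (binomial (λ b T → F b (true ∷ T)))
        ∙ sumSub M S (binomial (λ b T → F (suc b) (false ∷ T))))
        ∙ sumSub M S (binomial (λ b T → F b (false ∷ T)))
        ≈⟨ assoc _ _ _ ⟩
      sumSub M S (binomial (λ b T → F b (true ∷ T)))
        ∙ (sumSub M S (binomial (λ b T → F (suc b) (false ∷ T)))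
          ∙ sumSub M S (binomial (λ b T → F b (false ∷ T))))
        ≈⟨ ∙-congˡ (≈-trans (comm _ _) (≈-sym (sumSub-∙ M S _ _))) ⟩
      sumSub M S (binomial (λ b T → F b (true ∷ T)))
        ∙ sumSub M S (λ b T → binomial (λ b T → F b (false ∷ T)) b T ∙ binomial (λ b T → F (suc b) (false ∷ T)) b T)
        ≈⟨ ∙-cong (sumSub-cong M S λ {b} {S′} _ → reflexive (≡.sym (binomial-∘ (true ∷_) F b S′)))
                  (sumSub-cong M S λ {b} {S′} _ → ∙-cong (reflexive (≡.sym (binomial-∘ (false ∷_) F b S′)))
                                                         (reflexive (≡.sym (binomial-∘ (false ∷_) _ b S′)))) ⟩
      sumSub M S (λ b T → binomial F b (true ∷ T)) ∙ sumSub M S (λ b T → binomial F (suc b) (false ∷ T)) ∎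

    -- Every deletion that touches an element outside `M` contributes `ε`. This cuts the choice of
    -- vertices with the largest coordinate down to the isolated ones.
    sumSub-restrict : ∀ {d} (M S : Subset d) (F G : ℕ → Subset d → X) →
      (∀ {b S′} → Removal M S b S′ → F b S′ ≈ G b S′) →
      (∀ {b S′} → Removal (full d) S b S′ → ∀ i → lookup S i ≡ true → lookup S′ i ≡ false → lookup M i ≡ false → F b S′ ≈ ε) →
      sumSub (full d) S F ≈ sumSub M S G
    sumSub-restrict [] [] F G p q = p []
    sumSub-restrict (false ∷ M) (true ∷ S) F G p q = ≈-trans
      (∙-cong (sumSub-restrict M S _ _ (λ r → p (keep r)) (λ r i → q (keep r) (suc i)))
              (≈-trans (sumSub-cong (full _) S λ r → q (drop r) zero refl refl refl) (sumSub-ε (full _) S)))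
      (identityʳ _)
    sumSub-restrict (true ∷ M) (true ∷ S) F G p q = ∙-cong
      (sumSub-restrict M S _ _ (λ r → p (keep r)) (λ r i → q (keep r) (suc i)))
      (sumSub-restrict M S _ _ (λ r → p (drop r)) (λ r i → q (drop r) (suc i)))
    sumSub-restrict (false ∷ M) (false ∷ S) F G p q = sumSub-restrict M S _ _ (λ r → p (keep r)) (λ r i → q (keep r) (suc i))
    sumSub-restrict (true ∷ M)  (false ∷ S) F G p q = sumSub-restrict M S _ _ (λ r → p (keep r)) (λ r i → q (keep r) (suc i))

-- Lattice points and their outermost layer.

module LatticePoints where
  open SubsetSums

  module ℤΣ = SubsetSum ℤₚ.+-0-commutativeMonoid

  sumTo : ℕ → (ℕ → ℤ) → ℤ
  sumTo zero    f = + 0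
  sumTo (suc n) f = f 0 ℤ.+ sumTo n (λ k → f (suc k))

  sumTo-cong : ∀ n {f g} → (∀ k → k ℕ.< n → f k ≡ g k) → sumTo n f ≡ sumTo n g
  sumTo-cong zero    p = refl
  sumTo-cong (suc n) p = cong₂ ℤ._+_ (p 0 (s≤s z≤n)) (sumTo-cong n (λ k k<n → p (suc k) (s≤s k<n)))

  sumTo-last : ∀ n f → sumTo (suc n) f ≡ sumTo n f ℤ.+ f n
  sumTo-last zero    f = ℤₚ.+-comm (f 0) (+ 0)
  sumTo-last (suc n) f = trans (cong (ℤ._+_ (f 0)) (sumTo-last n (λ k → f (suc k)))) (sym (ℤₚ.+-assoc (f 0) _ _))

  sumTo-zero : ∀ n → sumTo n (λ _ → + 0) ≡ + 0
  sumTo-zero zero    = refl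
  sumTo-zero (suc n) = trans (ℤₚ.+-identityˡ _) (sumTo-zero n)

  sumSub-sumTo : ∀ {d} (M S : Subset d) n (f : ℕ → ℕ → Subset d → ℤ) →
    ℤΣ.sumSub M S (λ b S′ → sumTo n (λ k → f k b S′)) ≡ sumTo n (λ k → ℤΣ.sumSub M S (f k))
  sumSub-sumTo M S zero    f = ℤΣ.sumSub-ε M S
  sumSub-sumTo M S (suc n) f =
    trans (ℤΣ.sumSub-∙ M S (f 0) _) (cong (ℤ._+_ (ℤΣ.sumSub M S (f 0))) (sumSub-sumTo M S n (λ k → f (suc k))))

  -- Vertices outside S keep the coordinate 0, with which every edge inequality holds automatically.
  boxSum : ∀ {d} → Subset d → ℕ → (Vec ℕ d → ℤ) → ℤ
  boxSum []          N F = F []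
  boxSum (true ∷ S)  N F = sumTo N (λ k → boxSum S N (λ x → F (k ∷ x)))
  boxSum (false ∷ S) N F = boxSum S N (λ x → F (0 ∷ x))

  data InBox (N : ℕ) : ∀ {d} → Subset d → Vec ℕ d → Set where
    []      : InBox N [] []
    inside  : ∀ {d k x} {S : Subset d} → k ℕ.< N → InBox N S x → InBox N (true ∷ S) (k ∷ x)
    outside : ∀ {d x} {S : Subset d} → InBox N S x → InBox N (false ∷ S) (0 ∷ x)

  boxSum-cong : ∀ {d} (S : Subset d) N {F G} → (∀ {x} → InBox N S x → F x ≡ G x) → boxSum S N F ≡ boxSum S N G
  boxSum-cong []          N p = p []
  boxSum-cong (true ∷ S)  N p = sumTo-cong N (λ k k<N → boxSum-cong S N (λ b → p (inside k<N b)))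
  boxSum-cong (false ∷ S) N p = boxSum-cong S N (λ b → p (outside b))

  boxSum-zero : ∀ {d} (S : Subset d) N → boxSum S N (λ _ → + 0) ≡ + 0
  boxSum-zero []          N = refl
  boxSum-zero (true ∷ S)  N = trans (sumTo-cong N (λ _ _ → boxSum-zero S N)) (sumTo-zero N)
  boxSum-zero (false ∷ S) N = boxSum-zero S N

  -- The original set is not an argument: a vertex outside it and a vertex just removed with
  -- coordinate 0 look the same.
  layer : ∀ {d} → Subset d → Subset d → ℕ → Vec ℕ d → Vec ℕ d
  layer []           []            N []       = []
  layer (_ ∷ S′)     (true ∷ S″)   N (y ∷ ys) = suc y ∷ layer S′ S″ N ys
  layer (true ∷ S′)  (false ∷ S″)  N (y ∷ ys) = suc N ∷ layer S′ S″ N ys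
  layer (false ∷ S′) (false ∷ S″)  N (y ∷ ys) = 0 ∷ layer S′ S″ N ys

  boxSum-layer : ∀ {d} (S : Subset d) N (F : Vec ℕ d → ℤ) → boxSum S (2 ℕ.+ N) F ≡
    ℤΣ.sumSub (full d) S λ _ S′ → ℤΣ.sumSub (full d) S′ λ _ S″ → boxSum S″ N λ y → F (layer S′ S″ N y)
  boxSum-layer []          N F = refl
  boxSum-layer (false ∷ S) N F = boxSum-layer S N (λ x → F (0 ∷ x))
  boxSum-layer {suc d} (true ∷ S) N F = begin
    g 0 ℤ.+ sumTo (suc N) (λ k → g (suc k))
      -- `sumSub` lists kept before deleted elements, so the values of the first coordinate must
      -- come in the order 1 to N, then N + 1, then 0.
      ≡⟨ cong (ℤ._+_ (g 0)) (sumTo-last N (λ k → g (suc k))) ⟩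
    g 0 ℤ.+ (sumTo N (λ k → g (suc k)) ℤ.+ g (suc N))
      ≡⟨ ℤₚ.+-comm (g 0) _ ⟩
    (sumTo N (λ k → g (suc k)) ℤ.+ g (suc N)) ℤ.+ g 0
      ≡⟨ cong₂ ℤ._+_ (cong₂ ℤ._+_ middle (boxSum-layer S N _)) (boxSum-layer S N _) ⟩
    (Σ S (λ _ S′ → Σ S′ (λ _ S″ → sumTo N (λ k → boxSum S″ N (λ y → F (suc k ∷ layer S′ S″ N y)))))
      ℤ.+ Σ S (λ _ S′ → Σ S′ (λ _ S″ → boxSum S″ N (λ y → F (suc N ∷ layer S′ S″ N y)))))
      ℤ.+ Σ S (λ _ S′ → Σ S′ (λ _ S″ → boxSum S″ N (λ y → F (0 ∷ layer S′ S″ N y))))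
      ≡⟨ cong (ℤ._+ Σ S (λ _ S′ → Σ S′ (λ _ S″ → boxSum S″ N (λ y → F (0 ∷ layer S′ S″ N y)))))
              (sym (ℤΣ.sumSub-∙ (full d) S _ _)) ⟩
    _ ∎
    where
    open ≡-Reasoning
    Σ : Subset d → (ℕ → Subset d → ℤ) → ℤ
    Σ = ℤΣ.sumSub (full d)
    g : ℕ → ℤ
    g k = boxSum S (2 ℕ.+ N) (λ x → F (k ∷ x))
    middle : sumTo N (λ k → g (suc k)) ≡
             Σ S (λ _ S′ → Σ S′ (λ _ S″ → sumTo N (λ k → boxSum S″ N (λ y → F (suc k ∷ layer S′ S″ N y)))))
    middle = trans (sumTo-cong N (λ k _ → boxSum-layer S N _))
      (trans (sym (sumSub-sumTo (full d) S N _))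
             (ℤΣ.sumSub-cong (full d) S λ {_} {S′} _ → sym (sumSub-sumTo (full d) S′ N _)))

  indicator : Bool → ℤ
  indicator b = if b then + 1 else + 0

  count : {X : Set} → (X → Bool) → List X → ℤ
  count p xs = + length (filterᵇ p xs)

  count-∷ : ∀ {X : Set} (p : X → Bool) x xs → count p (x ∷ xs) ≡ indicator (p x) ℤ.+ count p xs
  count-∷ p x xs with p x
  ... | true  = refl
  ... | false = sym (ℤₚ.+-identityˡ _)

  count-++ : ∀ {X : Set} (p : X → Bool) xs ys → count p (xs ++ ys) ≡ count p xs ℤ.+ count p ys
  count-++ p []       ys = sym (ℤₚ.+-identityˡ _)
  count-++ p (x ∷ xs) ys with p x
  ... | true  = cong (ℤ._+_ (+ 1)) (count-++ p xs ys)
  ... | false = count-++ p xs ys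

  count-map : ∀ {X Y : Set} (p : Y → Bool) (f : X → Y) xs → count p (map f xs) ≡ count (λ x → p (f x)) xs
  count-map p f []       = refl
  count-map p f (x ∷ xs) with p (f x)
  ... | true  = cong (ℤ._+_ (+ 1)) (count-map p f xs)
  ... | false = count-map p f xs

  count-concatMap : ∀ {X : Set} (p : X → Bool) (g : ℕ → List X) h n →
    count p (concatMap g (applyUpTo h n)) ≡ sumTo n (λ k → count p (g (h k)))
  count-concatMap p g h zero    = refl
  count-concatMap p g h (suc n) = trans (count-++ p (g (h 0)) _)
    (cong (ℤ._+_ (count p (g (h 0)))) (count-concatMap p g (λ k → h (suc k)) n))

  count-box : ∀ d n (p : Vec ℕ d → Bool) → count p (box d n) ≡ boxSum (full d) (suc n) (λ x → indicator (p x))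
  count-box zero    n p = trans (count-∷ p [] []) (ℤₚ.+-identityʳ _)
  count-box (suc d) n p = trans (count-concatMap p (λ k → map (k ∷_) (box d n)) id (suc n))
    (sumTo-cong (suc n) (λ k _ → trans (count-map p (k ∷_) (box d n)) (count-box d n (λ x → p (k ∷ x)))))

  ∧-true : ∀ {a b} → a ∧ b ≡ true → a ≡ true × b ≡ true
  ∧-true {true} {true} _ = refl , refl

  allᵇ⁻ : ∀ {n} {Y : Set} (p : Y → Bool) (f : Fin n → Y) → allᵇ p (List.tabulate f) ≡ true → ∀ i → p (f i) ≡ true
  allᵇ⁻ p f q zero    = proj₁ (∧-true q)
  allᵇ⁻ p f q (suc i) = allᵇ⁻ p (λ j → f (suc j)) (proj₂ (∧-true {p (f zero)} q)) i

  allᵇ⁺ : ∀ {n} {Y : Set} (p : Y → Bool) (f : Fin n → Y) → (∀ i → p (f i) ≡ true) → allᵇ p (List.tabulate f) ≡ true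
  allᵇ⁺ {zero}  p f q = refl
  allᵇ⁺ {suc n} p f q rewrite q zero = allᵇ⁺ p (λ j → f (suc j)) (λ j → q (suc j))

  allᵇ-false : ∀ {n} {Y : Set} (p : Y → Bool) (f : Fin n → Y) → allᵇ p (List.tabulate f) ≡ false → ∃[ i ] p (f i) ≡ false
  allᵇ-false {suc n} p f q with p (f zero) in eq
  ... | false = zero , eq
  ... | true with allᵇ-false p (λ j → f (suc j)) q
  ...   | i , r = suc i , r

  ≤ᵇ-true : ∀ {m n} → m ℕ.≤ n → (m ≤ᵇ n) ≡ true
  ≤ᵇ-true {m} {n} p with m ≤ᵇ n in eq
  ... | true  = refl
  ... | false = contradiction (subst T eq (ℕₚ.≤⇒≤ᵇ p)) id

  true-≤ᵇ : ∀ {m n} → (m ≤ᵇ n) ≡ true → m ℕ.≤ n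
  true-≤ᵇ {m} {n} p = ℕₚ.≤ᵇ⇒≤ m n (subst T (sym p) _)

  ≤ᵇ-false : ∀ {m n} → n ℕ.< m → (m ≤ᵇ n) ≡ false
  ≤ᵇ-false {m} {n} p with m ≤ᵇ n in eq
  ... | false = refl
  ... | true  = contradiction (true-≤ᵇ eq) (ℕₚ.<⇒≱ p)

  bool-iff : ∀ {a b} → (a ≡ true → b ≡ true) → (b ≡ true → a ≡ true) → a ≡ b
  bool-iff {true}  {b}     f g = sym (f refl)
  bool-iff {false} {true}  f g = g refl
  bool-iff {false} {false} f g = refl

  EdgeBound : ∀ {d} → Adj d → ℕ → Vec ℕ d → Set
  EdgeBound A n x = ∀ i j → A i j ≡ true → lookup x i ℕ.+ lookup x j ℕ.≤ n

  inFRAC⁻ : ∀ {d} (A : Adj d) n x → inDilatedFRAC A n x ≡ true → EdgeBound A n x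
  inFRAC⁻ A n x p i j e with allᵇ⁻ _ id (allᵇ⁻ _ id p i) j
  ... | q rewrite e = true-≤ᵇ q

  inFRAC⁺ : ∀ {d} (A : Adj d) n x → EdgeBound A n x → inDilatedFRAC A n x ≡ true
  inFRAC⁺ A n x p = allᵇ⁺ _ id λ i → allᵇ⁺ _ id λ j → edge i j
    where
    edge : ∀ i j → (not (A i j) ∨ (lookup x i ℕ.+ lookup x j ≤ᵇ n)) ≡ true
    edge i j with A i j in e
    ... | false = refl
    ... | true  = ≤ᵇ-true (p i j e)

  isolated : ∀ {d} → Adj d → Subset d → Subset d
  isolated {d} A S = tabulate λ i → allᵇ (λ j → not (A i j ∧ lookup S j)) (allFin d)

  isolated⁻ : ∀ {d} (A : Adj d) S i → lookup (isolated A S) i ≡ true → ∀ j → A i j ≡ true → lookup S j ≡ false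
  isolated⁻ A S i p j e with allᵇ⁻ _ id (trans (sym (lookup∘tabulate _ i)) p) j
  ... | q rewrite e with lookup S j
  ... | false = refl

  isolated⁺ : ∀ {d} (A : Adj d) S i → (∀ j → A i j ≡ true → lookup S j ≡ false) → lookup (isolated A S) i ≡ true
  isolated⁺ A S i p = trans (lookup∘tabulate _ i) (allᵇ⁺ _ id edge)
    where
    edge : ∀ j → not (A i j ∧ lookup S j) ≡ true
    edge j with A i j in e
    ... | false = refl
    ... | true rewrite p j e = refl

  isolated-false : ∀ {d} (A : Adj d) S i → lookup (isolated A S) i ≡ false → ∃[ j ] A i j ≡ true × lookup S j ≡ true
  isolated-false A S i p with allᵇ-false _ id (trans (sym (lookup∘tabulate _ i)) p)
  ... | j , q with A i j in e | lookup S j in s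
  ... | true | true = j , e , s

  -- A deleted vertex was isolated in S, hence not adjacent to i, which lies in S. So the surviving
  -- vertices lose no neighbour.
  isolated-removal : ∀ {d} (A : Adj d) → (∀ i j → A i j ≡ A j i) → ∀ {S S′ b} → Removal (isolated A S) S b S′ →
    ∀ i → lookup S′ i ≡ true → lookup (isolated A S) i ≡ lookup (isolated A S′) i
  isolated-removal A A-sym {S} {S′} r i i∈S′ = bool-iff
    (λ p → isolated⁺ A S′ i (λ j e → outside⊆ j (isolated⁻ A S i p j e)))
    (λ p → isolated⁺ A S i (λ j e → stays j e (isolated⁻ A S′ i p j e)))
    where
    outside⊆ : ∀ j → lookup S j ≡ false → lookup S′ j ≡ false
    outside⊆ j p with lookup S′ j in q
    ... | false = refl
    ... | true with () ← trans (sym p) (Removal-⊆ r j q)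
    stays : ∀ j → A i j ≡ true → lookup S′ j ≡ false → lookup S j ≡ false
    stays j e p with lookup S j in q
    ... | false = refl
    ... | true with () ← trans (sym (Removal-⊆ r i i∈S′))
                           (isolated⁻ A S j (Removal-mask r j q p) i (trans (A-sym j i) e))

  lookup-inside : ∀ {d N} {S : Subset d} {x} → InBox N S x → ∀ i → lookup S i ≡ true → lookup x i ℕ.< N
  lookup-inside (inside k<N _) zero    _ = k<N
  lookup-inside (inside _ b)   (suc i) p = lookup-inside b i p
  lookup-inside (outside b)    (suc i) p = lookup-inside b i p

  lookup-outside : ∀ {d N} {S : Subset d} {x} → InBox N S x → ∀ i → lookup S i ≡ false → lookup x i ≡ 0
  lookup-outside (inside _ b) (suc i) p = lookup-outside b i p
  lookup-outside (outside _)  zero    _ = refl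
  lookup-outside (outside b)  (suc i) p = lookup-outside b i p

  layer-middle : ∀ {d} (S′ S″ : Subset d) N y i → lookup S″ i ≡ true → lookup (layer S′ S″ N y) i ≡ suc (lookup y i)
  layer-middle (_ ∷ _)      (true ∷ _)   N (_ ∷ _)  zero    p = refl
  layer-middle (_ ∷ S′)     (true ∷ S″)  N (_ ∷ y)  (suc i) p = layer-middle S′ S″ N y i p
  layer-middle (true ∷ S′)  (false ∷ S″) N (_ ∷ y)  (suc i) p = layer-middle S′ S″ N y i p
  layer-middle (false ∷ S′) (false ∷ S″) N (_ ∷ y)  (suc i) p = layer-middle S′ S″ N y i p

  layer-top : ∀ {d} (S′ S″ : Subset d) N y i → lookup S′ i ≡ true → lookup S″ i ≡ false →
              lookup (layer S′ S″ N y) i ≡ suc N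
  layer-top (true ∷ _)   (false ∷ _)  N (_ ∷ _) zero    p q = refl
  layer-top (_ ∷ S′)     (true ∷ S″)  N (_ ∷ y) (suc i) p q = layer-top S′ S″ N y i p q
  layer-top (true ∷ S′)  (false ∷ S″) N (_ ∷ y) (suc i) p q = layer-top S′ S″ N y i p q
  layer-top (false ∷ S′) (false ∷ S″) N (_ ∷ y) (suc i) p q = layer-top S′ S″ N y i p q

  layer-bottom : ∀ {d} (S′ S″ : Subset d) N y i → lookup S′ i ≡ false → lookup S″ i ≡ false →
                 lookup (layer S′ S″ N y) i ≡ 0
  layer-bottom (false ∷ _)  (false ∷ _)  N (_ ∷ _) zero    p q = refl
  layer-bottom (_ ∷ S′)     (true ∷ S″)  N (_ ∷ y) (suc i) p q = layer-bottom S′ S″ N y i p q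
  layer-bottom (true ∷ S′)  (false ∷ S″) N (_ ∷ y) (suc i) p q = layer-bottom S′ S″ N y i p q
  layer-bottom (false ∷ S′) (false ∷ S″) N (_ ∷ y) (suc i) p q = layer-bottom S′ S″ N y i p q

  layer-≥1 : ∀ {d} (S′ S″ : Subset d) N y i → lookup S′ i ≡ true → 1 ℕ.≤ lookup (layer S′ S″ N y) i
  layer-≥1 S′ S″ N y i p with lookup S″ i in q
  ... | true  rewrite layer-middle S′ S″ N y i q = s≤s z≤n
  ... | false rewrite layer-top S′ S″ N y i p q  = s≤s z≤n

  layer-≤ : ∀ {d N y} (S′ S″ : Subset d) → InBox N S″ y → ∀ i → lookup (layer S′ S″ N y) i ℕ.≤ suc N
  layer-≤ {N = N} {y} S′ S″ b i with lookup S″ i in q | lookup S′ i in p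
  ... | true  | _     rewrite layer-middle S′ S″ N y i q   = s≤s (ℕₚ.<⇒≤ (lookup-inside b i q))
  ... | false | true  rewrite layer-top S′ S″ N y i p q    = ℕₚ.≤-refl
  ... | false | false rewrite layer-bottom S′ S″ N y i p q = z≤n

  -- On an edge inside `S″` the coordinate sum and the bound both drop by 2. All other edges are
  -- harmless: a vertex with coordinate N + 1 is isolated in `S′`, so its neighbours have coordinate
  -- 0, and if one end has coordinate 0 the other one is bounded by the box.
  layer-inFRAC : ∀ {d} (A : Adj d) → (∀ i j → A i j ≡ A j i) → ∀ {N S′ S″ b y} →
    Removal (isolated A S′) S′ b S″ → InBox N S″ y →
    inDilatedFRAC A (suc N) (layer S′ S″ N y) ≡ inDilatedFRAC A (N ∸ 1) y
  layer-inFRAC A A-sym {N} {S′} {S″} {y = y} r box = bool-iff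
    (λ p → inFRAC⁺ A (N ∸ 1) y (down (inFRAC⁻ A (suc N) x p)))
    (λ p → inFRAC⁺ A (suc N) x (up (inFRAC⁻ A (N ∸ 1) y p)))
    where
    x = layer S′ S″ N y

    coord-≤ : ∀ i → lookup y i ℕ.≤ N ∸ 1
    coord-≤ i with lookup S″ i in q
    ... | true  = ℕₚ.∸-monoˡ-≤ 1 (lookup-inside box i q)
    ... | false rewrite lookup-outside box i q = z≤n

    down : EdgeBound A (suc N) x → EdgeBound A (N ∸ 1) y
    down h i j e with lookup S″ i in qi | lookup S″ j in qj
    ... | false | _     rewrite lookup-outside box i qi = coord-≤ j
    ... | true  | false rewrite lookup-outside box j qj | ℕₚ.+-identityʳ (lookup y i) = coord-≤ i
    ... | true  | true  with h i j e
    ...   | h′ rewrite layer-middle S′ S″ N y i qi | layer-middle S′ S″ N y j qj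
                     | ℕₚ.+-suc (lookup y i) (lookup y j) = ℕₚ.∸-monoˡ-≤ 2 h′

    top : ∀ i j → A i j ≡ true → lookup S′ i ≡ true → lookup S″ i ≡ false → lookup x i ℕ.+ lookup x j ℕ.≤ suc N
    top i j e p q with isolated⁻ A S′ i (Removal-mask r i p q) j e
    ... | j∉S′ with lookup S″ j in qj
    ...   | true  with () ← trans (sym j∉S′) (Removal-⊆ r j qj)
    ...   | false rewrite layer-top S′ S″ N y i p q | layer-bottom S′ S″ N y j j∉S′ qj
                        | ℕₚ.+-identityʳ N = ℕₚ.≤-refl

    up : EdgeBound A (N ∸ 1) y → EdgeBound A (suc N) x
    up h i j e with lookup S″ i in qi | lookup S′ i in pi | lookup S″ j in qj | lookup S′ j in pj
    ... | false | true  | _     | _     = top i j e pi qi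
    ... | _     | _     | false | true  =
          subst (ℕ._≤ suc N) (ℕₚ.+-comm (lookup x j) (lookup x i)) (top j i (trans (A-sym j i) e) pj qj)
    ... | false | false | _     | _     rewrite layer-bottom S′ S″ N y i pi qi = layer-≤ S′ S″ box j
    ... | true  | _     | false | false
          rewrite layer-bottom S′ S″ N y j pj qj | ℕₚ.+-identityʳ (lookup x i) = layer-≤ S′ S″ box i
    ... | true  | _     | true  | _
          rewrite layer-middle S′ S″ N y i qi | layer-middle S′ S″ N y j qj
                | ℕₚ.+-suc (lookup y i) (lookup y j) =
          -- A vertex in `S″` has a coordinate below N, so N is positive and the subtraction in N ∸
          -- 1 is not truncated here.
          ℕₚ.≤-trans (s≤s (s≤s (h i j e))) (s≤s (ℕₚ.≤-reflexive (suc-pred (lookup-inside box i qi))))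
      where
      suc-pred : ∀ {k n} → k ℕ.< n → suc (n ∸ 1) ≡ n
      suc-pred (s≤s _) = refl

  -- A neighbour in `S′` has coordinate at least 1, which together with N + 1 exceeds the bound.
  layer-∉FRAC : ∀ {d} (A : Adj d) N (S′ S″ : Subset d) y i →
    lookup S′ i ≡ true → lookup S″ i ≡ false → lookup (isolated A S′) i ≡ false →
    inDilatedFRAC A (suc N) (layer S′ S″ N y) ≡ false
  layer-∉FRAC A N S′ S″ y i p q iso with isolated-false A S′ i iso
  ... | j , e , j∈S′ with inDilatedFRAC A (suc N) (layer S′ S″ N y) in v
  ... | false = refl
  ... | true with inFRAC⁻ A (suc N) (layer S′ S″ N y) v i j e
  ... | h rewrite layer-top S′ S″ N y i p q =
    contradiction h (ℕₚ.<⇒≱ (s≤s (subst (suc N ℕ.≤_) (ℕₚ.+-comm _ N) (ℕₚ.+-monoˡ-≤ N (layer-≥1 S′ S″ N y j j∈S′)))))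

  -- N counts the admissible values 0, …, N-1 of a coordinate, i.e. the dilation factor is N-1; for N = 0 (factor -1)
  -- only S = ∅ admits a point, and then the truncated bound N ∸ 1 is harmless.
  latticeCount : ∀ {d} → Adj d → ℕ → Subset d → ℤ
  latticeCount A N S = boxSum S N (λ x → indicator (inDilatedFRAC A (N ∸ 1) x))

  iFRAC≡latticeCount : ∀ {d} (A : Adj d) n → + iFRAC A n ≡ latticeCount A (suc n) (full d)
  iFRAC≡latticeCount {d} A n = count-box d n (inDilatedFRAC A n)

  -- The coordinates 0 of a lattice point form the outer deletion, the coordinates N + 1 the inner one;
  -- a vertex with coordinate N + 1 can only be adjacent to vertices with coordinate 0.
  latticeCount-step : ∀ {d} (A : Adj d) → (∀ i j → A i j ≡ A j i) → ∀ N S →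
    latticeCount A (2 ℕ.+ N) S ≡
    ℤΣ.sumSub (full d) S λ _ S′ → ℤΣ.sumSub (isolated A S′) S′ λ _ → latticeCount A N
  latticeCount-step {d} A A-sym N S = trans (boxSum-layer S N _)
    (ℤΣ.sumSub-cong (full d) S λ {_} {S′} _ → ℤΣ.sumSub-restrict (isolated A S′) S′ _ _
      (λ {_} {S″} r → boxSum-cong S″ N λ box → cong indicator (layer-inFRAC A A-sym r box))
      (λ {_} {S″} _ i p q iso → trans
        (boxSum-cong S″ N λ {y} _ → cong indicator (layer-∉FRAC A N S′ S″ y i p q iso)) (boxSum-zero S″ N)))

  emptyIndicator : ∀ {d} → Subset d → ℤ
  emptyIndicator []          = + 1
  emptyIndicator (true ∷ S)  = + 0
  emptyIndicator (false ∷ S) = emptyIndicator S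

  zeros-EdgeBound : ∀ {d} (A : Adj d) n → EdgeBound A n (replicate d 0)
  zeros-EdgeBound A n i j _ rewrite lookup-replicate i 0 | lookup-replicate j 0 = z≤n

  latticeCount-0 : ∀ {d} (A : Adj d) S → latticeCount A 0 S ≡ emptyIndicator S
  latticeCount-0 {d} A S = lemma S _ (cong indicator (inFRAC⁺ A 0 (replicate d 0) (zeros-EdgeBound A 0)))
    where
    lemma : ∀ {e} (S : Subset e) F → F (replicate e 0) ≡ + 1 → boxSum S 0 F ≡ emptyIndicator S
    lemma []          F p = p
    lemma (true ∷ S)  F p = refl
    lemma (false ∷ S) F p = lemma S _ p

  latticeCount-1 : ∀ {d} (A : Adj d) S → latticeCount A 1 S ≡ + 1
  latticeCount-1 {d} A S = lemma S _ (cong indicator (inFRAC⁺ A 0 (replicate d 0) (zeros-EdgeBound A 0)))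
    where
    lemma : ∀ {e} (S : Subset e) F → F (replicate e 0) ≡ + 1 → boxSum S 1 F ≡ + 1
    lemma []          F p = p
    lemma (true ∷ S)  F p = trans (ℤₚ.+-identityʳ _) (lemma S _ p)
    lemma (false ∷ S) F p = lemma S _ p

  sumSub-emptyIndicator : ∀ {d} (S : Subset d) → ℤΣ.sumSub (full d) S (λ _ → emptyIndicator) ≡ + 1
  sumSub-emptyIndicator []              = refl
  sumSub-emptyIndicator {suc d} (true ∷ S)  =
    trans (cong₂ ℤ._+_ (ℤΣ.sumSub-ε (full d) S) (sumSub-emptyIndicator S)) refl
  sumSub-emptyIndicator (false ∷ S)     = sumSub-emptyIndicator S

-- Generating functions of the layer recursion.

module LayerEquations where
  open PowerSeries
  open GammaPositive
  open SubsetSums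
  open LatticePoints
  open Solver using (solve; _:=_; _:+_; _:*_; _:-_; :-_; con)
  open ℤ[[t]] using () renaming
    (refl to ≈-refl; sym to ≈-sym; trans to ≈-trans; +-cong to +≈; *-cong to *≈; reflexive to ≈-reflexive)
  open Relation.Binary.Reasoning.Setoid ℤ[[t]].setoid

  module SΣ = SubsetSum ℤ[[t]].+-commutativeMonoid
  open SΣ using (sumSub; positive; binomial)

  coeff-sumSub : ∀ {d} (M S : Subset d) F n → coeff (sumSub M S F) n ≡ ℤΣ.sumSub M S (λ b S′ → coeff (F b S′) n)
  coeff-sumSub []          []          F n = refl
  coeff-sumSub (false ∷ M) (s ∷ S)     F n = coeff-sumSub M S _ n
  coeff-sumSub (true ∷ M)  (false ∷ S) F n = coeff-sumSub M S _ n
  coeff-sumSub (true ∷ M)  (true ∷ S)  F n = cong₂ ℤ._+_ (coeff-sumSub M S _ n) (coeff-sumSub M S _ n)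

  sumSub-* : ∀ {d} a (M S : Subset d) F → a * sumSub M S F ≈ sumSub M S (λ b S′ → a * F b S′)
  sumSub-* a = SΣ.sumSub-hom (a *_) (ℤ[[t]].distribˡ a)

  -- Generating function of the weights k^b. The convention 0^0 = 1 matters: it makes the zeroth
  -- power of a deletion operator the identity.
  ρ : ℕ → Series
  coeff (ρ b) n = (+ n) ℤ.^ b

  ρ-zero : ρ 0 ≈ κ 0
  ρ-zero = ext λ _ → refl

  ρ-suc : ∀ b → ρ (suc b) ≈ t * κ (suc b)
  ρ-suc b = ext λ
    { zero    → trans (ℤₚ.*-zeroˡ ((+ 0) ℤ.^ b)) (sym (coeff-t*-zero (κ (suc b))))
    ; (suc n) → sym (coeff-t*-suc (κ (suc b)) n) }

  ρ-κ : ∀ b → ρ (suc b) ≈ θ (ρ b)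
  ρ-κ b = ext λ n → refl

  weight : ℕ → Series → Series
  coeff (weight b x) n = (+ suc n) ℤ.^ b ℤ.* coeff x n

  -- The binomial theorem for the operator (1 + θ)^b, which multiplies coefficient n by (n + 1)^b;
  -- this is what `weight b` denotes.
  binomial-weight : ∀ {d} (w : ℕ → Series) (Z : Subset d → Series) → (∀ k → w (suc k) ≈ θ (w k)) →
    ∀ b S → binomial (λ k S → w k * Z S) b S ≈ weight b (w 0) * Z S
  binomial-weight w Z w-suc zero    S = *≈ʳ (ext λ n → sym (ℤₚ.*-identityˡ (coeff (w 0) n)))
  binomial-weight w Z w-suc (suc b) S = begin
    binomial (λ k S → w k * Z S) b S + binomial (λ k S → w (suc k) * Z S) b S
      ≈⟨ +≈ (binomial-weight w Z w-suc b S) (binomial-weight (λ k → w (suc k)) Z (λ k → w-suc (suc k)) b S) ⟩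
    weight b (w 0) * Z S + weight b (w 1) * Z S
      ≈⟨ ≈-sym (ℤ[[t]].distribʳ (Z S) (weight b (w 0)) (weight b (w 1))) ⟩
    (weight b (w 0) + weight b (w 1)) * Z S
      ≈⟨ *≈ʳ (ext λ n → trans (cong (λ z → (+ suc n) ℤ.^ b ℤ.* coeff (w 0) n ℤ.+ (+ suc n) ℤ.^ b ℤ.* z) (at (w-suc 0) n))
                              (lemma (+ n) ((+ suc n) ℤ.^ b) (coeff (w 0) n))) ⟩
    weight (suc b) (w 0) * Z S ∎
    where
    lemma : ∀ n p x → p ℤ.* x ℤ.+ p ℤ.* (n ℤ.* x) ≡ ((+ 1 ℤ.+ n) ℤ.* p) ℤ.* x
    lemma = solve-∀

  weight-ρ0 : ∀ b → weight b (ρ 0) ≈ κ b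
  weight-ρ0 b = ext λ n → ℤₚ.*-identityʳ ((+ suc n) ℤ.^ b)

  -- (1 - tL)⁻¹ for the deletion operator L: its k-th power weights the deletion of b elements by k^b.
  resolvent : ∀ {d} (μ : Subset d → Subset d) →
    (∀ {S S′ b} F → Removal (μ S) S b S′ → sumSub (μ S′) S′ F ≡ sumSub (μ S) S′ F) →
    (X Z : Subset d → Series) →
    (∀ S → X S ≈ Z S + t * sumSub (μ S) S (λ _ → X)) →
    ∀ S → X S ≈ sumSub (μ S) S (λ b S′ → ρ b * Z S′)
  -- The claimed sum `V` solves the same equation. The solution is unique, since the factor t lets
  -- coefficient n depend only on `Z` and on coefficients of index n - 1.
  resolvent {d} μ stable X Z eq S = ext λ n → unique n S
    where
    V : Subset d → Series
    V S = sumSub (μ S) S (λ b S′ → ρ b * Z S′)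

    first : ℕ → Subset d → Series
    first zero    S = Z S
    first (suc _) S = 0#

    sumSub-first : ∀ S → sumSub (μ S) S first ≈ Z S
    sumSub-first S = begin
      sumSub (μ S) S first                      ≈⟨ SΣ.sumSub-split (μ S) S first ⟩
      Z S + sumSub (μ S) S (positive first)     ≈⟨ +≈ˡ (≈-trans (SΣ.sumSub-cong (μ S) S λ { {zero} _ → ≈-refl ; {suc _} _ → ≈-refl })
                                                                (SΣ.sumSub-ε (μ S) S)) ⟩
      Z S + 0#                                  ≈⟨ ℤ[[t]].+-identityʳ (Z S) ⟩
      Z S                                       ∎

    -- By the binomial theorem the second summand is t (κ b) Z, which is ρ b without its constant
    -- term 0^b. That term is nonzero for b = 0 only, and `first` supplies it.
    recurrence : ∀ b S → first b S + t * binomial (λ k S → ρ k * Z S) b S ≈ ρ b * Z S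
    recurrence b S = ≈-trans (+≈ˡ (*≈ˡ (≈-trans (binomial-weight ρ Z ρ-κ b S) (*≈ʳ (weight-ρ0 b))))) (cases b)
      where
      cases : ∀ b → first b S + t * (κ b * Z S) ≈ ρ b * Z S
      cases zero = begin
        Z S + t * (κ 0 * Z S)
          ≈⟨ solve 3 (λ t k z → z :+ t :* (k :* z) := (con (+ 1) :- (con (+ 1) :- t) :* k) :* z :+ k :* z) ≈-refl t (κ 0) (Z S) ⟩
        (1# + - (1-t * κ 0)) * Z S + κ 0 * Z S
          ≈⟨ +≈ʳ (*≈ʳ (+≈ˡ (ℤ[[t]].-‿cong 1-t*κ0))) ⟩
        (1# + - 1#) * Z S + κ 0 * Z S
          ≈⟨ solve 2 (λ k z → (con (+ 1) :- con (+ 1)) :* z :+ k :* z := k :* z) ≈-refl (κ 0) (Z S) ⟩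
        κ 0 * Z S
          ≈⟨ *≈ʳ (≈-sym ρ-zero) ⟩
        ρ 0 * Z S ∎
      cases (suc b) = begin
        0# + t * (κ (suc b) * Z S)   ≈⟨ solve 3 (λ t k z → con (+ 0) :+ t :* (k :* z) := (t :* k) :* z) ≈-refl t (κ (suc b)) (Z S) ⟩
        (t * κ (suc b)) * Z S        ≈⟨ *≈ʳ (≈-sym (ρ-suc b)) ⟩
        ρ (suc b) * Z S              ∎

    V-eq : ∀ S → V S ≈ Z S + t * sumSub (μ S) S (λ _ → V)
    V-eq S = ≈-sym (begin
      Z S + t * sumSub (μ S) S (λ _ → V)
        ≈⟨ +≈ (≈-sym (sumSub-first S)) (*≈ˡ (≈-trans
             (SΣ.sumSub-cong (μ S) S λ r → ≈-reflexive (stable _ r))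
             (SΣ.sumSub-sumSub (μ S) S _))) ⟩
      sumSub (μ S) S first + t * sumSub (μ S) S (binomial (λ k S → ρ k * Z S))
        ≈⟨ +≈ˡ (sumSub-* t (μ S) S _) ⟩
      sumSub (μ S) S first + sumSub (μ S) S (λ b S′ → t * binomial (λ k S → ρ k * Z S) b S′)
        ≈⟨ ≈-sym (SΣ.sumSub-∙ (μ S) S _ _) ⟩
      sumSub (μ S) S (λ b S′ → first b S′ + t * binomial (λ k S → ρ k * Z S) b S′)
        ≈⟨ SΣ.sumSub-cong (μ S) S (λ {b} {S′} _ → recurrence b S′) ⟩
      V S ∎)

    unique : ∀ n S → coeff (X S) n ≡ coeff (V S) n
    unique n S = trans (at (eq S) n) (trans (cong (ℤ._+_ (coeff (Z S) n)) (tail n)) (sym (at (V-eq S) n)))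
      where
      tail : ∀ n → coeff (t * sumSub (μ S) S (λ _ → X)) n ≡ coeff (t * sumSub (μ S) S (λ _ → V)) n
      tail zero    = trans (coeff-t*-zero (sumSub (μ S) S (λ _ → X))) (sym (coeff-t*-zero (sumSub (μ S) S (λ _ → V))))
      tail (suc n) = trans (coeff-t*-suc (sumSub (μ S) S (λ _ → X)) n) (trans
        (trans (coeff-sumSub (μ S) S _ n) (trans
          (ℤΣ.sumSub-cong (μ S) S (λ {_} {S′} _ → unique n S′))
          (sym (coeff-sumSub (μ S) S _ n))))
        (sym (coeff-t*-suc (sumSub (μ S) S (λ _ → V)) n)))

  module Layers {d} (A : Adj d) (A-sym : ∀ i j → A i j ≡ A j i) where

    E B : (Subset d → Series) → Subset d → Series
    E f S = sumSub (full d) S (λ _ → f)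
    B f S = sumSub (isolated A S) S (λ _ → f)

    δ : Subset d → Series
    δ S = const (emptyIndicator S)

    -- false: even dilations, true: odd dilations
    φ U : Bool → Subset d → Series
    φ false = δ
    φ true  = B δ
    coeff (U false S) m = latticeCount A (1 ℕ.+ 2 ℕ.* m) S
    coeff (U true  S) m = latticeCount A (2 ℕ.+ 2 ℕ.* m) S

    -- The weight of a negative innermost block; `φ-eq` is where these two values come from.
    c : Bool → Series
    c false = t
    c true  = 1#

    B-cong : ∀ {f g} → (∀ S → f S ≈ g S) → ∀ S → B f S ≈ B g S
    B-cong p S = SΣ.sumSub-cong (isolated A S) S (λ {_} {S′} _ → p S′)

    B-+ : ∀ f g S → B (λ S → f S + g S) S ≈ B f S + B g S
    B-+ f g S = SΣ.sumSub-∙ (isolated A S) S _ _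

    B-* : ∀ a f S → B (λ S → a * f S) S ≈ a * B f S
    B-* a f S = ≈-sym (sumSub-* a (isolated A S) S _)

    coeff-EB : ∀ f S n → coeff (E (B f) S) n ≡
      ℤΣ.sumSub (full d) S λ _ S′ → ℤΣ.sumSub (isolated A S′) S′ λ _ S″ → coeff (f S″) n
    coeff-EB f S n = trans (coeff-sumSub (full d) S _ n)
      (ℤΣ.sumSub-cong (full d) S λ {_} {S′} _ → coeff-sumSub (isolated A S′) S′ _ n)

    coeff-φ-suc : ∀ p S n → coeff (φ p S) (suc n) ≡ + 0
    coeff-φ-suc false S n = refl
    coeff-φ-suc true  S n = trans (coeff-sumSub (isolated A S) S _ (suc n)) (ℤΣ.sumSub-ε (isolated A S) S)

    U-step : ∀ p S n → coeff (U p S) (suc n) ≡ coeff (E (B (U p)) S) n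
    U-step false S n rewrite ℕₚ.*-suc 2 n = trans (latticeCount-step A A-sym (1 ℕ.+ 2 ℕ.* n) S) (sym (coeff-EB (U false) S n))
    U-step true  S n rewrite ℕₚ.*-suc 2 n = trans (latticeCount-step A A-sym (2 ℕ.+ 2 ℕ.* n) S) (sym (coeff-EB (U true) S n))

    U-zero : ∀ p S → coeff (U p S) 0 ≡ coeff (E (φ p) S) 0
    U-zero false S = trans (latticeCount-1 A S) (trans (sym (sumSub-emptyIndicator S)) (sym (coeff-sumSub (full d) S _ 0)))
    U-zero true  S = trans (latticeCount-step A A-sym 0 S) (trans
      (ℤΣ.sumSub-cong (full d) S λ {_} {S′} _ → ℤΣ.sumSub-cong (isolated A S′) S′ λ {_} {S″} _ → latticeCount-0 A S″)
      (sym (coeff-EB δ S 0)))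

    W : Bool → Subset d → Series
    W p S = φ p S + t * B (U p) S

    U≈EW : ∀ p S → U p S ≈ E (W p) S
    U≈EW p S = ≈-trans (ext pointwise) (≈-sym (≈-trans (SΣ.sumSub-∙ (full d) S _ _)
                                              (+≈ˡ (≈-sym (sumSub-* t (full d) S _)))))
      where
      pointwise : ∀ n → coeff (U p S) n ≡ coeff (E (φ p) S + t * E (B (U p)) S) n
      pointwise zero = trans (U-zero p S) (trans (sym (ℤₚ.+-identityʳ _))
        (cong (ℤ._+_ (coeff (E (φ p) S) 0)) (sym (coeff-t*-zero (E (B (U p)) S)))))
      pointwise (suc n) = trans (U-step p S n) (trans (sym (ℤₚ.+-identityˡ _)) (cong₂ ℤ._+_
        (sym (trans (coeff-sumSub (full d) S _ (suc n)) (trans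
          (ℤΣ.sumSub-cong (full d) S λ {_} {S′} _ → coeff-φ-suc p S′ n) (ℤΣ.sumSub-ε (full d) S))))
        (sym (coeff-t*-suc (E (B (U p)) S) n))))

    -- Up to powers of 1-t, R and Q⁻ collect the configurations whose outermost block is positive, respectively
    -- negative; X and Y only serve to bring the equation for Q⁻ into the form required by the resolvent.
    Q R Q⁻ X Y : Bool → Subset d → Series
    Q  p S = φ p S + t * (B (U p) S + - U p S)
    R  p S = sumSub (full d) S (positive λ b S′ → κ b * Q p S′)
    Q⁻ p S = Q p S + - δ S
    X  p S = c p * δ S + t * (1-t * R p S)
    Y  p S = t * Q⁻ p S + X p S

    positive-ρ : ∀ M S (Z : Subset d → Series) →
      sumSub M S (positive λ b S′ → ρ b * Z S′) ≈ t * sumSub M S (positive λ b S′ → κ b * Z S′)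
    positive-ρ M S Z = ≈-trans
      (SΣ.sumSub-cong M S λ
        { {zero}       _ → ≈-sym (ℤ[[t]].zeroʳ t)
        ; {suc b} {S′} _ → ≈-trans (*≈ʳ (ρ-suc b)) (ℤ[[t]].*-assoc t (κ (suc b)) (Z S′)) })
      (≈-sym (sumSub-* t M S _))

    -- Q = W - tU = (1 - tE)W, so `W` is the resolvent of E applied to `Q`. Its empty deletion
    -- carries the weight κ 0 = 1/(1-t), and the nonempty ones make up tR.
    [1-t]U : ∀ p S → 1-t * U p S ≈ Q p S + 1-t * R p S
    [1-t]U p S = t-cancel (begin
      t * (1-t * U p S)
        ≈⟨ solve 4 (λ t f b u → t :* ((con (+ 1) :- t) :* u) := (con (+ 1) :- t) :* ((f :+ t :* b) :- (f :+ t :* (b :- u))))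
             ≈-refl t (φ p S) (B (U p) S) (U p S) ⟩
      1-t * (W p S + - Q p S)
        ≈⟨ *≈ˡ (+≈ʳ W-resolved) ⟩
      1-t * ((κ 0 * Q p S + t * R p S) + - Q p S)
        ≈⟨ solve 4 (λ t k q r → (con (+ 1) :- t) :* ((k :* q :+ t :* r) :- q) :=
                      ((con (+ 1) :- t) :* k) :* q :- (con (+ 1) :- t) :* q :+ t :* ((con (+ 1) :- t) :* r))
             ≈-refl t (κ 0) (Q p S) (R p S) ⟩
      ((1-t * κ 0) * Q p S + - (1-t * Q p S)) + t * (1-t * R p S)
        ≈⟨ +≈ʳ (+≈ʳ (*≈ʳ 1-t*κ0)) ⟩
      (1# * Q p S + - (1-t * Q p S)) + t * (1-t * R p S)
        ≈⟨ solve 3 (λ t q r → (con (+ 1) :* q :- (con (+ 1) :- t) :* q) :+ t :* ((con (+ 1) :- t) :* r) :=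
                      t :* (q :+ (con (+ 1) :- t) :* r)) ≈-refl t (Q p S) (R p S) ⟩
      t * (Q p S + 1-t * R p S) ∎)
      where
      W-resolved : W p S ≈ κ 0 * Q p S + t * R p S
      W-resolved = begin
        W p S
          ≈⟨ resolvent (λ _ → full d) (λ _ _ → refl) (W p) (Q p) (λ S → begin
               W p S                          ≈⟨ solve 4 (λ t f b u → f :+ t :* b := (f :+ t :* (b :- u)) :+ t :* u) ≈-refl t (φ p S) (B (U p) S) (U p S) ⟩
               Q p S + t * U p S              ≈⟨ +≈ˡ (*≈ˡ (U≈EW p S)) ⟩
               Q p S + t * E (W p) S          ∎) S ⟩
        sumSub (full d) S (λ b S′ → ρ b * Q p S′)
          ≈⟨ SΣ.sumSub-split (full d) S _ ⟩
        ρ 0 * Q p S + sumSub (full d) S (positive λ b S′ → ρ b * Q p S′)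
          ≈⟨ +≈ (*≈ʳ ρ-zero) (positive-ρ (full d) S (Q p)) ⟩
        κ 0 * Q p S + t * R p S ∎

    -- Brings the innermost terms of the two parities into one form, with `c` as the only remaining
    -- trace of p.
    φ-eq : ∀ p S → (1-t * φ p S + - δ S) + t * B δ S ≈ c p * (B δ S + - δ S)
    φ-eq false S = solve 3 (λ t x y → ((con (+ 1) :- t) :* x :- x) :+ t :* y := t :* (y :- x)) ≈-refl t (δ S) (B δ S)
    φ-eq true  S = solve 3 (λ t x y → ((con (+ 1) :- t) :* y :- x) :+ t :* y := con (+ 1) :* (y :- x)) ≈-refl t (δ S) (B δ S)

    -- Eliminates `U`: in Q = (1-t)Q + tQ the first summand contains only (1-t)BU and (1-t)U, both
    -- of which `[1-t]U` rewrites, and the two terms tQ cancel.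
    Q-eq : ∀ p S → Q p S ≈ 1-t * φ p S + (t * B (Q p) S + t * (1-t * (B (R p) S + - R p S)))
    Q-eq p S = begin
      Q p S
        ≈⟨ solve 4 (λ t f b u → f :+ t :* (b :- u) := ((con (+ 1) :- t) :* f
              :+ t :* ((con (+ 1) :- t) :* b :- (con (+ 1) :- t) :* u)) :+ t :* (f :+ t :* (b :- u)))
             ≈-refl t (φ p S) (B (U p) S) (U p S) ⟩
      (1-t * φ p S + t * (1-t * B (U p) S + - (1-t * U p S))) + t * Q p S
        ≈⟨ +≈ʳ (+≈ˡ (*≈ˡ (+≈ [1-t]BU (ℤ[[t]].-‿cong ([1-t]U p S))))) ⟩
      (1-t * φ p S + t * ((B (Q p) S + 1-t * B (R p) S) + - (Q p S + 1-t * R p S))) + t * Q p S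
        ≈⟨ solve 6 (λ t f bq br q r → ((con (+ 1) :- t) :* f :+ t :* ((bq :+ (con (+ 1) :- t) :* br) :- (q :+ (con (+ 1) :- t) :* r))) :+ t :* q :=
                     (con (+ 1) :- t) :* f :+ (t :* bq :+ t :* ((con (+ 1) :- t) :* (br :- r))))
             ≈-refl t (φ p S) (B (Q p) S) (B (R p) S) (Q p S) (R p S) ⟩
      1-t * φ p S + (t * B (Q p) S + t * (1-t * (B (R p) S + - R p S))) ∎
      where
      [1-t]BU : 1-t * B (U p) S ≈ B (Q p) S + 1-t * B (R p) S
      [1-t]BU = ≈-trans (≈-sym (B-* 1-t (U p) S)) (≈-trans (B-cong ([1-t]U p) S)
        (≈-trans (B-+ (Q p) _ S) (+≈ˡ (B-* 1-t (R p) S))))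

    B-Y : ∀ p S → B (Y p) S ≈ t * (B (Q p) S + - B δ S) + (c p * B δ S + t * (1-t * B (R p) S))
    B-Y p S = ≈-trans (B-+ (λ S → t * Q⁻ p S) (X p) S) (+≈
      (≈-trans (B-* t (Q⁻ p) S) (*≈ˡ (≈-trans (B-+ (Q p) _ S) (+≈ˡ (B-neg S)))))
      (≈-trans (B-+ (λ S → c p * δ S) _ S) (+≈ (B-* (c p) δ S) (≈-trans (B-* t _ S) (*≈ˡ (B-* 1-t (R p) S))))))
      where
      B-neg : ∀ S → B (λ S → - δ S) S ≈ - B δ S
      B-neg S = ≈-sym (SΣ.sumSub-hom -_ (λ x y → solve 2 (λ x y → :- (x :+ y) := (:- x) :+ (:- y)) ≈-refl x y) (isolated A S) S _)

    -- `Q-eq` and `φ-eq` say that Q⁻ = t BQ⁻ + (BX - X). The source term still contains B; adding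
    -- `X` to tQ⁻ absorbs it, because (1 - tB)(tQ⁻ + X) = (1-t)X.
    Y-eq : ∀ p S → Y p S ≈ 1-t * X p S + t * B (Y p) S
    Y-eq p S = begin
      Y p S
        ≈⟨ +≈ʳ (*≈ˡ (+≈ʳ (≈-trans (Q-eq p S) (solve 6 (λ t f d bd bq rr →
             (con (+ 1) :- t) :* f :+ (t :* bq :+ rr) := (((con (+ 1) :- t) :* f :- d) :+ t :* bd) :+ (t :* (bq :- bd) :+ (rr :+ d)))
             ≈-refl t (φ p S) (δ S) (B δ S) (B (Q p) S) (t * (1-t * (B (R p) S + - R p S))))))) ⟩
      t * ((((1-t * φ p S + - δ S) + t * B δ S) + (t * (B (Q p) S + - B δ S) + (t * (1-t * (B (R p) S + - R p S)) + δ S))) + - δ S) + X p S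
        ≈⟨ +≈ʳ (*≈ˡ (+≈ʳ (+≈ʳ (φ-eq p S)))) ⟩
      t * ((c p * (B δ S + - δ S) + (t * (B (Q p) S + - B δ S) + (t * (1-t * (B (R p) S + - R p S)) + δ S))) + - δ S) + X p S
        ≈⟨ solve 7 (λ t c d bd bq br r →
             t :* ((c :* (bd :- d) :+ (t :* (bq :- bd) :+ (t :* ((con (+ 1) :- t) :* (br :- r)) :+ d))) :- d)
               :+ (c :* d :+ t :* ((con (+ 1) :- t) :* r)) :=
             (con (+ 1) :- t) :* (c :* d :+ t :* ((con (+ 1) :- t) :* r))
               :+ t :* (t :* (bq :- bd) :+ (c :* bd :+ t :* ((con (+ 1) :- t) :* br))))
             ≈-refl t (c p) (δ S) (B δ S) (B (Q p) S) (B (R p) S) (R p S) ⟩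
      1-t * X p S + t * (t * (B (Q p) S + - B δ S) + (c p * B δ S + t * (1-t * B (R p) S)))
        ≈⟨ +≈ˡ (*≈ˡ (≈-sym (B-Y p S))) ⟩
      1-t * X p S + t * B (Y p) S ∎

    isolated-stable : ∀ {S S′ b} F → Removal (isolated A S) S b S′ → sumSub (isolated A S′) S′ F ≡ sumSub (isolated A S) S′ F
    isolated-stable {S} {S′} F r = sym (SΣ.sumSub-mask (isolated A S) (isolated A S′) S′ F (isolated-removal A A-sym r))

    -- In the resolvent of B the empty deletion contributes κ 0 (1-t) X = X, exactly the term that
    -- `Y` adds to tQ⁻. Hence only nonempty negative blocks remain.
    Q⁻-eq : ∀ p S → Q⁻ p S ≈ sumSub (isolated A S) S (positive λ b S′ → κ b * (1-t * X p S′))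
    Q⁻-eq p S = t-cancel (begin
      t * Q⁻ p S
        ≈⟨ solve 2 (λ q x → q := (q :+ x) :- x) ≈-refl (t * Q⁻ p S) (X p S) ⟩
      Y p S + - X p S
        ≈⟨ +≈ʳ (resolvent (isolated A) isolated-stable (Y p) (λ S → 1-t * X p S) (Y-eq p) S) ⟩
      sumSub (isolated A S) S (λ b S′ → ρ b * (1-t * X p S′)) + - X p S
        ≈⟨ +≈ʳ (≈-trans (SΣ.sumSub-split (isolated A S) S _) (+≈ (*≈ʳ ρ-zero) (positive-ρ (isolated A S) S (λ S → 1-t * X p S)))) ⟩
      (κ 0 * (1-t * X p S) + t * Z) + - X p S
        ≈⟨ solve 5 (λ t k x z u → (k :* (u :* x) :+ t :* z) :- x := ((u :* k) :* x :- x) :+ t :* z)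
             ≈-refl t (κ 0) (X p S) Z 1-t ⟩
      ((1-t * κ 0) * X p S + - X p S) + t * Z
        ≈⟨ +≈ʳ (+≈ʳ (*≈ʳ 1-t*κ0)) ⟩
      (1# * X p S + - X p S) + t * Z
        ≈⟨ solve 2 (λ x z → (con (+ 1) :* x :- x) :+ z := z) ≈-refl (X p S) (t * Z) ⟩
      t * Z ∎)
      where
      Z = sumSub (isolated A S) S (positive λ b S′ → κ b * (1-t * X p S′))

-- Gamma-positive decomposition common to both numerators.

module NumeratorDecomposition where
  open PowerSeries
  open GammaPositive
  open SubsetSums
  open LatticePoints
  open LayerEquations
  open Solver using (solve; _:=_; _:+_; _:*_; _:-_; :-_; con)
  open ℤ[[t]] using () renaming
    (refl to ≈-refl; sym to ≈-sym; trans to ≈-trans; +-cong to +≈; *-cong to *≈; reflexive to ≈-reflexive)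
  open Relation.Binary.Reasoning.Setoid ℤ[[t]].setoid

  module Decomposition {d} (A : Adj d) (A-sym : ∀ i j → A i j ≡ A j i) where
    open Layers A A-sym
    open SΣ using (sumSub; positive)

    -- The same α and β serve both parities, and p enters through `c` alone; this shared pair later
    -- links the two numerators.
    record Rep (n k : ℕ) (x : Bool → Series) : Set where
      constructor rep
      field
        {α β} : Series
        α-Pos : Pos 1 n α
        β-Pos : Pos 1 k β
        split : ∀ p → x p ≈ α + c p * β

    Rep-≈ : ∀ {n k x y} → (∀ p → x p ≈ y p) → Rep n k y → Rep n k x
    Rep-≈ x≈y (rep a b eq) = rep a b (λ p → ≈-trans (x≈y p) (eq p))

    Rep-zero : ∀ {n k} → Rep n k (λ _ → 0#)
    Rep-zero = rep zero zero (λ p → solve 1 (λ c → con (+ 0) := con (+ 0) :+ c :* con (+ 0)) ≈-refl (c p))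

    Rep-+ : ∀ {n k x y} → Rep n k x → Rep n k y → Rep n k (λ p → x p + y p)
    Rep-+ (rep {α} {β} a b eq) (rep {α′} {β′} a′ b′ eq′) = rep (add a a′) (add b b′) λ p → ≈-trans (+≈ (eq p) (eq′ p))
      (solve 5 (λ c a b a′ b′ → (a :+ c :* b) :+ (a′ :+ c :* b′) := (a :+ a′) :+ c :* (b :+ b′)) ≈-refl (c p) α β α′ β′)

    Rep-* : ∀ {e n k x a} → Pos 0 e a → Rep n k x → Rep (e ℕ.+ n) (e ℕ.+ k) (λ p → a * x p)
    Rep-* {a = m} pos (rep {α} {β} a b eq) = rep (Pos-* pos a) (Pos-* pos b) λ p → ≈-trans (*≈ˡ (eq p))
      (solve 4 (λ m c a b → m :* (a :+ c :* b) := m :* a :+ c :* (m :* b)) ≈-refl m (c p) α β)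

    Rep-sumSub : ∀ {n k} M S {F : Bool → ℕ → Subset d → Series} →
      (∀ {b S′} → Removal M S b S′ → Rep n k (λ p → F p b S′)) → Rep n k (λ p → sumSub M S (F p))
    Rep-sumSub {n} {k} M S r = SΣ.sumSub-closed (Rep n k) Rep-+ M S r

    -- The powers of `1-t` do no harm to positivity: they meet a nonzero factor for empty S only,
    -- where the exponent is 0.
    δ-Pos : ∀ S → Pos 1 (suc (size S)) ([1-t]^ (size S) * δ S)
    δ-Pos S = lemma S
      where
      lemma : ∀ {d} (S : Subset d) → Pos 1 (suc (size S)) ([1-t]^ (size S) * const (emptyIndicator S))
      lemma []          = resp (≈-sym (ℤ[[t]].*-identityʳ 1#)) unit
      lemma (false ∷ S) = lemma S
      lemma (true ∷ S)  = resp (≈-sym (ℤ[[t]].zeroʳ ([1-t]^ (suc (size S))))) zero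

    -- The truncation in `size S ∸ 1` concerns empty S only, where `R` has no nonempty deletion to
    -- sum over and vanishes.
    RepR RepQ⁻ : Subset d → Set
    RepR  S = Rep (size S) (size S ∸ 1) (λ p → [1-t]^ (suc (size S)) * R p S)
    RepQ⁻ S = Rep (suc (size S)) (size S) (λ p → [1-t]^ (size S) * Q⁻ p S)

    -- A block of b + 1 vertices uses b + 2 factors for its Eulerian polynomial, one more than its
    -- size; hence the exponent s + 1.
    [1-t]^-split : ∀ b {s n} x y → suc b ℕ.+ n ≡ s → [1-t]^ (suc s) * (x * y) ≈ ([1-t]^ (2 ℕ.+ b) * x) * ([1-t]^ n * y)
    [1-t]^-split b {n = n} x y refl = ≈-trans (*≈ʳ ([1-t]^-+ (2 ℕ.+ b) n))
      (solve 4 (λ p q x y → (p :* q) :* (x :* y) := (p :* x) :* (q :* y)) ≈-refl ([1-t]^ (2 ℕ.+ b)) ([1-t]^ n) x y)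

    -- For s = 0 the factor t would lead to length 2 instead of 1, but a series of length 0 is zero.
    t*Pos : ∀ s {x} → Pos 1 (s ∸ 1) x → Pos 1 (suc s) (t * x)
    t*Pos zero    p = resp (≈-sym (≈-trans (*≈ˡ (Pos-0 p)) (ℤ[[t]].zeroʳ t))) zero
    t*Pos (suc s) p = t* p

    RepQ : ∀ S → RepQ⁻ S → Rep (suc (size S)) (size S) (λ p → [1-t]^ (size S) * Q p S)
    RepQ S r = Rep-≈ (λ p → solve 3 (λ w q d → w :* q := w :* d :+ w :* (q :- d)) ≈-refl ([1-t]^ (size S)) (Q p S) (δ S))
      (Rep-+ (rep (δ-Pos S) zero λ p → solve 2 (λ x c → x := x :+ c :* con (+ 0)) ≈-refl ([1-t]^ (size S) * δ S) (c p)) r)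

    -- The summand c δ already has the shape of a β-part; the factor t in front of `R` lengthens
    -- both of its parts by 2.
    RepX : ∀ S → RepR S → Rep (2 ℕ.+ size S) (suc (size S)) (λ p → [1-t]^ (size S) * X p S)
    RepX S (rep {α} {β} a b eq) = rep (t* a) (add (δ-Pos S) (t*Pos (size S) b)) λ p → begin
      [1-t]^ (size S) * X p S
        ≈⟨ solve 6 (λ w c d t u r → w :* (c :* d :+ t :* (u :* r)) := c :* (w :* d) :+ t :* ((u :* w) :* r))
             ≈-refl ([1-t]^ (size S)) (c p) (δ S) t 1-t (R p S) ⟩
      c p * ([1-t]^ (size S) * δ S) + t * ([1-t]^ (suc (size S)) * R p S)
        ≈⟨ +≈ˡ (*≈ˡ (eq p)) ⟩
      c p * ([1-t]^ (size S) * δ S) + t * (α + c p * β)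
        ≈⟨ solve 5 (λ c d t a b → c :* d :+ t :* (a :+ c :* b) := t :* a :+ c :* (d :+ t :* b)) ≈-refl (c p) ([1-t]^ (size S) * δ S) t α β ⟩
      t * α + c p * ([1-t]^ (size S) * δ S + t * β) ∎

    Rep-index : ∀ {n n′ k k′ x} → n ≡ n′ → k ≡ k′ → Rep n k x → Rep n′ k′ x
    Rep-index refl refl r = r

    RepR-step : ∀ S → (∀ {b S′} → Removal (full d) S (suc b) S′ → RepQ⁻ S′) → RepR S
    RepR-step S ih = Rep-≈ (λ p → sumSub-* ([1-t]^ (suc (size S))) (full d) S _) (Rep-sumSub (full d) S term)
      where
      term : ∀ {b S′} → Removal (full d) S b S′ →
        Rep (size S) (size S ∸ 1) (λ p → [1-t]^ (suc (size S)) * positive (λ b S′ → κ b * Q p S′) b S′)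
      term {zero}       r = Rep-≈ (λ p → ℤ[[t]].zeroʳ ([1-t]^ (suc (size S)))) Rep-zero
      term {suc b} {S′} r = Rep-≈ (λ p → [1-t]^-split b (κ (suc b)) (Q p S′) (Removal-size r))
        (Rep-index (trans (ℕₚ.+-suc b (size S′)) (Removal-size r)) (cong (_∸ 1) (Removal-size r))
          (Rep-* (eulerian-Pos b) (RepQ S′ (ih r))))

    RepQ⁻-step : ∀ S → (∀ {b S′} → Removal (isolated A S) S (suc b) S′ → RepR S′) → RepQ⁻ S
    RepQ⁻-step S ih = Rep-≈
      (λ p → ≈-trans (*≈ˡ (Q⁻-eq p S)) (sumSub-* ([1-t]^ (size S)) (isolated A S) S _)) (Rep-sumSub (isolated A S) S term)
      where
      term : ∀ {b S′} → Removal (isolated A S) S b S′ →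
        Rep (suc (size S)) (size S) (λ p → [1-t]^ (size S) * positive (λ b S′ → κ b * (1-t * X p S′)) b S′)
      term {zero}       r = Rep-≈ (λ p → ℤ[[t]].zeroʳ ([1-t]^ (size S))) Rep-zero
      term {suc b} {S′} r = Rep-≈
        (λ p → ≈-trans
          (solve 4 (λ w k u x → w :* (k :* (u :* x)) := (u :* w) :* (k :* x)) ≈-refl ([1-t]^ (size S)) (κ (suc b)) 1-t (X p S′))
          ([1-t]^-split b (κ (suc b)) (X p S′) (Removal-size r)))
        (Rep-index
          (trans (ℕₚ.+-suc b (suc (size S′))) (cong suc (trans (ℕₚ.+-suc b (size S′)) (Removal-size r))))
          (trans (ℕₚ.+-suc b (size S′)) (Removal-size r))
          (Rep-* (eulerian-Pos b) (RepX S′ (ih r))))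

    -- Signs of blocks alternate, so each claim calls the other one, and blocks are nonempty, so the
    -- set shrinks.
    reps : ∀ n S → size S ℕ.< n → RepR S × RepQ⁻ S
    reps (suc n) S (s≤s size≤n) =
      RepR-step S (λ {_} {S′} r → proj₂ (reps n S′ (smaller r))) ,
      RepQ⁻-step S (λ {_} {S′} r → proj₁ (reps n S′ (smaller r)))
      where
      smaller : ∀ {b M S′} → Removal M S (suc b) S′ → size S′ ℕ.< n
      smaller {b} {S′ = S′} r = ℕₚ.<-≤-trans
        (subst (size S′ ℕ.<_) (Removal-size r) (s≤s (ℕₚ.m≤n+m (size S′) b))) size≤n

  module _ {d} (A : Adj (suc d)) (A-sym : ∀ i j → A i j ≡ A j i) (no-isolated : NoIsolatedVertices A) where
    open Layers A A-sym
    open Decomposition A A-sym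

    B-full : ∀ f → B f (full (suc d)) ≡ f (full (suc d))
    B-full f = SΣ.sumSub-none (isolated A (full (suc d))) (full (suc d)) (λ _ → f) none
      where
      none : ∀ i → lookup (isolated A (full (suc d))) i ≡ false
      none i with lookup (isolated A (full (suc d))) i in eq
      ... | false = refl
      ... | true with no-isolated i
      ...   | j , e with () ← trans (sym (lookup-replicate j true)) (isolated⁻ A (full (suc d)) i eq j e)

    φ-full : ∀ p → φ p (full (suc d)) ≈ 0#
    φ-full false = ≈-refl
    φ-full true  = ≈-reflexive (B-full δ)

    -- Without isolated vertices B acts as the identity at the full set, so the outermost block is
    -- positive.
    Q-full : ∀ p → Q p (full (suc d)) ≈ 0#
    Q-full p = begin
      φ p (full _) + t * (B (U p) (full _) + - U p (full _))
        ≈⟨ +≈ (φ-full p) (*≈ˡ (+≈ʳ (≈-reflexive (B-full (U p))))) ⟩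
      0# + t * (U p (full _) + - U p (full _))
        ≈⟨ solve 2 (λ t u → con (+ 0) :+ t :* (u :- u) := con (+ 0)) ≈-refl t (U p (full _)) ⟩
      0# ∎

    U≈R : ∀ p → [1-t]^ (2 ℕ.+ d) * U p (full (suc d)) ≈ [1-t]^ (suc (size (full (suc d)))) * R p (full (suc d))
    U≈R p = begin
      (1-t * [1-t]^ (suc d)) * U p S
        ≈⟨ solve 3 (λ w v u → (w :* v) :* u := v :* (w :* u)) ≈-refl 1-t ([1-t]^ (suc d)) (U p S) ⟩
      [1-t]^ (suc d) * (1-t * U p S)
        ≈⟨ *≈ˡ (≈-trans ([1-t]U p S) (+≈ʳ (Q-full p))) ⟩
      [1-t]^ (suc d) * (0# + 1-t * R p S)
        ≈⟨ solve 3 (λ w v r → v :* (con (+ 0) :+ w :* r) := (w :* v) :* r) ≈-refl 1-t ([1-t]^ (suc d)) (R p S) ⟩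
      [1-t]^ (2 ℕ.+ d) * R p S
        ≈⟨ *≈ʳ (≈-reflexive (cong (λ n → [1-t]^ (suc n)) (sym (size-full (suc d))))) ⟩
      [1-t]^ (suc (size S)) * R p S ∎
      where S = full (suc d)

    Decomposed : Set
    Decomposed = ∃[ α ] ∃[ β ] Pos 1 (suc d) α × Pos 1 d β ×
      ([1-t]^ (2 ℕ.+ d) * U false (full (suc d)) ≈ α + t * β) × ([1-t]^ (2 ℕ.+ d) * U true (full (suc d)) ≈ α + β)

    numerators : Decomposed
    numerators = from (proj₁ (reps (suc (suc d)) (full (suc d)) (s≤s (ℕₚ.≤-reflexive (size-full (suc d))))))
      where
      from : RepR (full (suc d)) → Decomposed
      from (rep {α} {β} a b eq) =
        α , β , subst (λ n → Pos 1 n α) (size-full (suc d)) a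
              , subst (λ n → Pos 1 (n ∸ 1) β) (size-full (suc d)) b
              , ≈-trans (U≈R false) (eq false)
              , ≈-trans (U≈R true) (≈-trans (eq true) (+≈ˡ (ℤ[[t]].*-identityˡ β)))

-- From gamma-positivity to symmetric and unimodal coefficients.

module Numerators where
  open PowerSeries
  open GammaPositive
  open LatticePoints

  coeff-1-t*-zero : ∀ x → coeff (1-t * x) 0 ≡ coeff x 0
  coeff-1-t*-zero x = trans (at (1-t* x) 0) (trans (cong (λ z → coeff x 0 ℤ.+ ℤ.- z) (coeff-t*-zero x)) (ℤₚ.+-identityʳ _))

  coeff-1-t*-suc : ∀ x n → coeff (1-t * x) (suc n) ≡ coeff x (suc n) ℤ.- coeff x n
  coeff-1-t*-suc x n = trans (at (1-t* x) (suc n)) (cong (λ z → coeff x (suc n) ℤ.+ ℤ.- z) (coeff-t*-suc x n))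

  1+t*≈ : ∀ x → 1+t * x ≈ x + t * x
  1+t*≈ x = solve 2 (λ t x → (con (+ 1) :+ t) :* x := x :+ t :* x) ℤ[[t]].refl t x
    where open Solver using (solve; _:=_; _:+_; _:*_; con)

  coeff-1+t*-zero : ∀ x → coeff (1+t * x) 0 ≡ coeff x 0
  coeff-1+t*-zero x = trans (at (1+t*≈ x) 0) (trans (cong (ℤ._+_ (coeff x 0)) (coeff-t*-zero x)) (ℤₚ.+-identityʳ _))

  coeff-1+t*-suc : ∀ x n → coeff (1+t * x) (suc n) ≡ coeff x (suc n) ℤ.+ coeff x n
  coeff-1+t*-suc x n = trans (at (1+t*≈ x) (suc n)) (cong (ℤ._+_ (coeff x (suc n))) (coeff-t*-suc x n))

  -- Here n is the length, so the centre is (n - 1)/2. `rise` covers the first half only, and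
  -- `mirror` yields the rest; `head≥0` is what multiplication by t needs, as it puts a 0 in front.
  record SymmetricUnimodal (n : ℕ) (x : ℕ → ℤ) : Set where
    field
      vanish : ∀ k → n ℕ.≤ k → x k ≡ + 0
      mirror : ∀ i j → suc (i ℕ.+ j) ≡ n → x i ≡ x j
      rise   : ∀ i → 2 ℕ.+ (i ℕ.+ i) ℕ.≤ n → x i ℤ.≤ x (suc i)
      head≥0 : + 0 ℤ.≤ x 0
  open SymmetricUnimodal

  SymmetricUnimodal-≗ : ∀ {n x y} → x ≗ y → SymmetricUnimodal n x → SymmetricUnimodal n y
  SymmetricUnimodal-≗ p s = record
    { vanish = λ k n≤k → trans (sym (p k)) (vanish s k n≤k)
    ; mirror = λ i j e → trans (sym (p i)) (trans (mirror s i j e) (p j))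
    ; rise   = λ i le → subst₂ ℤ._≤_ (p i) (p (suc i)) (rise s i le)
    ; head≥0 = subst (+ 0 ℤ.≤_) (p 0) (head≥0 s) }

  -- Consecutive coefficients of (1+t)x differ by x_(i+2) - x_i. Before the centre this is a sum of
  -- two rises; when i and i + 2 lie on either side of the centre, they are mirror images and the
  -- difference is 0.
  SymmetricUnimodal-1+t* : ∀ {n} x → SymmetricUnimodal n (coeff x) → SymmetricUnimodal (suc n) (coeff (1+t * x))
  SymmetricUnimodal-1+t* {n} x s = SymmetricUnimodal-≗
    (λ { zero → sym (coeff-1+t*-zero x) ; (suc k) → sym (coeff-1+t*-suc x k) })
    (record { vanish = vanish′ ; mirror = mirror′ ; rise = rise′ ; head≥0 = head≥0 s })
    where
    y : ℕ → ℤ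
    y zero    = coeff x 0
    y (suc k) = coeff x (suc k) ℤ.+ coeff x k

    vanish′ : ∀ k → suc n ℕ.≤ k → y k ≡ + 0
    vanish′ (suc k) (s≤s n≤k) = cong₂ ℤ._+_ (vanish s (suc k) (ℕₚ.m≤n⇒m≤1+n n≤k)) (vanish s k n≤k)

    edge : ∀ j → suc j ≡ n → coeff x 0 ≡ y (suc j)
    edge j e = trans (mirror s 0 j e) (trans (sym (ℤₚ.+-identityˡ _))
      (cong (ℤ._+ coeff x j) (sym (vanish s (suc j) (ℕₚ.≤-reflexive (sym e))))))

    mirror′ : ∀ i j → suc (i ℕ.+ j) ≡ suc n → y i ≡ y j
    mirror′ zero    zero    e = refl
    mirror′ zero    (suc j) e = edge j (ℕₚ.suc-injective e)
    mirror′ (suc i) zero    e = sym (edge i (trans (cong suc (sym (ℕₚ.+-identityʳ i))) (ℕₚ.suc-injective e)))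
    mirror′ (suc i) (suc j) e = trans (ℤₚ.+-comm (coeff x (suc i)) (coeff x i)) (cong₂ ℤ._+_
      (mirror s i (suc j) (ℕₚ.suc-injective e))
      (mirror s (suc i) j (trans (cong suc (sym (ℕₚ.+-suc i j))) (ℕₚ.suc-injective e))))

    x1≥0 : 1 ℕ.≤ n → + 0 ℤ.≤ coeff x 1
    x1≥0 le with ℕₚ.m≤n⇒m<n∨m≡n le
    ... | inj₁ 2≤n = ℤₚ.≤-trans (head≥0 s) (rise s 0 2≤n)
    ... | inj₂ 1≡n = ℤₚ.≤-reflexive (sym (vanish s 1 (ℕₚ.≤-reflexive (sym 1≡n))))

    skip : ∀ i → 3 ℕ.+ (i ℕ.+ i) ℕ.≤ n → coeff x i ℤ.≤ coeff x (2 ℕ.+ i)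
    skip i le with ℕₚ.m≤n⇒m<n∨m≡n le
    ... | inj₁ lt = ℤₚ.≤-trans (rise s i (ℕₚ.≤-trans (ℕₚ.n≤1+n _) le))
                      (rise s (suc i) (subst (λ z → suc (suc (suc z)) ℕ.≤ n) (sym (ℕₚ.+-suc i i)) lt))
    ... | inj₂ e  = ℤₚ.≤-reflexive (mirror s i (2 ℕ.+ i) (trans (cong suc (trans (ℕₚ.+-suc i (suc i)) (cong suc (ℕₚ.+-suc i i)))) e))

    rise′ : ∀ i → 2 ℕ.+ (i ℕ.+ i) ℕ.≤ suc n → y i ℤ.≤ y (suc i)
    rise′ zero (s≤s le) = subst (ℤ._≤ coeff x 1 ℤ.+ coeff x 0) (ℤₚ.+-identityˡ _) (ℤₚ.+-monoˡ-≤ (coeff x 0) (x1≥0 le))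
    rise′ (suc i) (s≤s le) = subst (ℤ._≤ y (2 ℕ.+ i)) (ℤₚ.+-comm (coeff x i) (coeff x (suc i)))
      (ℤₚ.+-monoˡ-≤ (coeff x (suc i)) (skip i (subst (λ z → suc (suc z) ℕ.≤ n) (ℕₚ.+-suc i i) le)))

  SymmetricUnimodal-t* : ∀ {n} x → SymmetricUnimodal n (coeff x) → SymmetricUnimodal (2 ℕ.+ n) (coeff (t * x))
  SymmetricUnimodal-t* {n} x s = SymmetricUnimodal-≗
    (λ { zero → sym (coeff-t*-zero x) ; (suc k) → sym (coeff-t*-suc x k) })
    (record { vanish = vanish′ ; mirror = mirror′ ; rise = rise′ ; head≥0 = ℤₚ.≤-refl })
    where
    y : ℕ → ℤ
    y zero    = + 0
    y (suc k) = coeff x k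

    vanish′ : ∀ k → 2 ℕ.+ n ℕ.≤ k → y k ≡ + 0
    vanish′ (suc k) (s≤s le) = vanish s k (ℕₚ.<⇒≤ le)

    edge : ∀ j → j ≡ n → + 0 ≡ coeff x j
    edge j e = sym (vanish s j (ℕₚ.≤-reflexive (sym e)))

    mirror′ : ∀ i j → suc (i ℕ.+ j) ≡ 2 ℕ.+ n → y i ≡ y j
    mirror′ zero    zero    e = refl
    mirror′ zero    (suc j) e = edge j (ℕₚ.suc-injective (ℕₚ.suc-injective e))
    mirror′ (suc i) zero    e = sym (edge i (trans (sym (ℕₚ.+-identityʳ i)) (ℕₚ.suc-injective (ℕₚ.suc-injective e))))
    mirror′ (suc i) (suc j) e = mirror s i j (trans (sym (ℕₚ.+-suc i j)) (ℕₚ.suc-injective (ℕₚ.suc-injective e)))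

    rise′ : ∀ i → 2 ℕ.+ (i ℕ.+ i) ℕ.≤ 2 ℕ.+ n → y i ℤ.≤ y (suc i)
    rise′ zero    le = head≥0 s
    rise′ (suc i) (s≤s (s≤s le)) = rise s i (subst (λ z → suc z ℕ.≤ n) (ℕₚ.+-suc i i) le)

  SymmetricUnimodal-zero : ∀ {n} → SymmetricUnimodal n (coeff 0#)
  SymmetricUnimodal-zero = SymmetricUnimodal-≗ {x = λ _ → + 0} (λ { zero → refl ; (suc _) → refl }) (record
    { vanish = λ _ _ → refl ; mirror = λ _ _ _ → refl ; rise = λ _ _ → ℤₚ.≤-refl ; head≥0 = ℤₚ.≤-refl })

  Pos-SymmetricUnimodal : ∀ {n x} → Pos 1 n x → SymmetricUnimodal n (coeff x)
  Pos-SymmetricUnimodal unit = record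
    { vanish = λ { (suc k) _ → refl }
    ; mirror = λ { zero zero _ → refl }
    ; rise = λ { _ (s≤s ()) } ; head≥0 = ℤ.+≤+ z≤n }
  Pos-SymmetricUnimodal zero = SymmetricUnimodal-zero
  Pos-SymmetricUnimodal (add p q) = let s = Pos-SymmetricUnimodal p ; u = Pos-SymmetricUnimodal q in record
    { vanish = λ k le → cong₂ ℤ._+_ (vanish s k le) (vanish u k le)
    ; mirror = λ i j e → cong₂ ℤ._+_ (mirror s i j e) (mirror u i j e)
    ; rise   = λ i le → ℤₚ.+-mono-≤ (rise s i le) (rise u i le)
    ; head≥0 = ℤₚ.+-mono-≤ (head≥0 s) (head≥0 u) }
  Pos-SymmetricUnimodal (1+t*_ {x = x} p) = SymmetricUnimodal-1+t* x (Pos-SymmetricUnimodal p)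
  Pos-SymmetricUnimodal (t*_ {x = x} p) = SymmetricUnimodal-t* x (Pos-SymmetricUnimodal p)
  Pos-SymmetricUnimodal (resp r p) = SymmetricUnimodal-≗ (at r) (Pos-SymmetricUnimodal p)

  -- Alternating binomial sums as multiplication by powers of 1 - t.

  sumℤ-map : ∀ (g : ℕ → ℤ) f n → sumℤ (map g (applyUpTo f n)) ≡ sumTo n (λ k → g (f k))
  sumℤ-map g f zero    = refl
  sumℤ-map g f (suc n) = cong (ℤ._+_ (g (f 0))) (sumℤ-map g (λ k → f (suc k)) n)

  sumTo-≗ : ∀ n {f g : ℕ → ℤ} → f ≗ g → sumTo n f ≡ sumTo n g
  sumTo-≗ n p = sumTo-cong n (λ k _ → p k)

  sumTo-minus : ∀ n f g → sumTo n (λ k → f k ℤ.- g k) ≡ sumTo n f ℤ.- sumTo n g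
  sumTo-minus zero    f g = refl
  sumTo-minus (suc n) f g rewrite sumTo-minus n (λ k → f (suc k)) (λ k → g (suc k)) = lemma (f 0) (g 0) _ _
    where
    lemma : ∀ a b u v → (a ℤ.- b) ℤ.+ (u ℤ.- v) ≡ (a ℤ.+ u) ℤ.- (b ℤ.+ v)
    lemma = solve-∀

  binomialSum : ℕ → (ℕ → ℤ) → ℤ
  binomialSum p h = sumTo (suc p) (λ j → sgn j ℤ.* + (p C j) ℤ.* h j)

  binomialSum-cong : ∀ p {h k} → h ≗ k → binomialSum p h ≡ binomialSum p k
  binomialSum-cong p e = sumTo-≗ (suc p) (λ j → cong (ℤ._*_ (sgn j ℤ.* + (p C j))) (e j))

  binomialSum-zero : ∀ p → binomialSum p (λ _ → + 0) ≡ + 0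
  binomialSum-zero p = trans (sumTo-≗ (suc p) (λ j → ℤₚ.*-zeroʳ (sgn j ℤ.* + (p C j)))) (sumTo-zero (suc p))

  binomialSum-suc : ∀ p h → binomialSum (suc p) h ≡ binomialSum p h ℤ.- binomialSum p (λ j → h (suc j))
  binomialSum-suc p h = begin
    f₀ ℤ.+ sumTo (suc p) (λ j → sgn (suc j) ℤ.* + (suc p C suc j) ℤ.* h (suc j))
      ≡⟨ cong (ℤ._+_ f₀) (sumTo-≗ (suc p) pascal) ⟩
    f₀ ℤ.+ sumTo (suc p) (λ j → f (suc j) ℤ.- g j)
      ≡⟨ cong (ℤ._+_ f₀) (sumTo-minus (suc p) (λ j → f (suc j)) g) ⟩
    f₀ ℤ.+ (sumTo (suc p) (λ j → f (suc j)) ℤ.- sumTo (suc p) g)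
      ≡⟨ sym (ℤₚ.+-assoc f₀ _ _) ⟩
    sumTo (suc (suc p)) f ℤ.- sumTo (suc p) g
      ≡⟨ cong (ℤ._- sumTo (suc p) g) (trans (sumTo-last (suc p) f)
           (trans (cong (ℤ._+_ (sumTo (suc p) f)) last) (ℤₚ.+-identityʳ (sumTo (suc p) f)))) ⟩
    binomialSum p h ℤ.- binomialSum p (λ j → h (suc j)) ∎
    where
    open ≡-Reasoning
    f g : ℕ → ℤ
    f j = sgn j ℤ.* + (p C j) ℤ.* h j
    g j = sgn j ℤ.* + (p C j) ℤ.* h (suc j)
    f₀ : ℤ
    f₀ = f 0
    last : f (suc p) ≡ + 0
    last = trans (cong (λ z → sgn (suc p) ℤ.* + z ℤ.* h (suc p)) (k>n⇒nCk≡0 {p} {suc p} ℕₚ.≤-refl))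
      (trans (cong (ℤ._* h (suc p)) (ℤₚ.*-zeroʳ (sgn (suc p)))) refl)
    pascal : ∀ j → sgn (suc j) ℤ.* + (suc p C suc j) ℤ.* h (suc j) ≡ f (suc j) ℤ.- g j
    pascal j = trans (cong (λ z → sgn (suc j) ℤ.* + z ℤ.* h (suc j)) (sym (nCk+nC[k+1]≡[n+1]C[k+1] p j)))
      (lemma (sgn j) (+ (p C j)) (+ (p C suc j)) (h (suc j)))
      where
      lemma : ∀ s a b x → (ℤ.- s) ℤ.* (a ℤ.+ b) ℤ.* x ≡ (ℤ.- s) ℤ.* b ℤ.* x ℤ.- s ℤ.* a ℤ.* x
      lemma = solve-∀

  -- The coefficient of t^m in t^j f.
  delayed : (ℕ → ℤ) → ℕ → ℕ → ℤ
  delayed f m       zero    = f m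
  delayed f zero    (suc j) = + 0
  delayed f (suc m) (suc j) = delayed f m j

  <ᵇ-suc : ∀ j m → (j <ᵇ suc m) ≡ (j ≤ᵇ m)
  <ᵇ-suc zero    m = refl
  <ᵇ-suc (suc j) m = refl

  delayed-if : ∀ f m j a → (if j ≤ᵇ m then a ℤ.* f (m ∸ j) else + 0) ≡ a ℤ.* delayed f m j
  delayed-if f m       zero    a = refl
  delayed-if f zero    (suc j) a = sym (ℤₚ.*-zeroʳ a)
  delayed-if f (suc m) (suc j) a rewrite <ᵇ-suc j m = delayed-if f m j a

  powTerm : ℕ → ℕ → (ℕ → ℤ) → ℕ → ℕ → ℤ
  powTerm p s f m j = if s ℕ.* j ≤ᵇ m then sgn j ℤ.* + (p C j) ℤ.* f (m ∸ s ℕ.* j) else + 0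

  mulOneMinusPow-sumTo : ∀ p s f m → mulOneMinusPow p s f m ≡ sumTo (suc p) (powTerm p s f m)
  mulOneMinusPow-sumTo p s f m = sumℤ-map (powTerm p s f m) id (suc p)

  mulOneMinusPow-1 : ∀ p f m → mulOneMinusPow p 1 f m ≡ binomialSum p (delayed f m)
  mulOneMinusPow-1 p f m = trans (mulOneMinusPow-sumTo p 1 f m) (sumTo-≗ (suc p) λ j →
    trans (cong (λ z → if z ≤ᵇ m then sgn j ℤ.* + (p C j) ℤ.* f (m ∸ z) else + 0) (ℕₚ.*-identityˡ j))
          (delayed-if f m j (sgn j ℤ.* + (p C j))))

  binomialSum-[1-t]^ : ∀ p x m → binomialSum p (delayed (coeff x) m) ≡ coeff ([1-t]^ p * x) m
  binomialSum-[1-t]^ zero x m = trans (lemma (coeff x m)) (sym (coeff-1* x m))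
    where
    lemma : ∀ a → + 1 ℤ.* + 1 ℤ.* a ℤ.+ + 0 ≡ a
    lemma = solve-∀
  binomialSum-[1-t]^ (suc p) x zero = begin
    binomialSum (suc p) (delayed (coeff x) 0)
      ≡⟨ binomialSum-suc p (delayed (coeff x) 0) ⟩
    binomialSum p (delayed (coeff x) 0) ℤ.- binomialSum p (λ _ → + 0)
      ≡⟨ cong₂ ℤ._-_ (binomialSum-[1-t]^ p x 0) (binomialSum-zero p) ⟩
    coeff ([1-t]^ p * x) 0 ℤ.+ + 0
      ≡⟨ ℤₚ.+-identityʳ _ ⟩
    coeff ([1-t]^ p * x) 0
      ≡⟨ sym (coeff-1-t*-zero ([1-t]^ p * x)) ⟩
    coeff (1-t * ([1-t]^ p * x)) 0
      ≡⟨ sym (at (ℤ[[t]].*-assoc 1-t ([1-t]^ p) x) 0) ⟩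
    coeff ([1-t]^ (suc p) * x) 0 ∎
    where open ≡-Reasoning
  binomialSum-[1-t]^ (suc p) x (suc m) = begin
    binomialSum (suc p) (delayed (coeff x) (suc m))
      ≡⟨ binomialSum-suc p (delayed (coeff x) (suc m)) ⟩
    binomialSum p (delayed (coeff x) (suc m)) ℤ.- binomialSum p (delayed (coeff x) m)
      ≡⟨ cong₂ ℤ._-_ (binomialSum-[1-t]^ p x (suc m)) (binomialSum-[1-t]^ p x m) ⟩
    coeff ([1-t]^ p * x) (suc m) ℤ.- coeff ([1-t]^ p * x) m
      ≡⟨ sym (coeff-1-t*-suc ([1-t]^ p * x) m) ⟩
    coeff (1-t * ([1-t]^ p * x)) (suc m)
      ≡⟨ sym (at (ℤ[[t]].*-assoc 1-t ([1-t]^ p) x) (suc m)) ⟩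
    coeff ([1-t]^ (suc p) * x) (suc m) ∎
    where open ≡-Reasoning

  delayed-cong : ∀ {f g} → f ≗ g → ∀ m → delayed f m ≗ delayed g m
  delayed-cong e m       zero    = e m
  delayed-cong e zero    (suc j) = refl
  delayed-cong e (suc m) (suc j) = delayed-cong e m j

  mulOneMinusPow-[1-t]^ : ∀ p f x → f ≗ coeff x → ∀ m → mulOneMinusPow p 1 f m ≡ coeff ([1-t]^ p * x) m
  mulOneMinusPow-[1-t]^ p f x e m = trans (mulOneMinusPow-1 p f m)
    (trans (binomialSum-cong p (delayed-cong e m)) (binomialSum-[1-t]^ p x m))

  data Parity : ℕ → Set where
    even : ∀ k → Parity (k ℕ.+ k)
    odd  : ∀ k → Parity (suc (k ℕ.+ k))

  parity : ∀ n → Parity n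
  parity zero = even 0
  parity (suc n) with parity n
  ... | even k = odd k
  ... | odd k  = subst Parity (cong suc (ℕₚ.+-suc k k)) (even (suc k))

  if-cong : ∀ {b c} {x y : ℤ} → b ≡ c → (c ≡ true → x ≡ y) → (if b then x else + 0) ≡ (if c then y else + 0)
  if-cong {true}  refl e = e refl
  if-cong {false} refl e = refl

  2*≡ : ∀ k → 2 ℕ.* k ≡ k ℕ.+ k
  2*≡ k = cong (k ℕ.+_) (ℕₚ.+-identityʳ k)

  double-∸ : ∀ k j → k ℕ.+ k ∸ (j ℕ.+ j) ≡ (k ∸ j) ℕ.+ (k ∸ j)
  double-∸ k j = trans (cong₂ _∸_ (sym (2*≡ k)) (sym (2*≡ j)))
    (trans (sym (ℕₚ.*-distribˡ-∸ 2 k j)) (2*≡ (k ∸ j)))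

  module _ (p : ℕ) (f : ℕ → ℤ) where

    shift-even : ∀ j k r → (j ≤ᵇ k) ≡ true → r ℕ.+ (k ℕ.+ k) ∸ 2 ℕ.* j ≡ r ℕ.+ ((k ∸ j) ℕ.+ (k ∸ j))
    shift-even j k r j≤k = begin
      r ℕ.+ (k ℕ.+ k) ∸ 2 ℕ.* j            ≡⟨ ℕₚ.+-∸-assoc r (subst (ℕ._≤ k ℕ.+ k) (sym (2*≡ j)) (ℕₚ.+-mono-≤ le le)) ⟩
      r ℕ.+ (k ℕ.+ k ∸ 2 ℕ.* j)            ≡⟨ cong (r ℕ.+_) (trans (cong (k ℕ.+ k ∸_) (2*≡ j)) (double-∸ k j)) ⟩
      r ℕ.+ ((k ∸ j) ℕ.+ (k ∸ j))          ∎
      where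
      open ≡-Reasoning
      le : j ℕ.≤ k
      le = true-≤ᵇ j≤k

    bound : ∀ j k r → r ℕ.≤ 1 → (2 ℕ.* j ≤ᵇ r ℕ.+ (k ℕ.+ k)) ≡ (j ≤ᵇ k)
    bound j k r r≤1 = bool-iff
      (λ e → ≤ᵇ-true (down (subst (ℕ._≤ r ℕ.+ (k ℕ.+ k)) (2*≡ j) (true-≤ᵇ {2 ℕ.* j} e))))
      (λ e → ≤ᵇ-true {2 ℕ.* j} (ℕₚ.≤-trans (subst (ℕ._≤ k ℕ.+ k) (sym (2*≡ j))
               (ℕₚ.+-mono-≤ (true-≤ᵇ {j} {k} e) (true-≤ᵇ {j} {k} e))) (ℕₚ.m≤n+m (k ℕ.+ k) r)))
      where
      down : j ℕ.+ j ℕ.≤ r ℕ.+ (k ℕ.+ k) → j ℕ.≤ k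
      down le with j ℕ.≤? k
      ... | yes j≤k = j≤k
      ... | no  j≰k = contradiction (ℕₚ.≤-trans le (ℕₚ.+-monoˡ-≤ (k ℕ.+ k) r≤1)) (ℕₚ.<⇒≱
            (subst (ℕ._≤ j ℕ.+ j) (cong suc (ℕₚ.+-suc k k)) (ℕₚ.+-mono-≤ (ℕₚ.≰⇒> j≰k) (ℕₚ.≰⇒> j≰k))))

    -- Multiplication by 1 - t² respects the parity of exponents and acts on each parity class as 1
    -- - t does.
    mulOneMinusPow-2 : ∀ r k → r ℕ.≤ 1 →
      mulOneMinusPow p 2 f (r ℕ.+ (k ℕ.+ k)) ≡ mulOneMinusPow p 1 (λ k → f (r ℕ.+ (k ℕ.+ k))) k
    mulOneMinusPow-2 r k r≤1 = trans (mulOneMinusPow-sumTo p 2 f (r ℕ.+ (k ℕ.+ k)))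
      (trans (sumTo-≗ (suc p) term) (sym (mulOneMinusPow-sumTo p 1 (λ k → f (r ℕ.+ (k ℕ.+ k))) k)))
      where
      term : ∀ j → powTerm p 2 f (r ℕ.+ (k ℕ.+ k)) j ≡ powTerm p 1 (λ k → f (r ℕ.+ (k ℕ.+ k))) k j
      term j = if-cong (trans (bound j k r r≤1) (cong (_≤ᵇ k) 1*j))
        (λ e → cong (λ z → sgn j ℤ.* + (p C j) ℤ.* f z)
          (trans (shift-even j k r (trans (cong (_≤ᵇ k) 1*j) e)) (cong (λ z → r ℕ.+ ((k ∸ z) ℕ.+ (k ∸ z))) 1*j)))
        where
        1*j : j ≡ 1 ℕ.* j
        1*j = sym (ℕₚ.*-identityˡ j)

  isEven-even : ∀ k → isEven (k ℕ.+ k) ≡ true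
  isEven-even zero    = refl
  isEven-even (suc k) rewrite ℕₚ.+-suc k k | isEven-even k = refl

  half-even : ∀ k → ⌊ k ℕ.+ k /2⌋ ≡ k
  half-even k = sym (ℕₚ.n≡⌊n+n/2⌋ k)

  half-odd : ∀ k → ⌊ suc (k ℕ.+ k) /2⌋ ≡ k
  half-odd k = sym (ℕₚ.n≡⌈n+n/2⌉ k)

  2*suc∸1 : ∀ e → 2 ℕ.* suc e ∸ 1 ≡ suc (e ℕ.+ e)
  2*suc∸1 e = trans (cong (λ z → e ℕ.+ suc z) (ℕₚ.+-identityʳ e)) (ℕₚ.+-suc e e)

  -- Interlacing of the two numerators.

  module Interleaving (e : ℕ) (α β : Series)
    (α-su : SymmetricUnimodal (suc e) (coeff α)) (β-su : SymmetricUnimodal e (coeff β))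
    (δ : ℕ → ℤ) (δ≗ : δ ≗ coeff (α + t * β)) where

    d : ℕ
    d = suc e

    ω : ℕ → ℤ
    ω = coeff (α + β)

    δ-vanish : ∀ k → d ℕ.≤ k → δ k ≡ + 0
    δ-vanish (suc k) (s≤s e≤k) = trans (δ≗ (suc k))
      (cong₂ ℤ._+_ (vanish α-su (suc k) (s≤s e≤k)) (trans (coeff-t*-suc β k) (vanish β-su k e≤k)))

    ω-vanish : ∀ k → d ℕ.≤ k → ω k ≡ + 0
    ω-vanish k d≤k = cong₂ ℤ._+_ (vanish α-su k d≤k) (vanish β-su k (ℕₚ.<⇒≤ d≤k))

    -- Reversal of a sequence of length d fixes α, which has that length, and turns β, which is one
    -- shorter, into tβ.
    ω-mirror : ∀ i j → i ℕ.+ j ≡ e → ω i ≡ δ j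
    ω-mirror i j p = trans (cong₂ ℤ._+_ (mirror α-su i j (cong suc p)) (β-mirror i j p)) (sym (δ≗ j))
      where
      β-mirror : ∀ i j → i ℕ.+ j ≡ e → coeff β i ≡ coeff (t * β) j
      β-mirror i zero    p = trans (vanish β-su i (ℕₚ.≤-reflexive (trans (sym p) (ℕₚ.+-identityʳ i)))) (sym (coeff-t*-zero β))
      β-mirror i (suc j) p = trans (mirror β-su i j (trans (sym (ℕₚ.+-suc i j)) p)) (sym (coeff-t*-suc β j))

    -- α cancels, and what remains is a rise of β, or nonnegativity of its constant term when i = 0.
    δ≤ω : ∀ i → i ℕ.+ i ℕ.≤ e → δ i ℤ.≤ ω i
    δ≤ω i le = ℤₚ.≤-trans (ℤₚ.≤-reflexive (δ≗ i)) (ℤₚ.+-monoʳ-≤ (coeff α i) (tβ≤β i le))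
      where
      tβ≤β : ∀ i → i ℕ.+ i ℕ.≤ e → coeff (t * β) i ℤ.≤ coeff β i
      tβ≤β zero    le = subst (ℤ._≤ coeff β 0) (sym (coeff-t*-zero β)) (head≥0 β-su)
      tβ≤β (suc i) le = subst (ℤ._≤ coeff β (suc i)) (sym (coeff-t*-suc β i))
        (rise β-su i (subst (ℕ._≤ e) (cong suc (ℕₚ.+-suc i i)) le))

    -- β cancels, since tβ has β_i at index i + 1, and what remains is a rise of α.
    ω≤δ : ∀ i → suc (i ℕ.+ i) ℕ.≤ e → ω i ℤ.≤ δ (suc i)
    ω≤δ i le = ℤₚ.≤-trans (ℤₚ.+-monoˡ-≤ (coeff β i) (rise α-su i (s≤s le)))
      (ℤₚ.≤-reflexive (sym (trans (δ≗ (suc i)) (cong (ℤ._+_ (coeff α (suc i))) (coeff-t*-suc β i)))))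

    interleave-even : ∀ k → interleave d δ (k ℕ.+ k) ≡ δ k
    interleave-even k rewrite isEven-even k | half-even k = refl

    interleave-odd : ∀ k → interleave d δ (suc (k ℕ.+ k)) ≡ δ (e ∸ k)
    interleave-odd k rewrite isEven-even k | half-odd k = refl

    interleave-odd-ω : ∀ k → k ℕ.≤ e → interleave d δ (suc (k ℕ.+ k)) ≡ ω k
    interleave-odd-ω k le = trans (interleave-odd k) (sym (ω-mirror k (e ∸ k) (ℕₚ.m+[n∸m]≡n le)))

    top : ℕ
    top = 2 ℕ.* d ∸ 1

    double-≤ : ∀ i → i ℕ.+ i ℕ.≤ suc (e ℕ.+ e) → i ℕ.≤ e
    double-≤ i le with i ℕ.≤? e
    ... | yes i≤e = i≤e
    ... | no  i≰e = contradiction le (ℕₚ.<⇒≱ (subst (ℕ._≤ i ℕ.+ i) (cong suc (ℕₚ.+-suc e e)) (ℕₚ.+-mono-≤ (ℕₚ.≰⇒> i≰e) (ℕₚ.≰⇒> i≰e))))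

    symmetric : Symmetric top (interleave d δ)
    symmetric i i≤top = go (parity i) (subst (i ℕ.≤_) (2*suc∸1 e) i≤top)
      where
      go : ∀ {i} → Parity i → i ℕ.≤ suc (e ℕ.+ e) → interleave d δ i ≡ interleave d δ (top ∸ i)
      go (even k) le = begin
        interleave d δ (k ℕ.+ k)                         ≡⟨ interleave-even k ⟩
        δ k                                              ≡⟨ cong δ (sym (ℕₚ.m∸[m∸n]≡n k≤e)) ⟩
        δ (e ∸ (e ∸ k))                                  ≡⟨ sym (interleave-odd (e ∸ k)) ⟩
        interleave d δ (suc ((e ∸ k) ℕ.+ (e ∸ k)))       ≡⟨ cong (interleave d δ) (sym (trans (cong (_∸ (k ℕ.+ k)) (2*suc∸1 e))
                                                              (trans (ℕₚ.+-∸-assoc 1 (ℕₚ.+-mono-≤ k≤e k≤e)) (cong suc (double-∸ e k))))) ⟩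
        interleave d δ (top ∸ (k ℕ.+ k))                 ∎
        where
        open ≡-Reasoning
        k≤e : k ℕ.≤ e
        k≤e = double-≤ k le
      go (odd k) (s≤s le) = begin
        interleave d δ (suc (k ℕ.+ k))                   ≡⟨ interleave-odd k ⟩
        δ (e ∸ k)                                        ≡⟨ sym (interleave-even (e ∸ k)) ⟩
        interleave d δ ((e ∸ k) ℕ.+ (e ∸ k))             ≡⟨ cong (interleave d δ) (sym (trans (cong (_∸ suc (k ℕ.+ k)) (2*suc∸1 e)) (double-∸ e k))) ⟩
        interleave d δ (top ∸ suc (k ℕ.+ k))             ∎
        where open ≡-Reasoning

    rising : ∀ i → i ℕ.< d → interleave d δ i ℤ.≤ interleave d δ (suc i)
    rising i i<d = go (parity i) (ℕₚ.≤-pred i<d)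
      where
      go : ∀ {i} → Parity i → i ℕ.≤ e → interleave d δ i ℤ.≤ interleave d δ (suc i)
      go (even k) le = subst₂ ℤ._≤_ (sym (interleave-even k))
        (sym (interleave-odd-ω k (ℕₚ.≤-trans (ℕₚ.m≤m+n k k) le))) (δ≤ω k le)
      go (odd k) le = subst₂ ℤ._≤_ (sym (interleave-odd-ω k (ℕₚ.≤-trans (ℕₚ.m≤m+n k k) (ℕₚ.<⇒≤ le))))
        (trans (sym (interleave-even (suc k))) (cong (λ z → interleave d δ (suc z)) (ℕₚ.+-suc k k))) (ω≤δ k le)

    unimodal : Unimodal top (interleave d δ)
    -- The axis of symmetry of the 2d entries lies between the indices d - 1 and d. Index d can
    -- serve as the peak because `rising` includes the central step.
    unimodal = d , d≤top , rising , falling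
      where
      d≤top : d ℕ.≤ top
      d≤top = subst (d ℕ.≤_) (sym (2*suc∸1 e)) (s≤s (ℕₚ.m≤m+n e e))
      falling : ∀ i → d ℕ.≤ i → i ℕ.< top → interleave d δ (suc i) ℤ.≤ interleave d δ i
      falling i d≤i i<top = subst₂ ℤ._≤_ (sym (symmetric (suc i) i<top))
        (trans (cong (interleave d δ) (sym step)) (sym (symmetric i (ℕₚ.<⇒≤ i<top))))
        (rising (top ∸ suc i) small)
        where
        step : top ∸ i ≡ suc (top ∸ suc i)
        step = ℕₚ.+-∸-assoc 1 i<top
        small : top ∸ suc i ℕ.< d
        small = s≤s (ℕₚ.≤-trans (ℕₚ.∸-monoʳ-≤ top (s≤s d≤i)) (ℕₚ.≤-trans (ℕₚ.∸-monoʳ-≤ top (ℕₚ.n≤1+n d))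
          (ℕₚ.≤-reflexive (trans (cong (_∸ d) (2*suc∸1 e)) (ℕₚ.m+n∸m≡n e e)))))

    bound-false : ∀ k → e ℕ.< k → 2 ℕ.* d ℕ.≤ k ℕ.+ k
    bound-false k e<k = subst (ℕ._≤ k ℕ.+ k) (sym (cong (d ℕ.+_) (ℕₚ.+-identityʳ d))) (ℕₚ.+-mono-≤ e<k e<k)

    bound-true : ∀ k → k ℕ.≤ e → suc (suc (k ℕ.+ k)) ℕ.≤ 2 ℕ.* d
    bound-true k k≤e = subst (ℕ._≤ 2 ℕ.* d) (cong suc (ℕₚ.+-suc k k))
      (subst (suc k ℕ.+ suc k ℕ.≤_) (sym (cong (d ℕ.+_) (ℕₚ.+-identityʳ d))) (ℕₚ.+-mono-≤ (s≤s k≤e) (s≤s k≤e)))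

    second-even : ∀ k → secondForm d δ (k ℕ.+ k) ≡ δ k
    second-even k with k ℕ.≤? e
    ... | yes k≤e rewrite ≤ᵇ-true {suc (k ℕ.+ k)} (ℕₚ.<⇒≤ (bound-true k k≤e)) = interleave-even k
    ... | no k≰e rewrite ≤ᵇ-false {suc (k ℕ.+ k)} (s≤s (bound-false k (ℕₚ.≰⇒> k≰e))) = sym (δ-vanish k (ℕₚ.≰⇒> k≰e))

    second-odd : ∀ k → secondForm d δ (suc (k ℕ.+ k)) ≡ ω k
    second-odd k with k ℕ.≤? e
    ... | yes k≤e rewrite ≤ᵇ-true {suc (suc (k ℕ.+ k))} (bound-true k k≤e) = interleave-odd-ω k k≤e
    ... | no k≰e rewrite ≤ᵇ-false {suc (suc (k ℕ.+ k))} (s≤s (ℕₚ.m≤n⇒m≤1+n (bound-false k (ℕₚ.≰⇒> k≰e)))) =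
      sym (ω-vanish k (ℕₚ.≰⇒> k≰e))

    first-even : ∀ k → firstForm d δ (k ℕ.+ k) ≡ δ k
    first-even k rewrite isEven-even k | half-even k = ℤₚ.+-identityʳ (δ k)

    first-odd : ∀ k → firstForm d δ (suc (k ℕ.+ k)) ≡ ω k
    first-odd k rewrite isEven-even k = trans (ℤₚ.+-identityˡ _) (cases (k ℕ.≤? e))
      where
      cases : Dec (k ℕ.≤ e) → (if suc (k ℕ.+ k) ≤ᵇ top then δ ⌊ (top ∸ suc (k ℕ.+ k)) /2⌋ else + 0) ≡ ω k
      cases (yes k≤e) = trans (if-cong (≤ᵇ-true (subst (suc (k ℕ.+ k) ℕ.≤_) (sym (2*suc∸1 e)) (s≤s (ℕₚ.+-mono-≤ k≤e k≤e)))) (λ _ → refl))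
        (trans (cong δ (trans (cong ⌊_/2⌋ (trans (cong (_∸ suc (k ℕ.+ k)) (2*suc∸1 e)) (double-∸ e k))) (half-even (e ∸ k))))
               (sym (ω-mirror k (e ∸ k) (ℕₚ.m+[n∸m]≡n k≤e))))
      cases (no k≰e) = trans (if-cong {y = + 0} (≤ᵇ-false {suc (k ℕ.+ k)} {top} (s≤s (ℕₚ.≤-trans (ℕₚ.m∸n≤m (2 ℕ.* d) 1)
          (bound-false k (ℕₚ.≰⇒> k≰e))))) (λ ())) (sym (ω-vanish k (ℕₚ.≰⇒> k≰e)))

    first≡second : ∀ m → firstForm d δ m ≡ secondForm d δ m
    first≡second m with parity m
    ... | even k = trans (first-even k) (sym (second-even k))
    ... | odd k  = trans (first-odd k) (sym (second-odd k))

    numerator≡first : (c : ℕ → ℤ) → (∀ k → c (k ℕ.+ k) ≡ δ k) → (∀ k → c (suc (k ℕ.+ k)) ≡ ω k) → ∀ m → c m ≡ firstForm d δ m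
    numerator≡first c c-even c-odd m with parity m
    ... | even k = trans (c-even k) (sym (first-even k))
    ... | odd k  = trans (c-odd k) (sym (first-odd k))

-- Reciprocity by finite differences.

module Reciprocities where
  open PowerSeries
  open GammaPositive
  open Numerators using (coeff-1-t*-zero; coeff-1-t*-suc)
  open +-*-Solver using (solve; _:=_; _:+_; _:*_; _:-_; :-_; con)

  toℚ : ℤ → ℚ
  toℚ z = z ℚ./ 1

  toℚ-+ : ∀ a b → toℚ (a ℤ.+ b) ≡ toℚ a ℚ.+ toℚ b
  toℚ-+ a b = ℚₚ.toℚᵘ-injective (begin
    ℚ.toℚᵘ (toℚ (a ℤ.+ b))                 ≈⟨ ℚₚ.toℚᵘ-fromℚᵘ (ℚᵘ.mkℚᵘ (a ℤ.+ b) 0) ⟩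
    ℚᵘ.mkℚᵘ (a ℤ.+ b) 0                    ≈⟨ ℚᵘ.*≡* (lemma a b) ⟩
    ℚᵘ.mkℚᵘ a 0 ℚᵘ.+ ℚᵘ.mkℚᵘ b 0           ≈⟨ ℚᵘₚ.+-cong (ℚᵘₚ.≃-sym (ℚₚ.toℚᵘ-fromℚᵘ (ℚᵘ.mkℚᵘ a 0))) (ℚᵘₚ.≃-sym (ℚₚ.toℚᵘ-fromℚᵘ (ℚᵘ.mkℚᵘ b 0))) ⟩
    ℚ.toℚᵘ (toℚ a) ℚᵘ.+ ℚ.toℚᵘ (toℚ b)     ≈⟨ ℚᵘₚ.≃-sym (ℚₚ.toℚᵘ-homo-+ (toℚ a) (toℚ b)) ⟩
    ℚ.toℚᵘ (toℚ a ℚ.+ toℚ b)               ∎)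
    where
    open Relation.Binary.Reasoning.Setoid ℚᵘₚ.≃-setoid
    lemma : ∀ a b → (a ℤ.+ b) ℤ.* + 1 ≡ (a ℤ.* + 1 ℤ.+ b ℤ.* + 1) ℤ.* + 1
    lemma = solve-∀

  toℚ-* : ∀ a b → toℚ (a ℤ.* b) ≡ toℚ a ℚ.* toℚ b
  toℚ-* a b = ℚₚ.toℚᵘ-injective (begin
    ℚ.toℚᵘ (toℚ (a ℤ.* b))                 ≈⟨ ℚₚ.toℚᵘ-fromℚᵘ (ℚᵘ.mkℚᵘ (a ℤ.* b) 0) ⟩
    ℚᵘ.mkℚᵘ a 0 ℚᵘ.* ℚᵘ.mkℚᵘ b 0           ≈⟨ ℚᵘₚ.*-cong (ℚᵘₚ.≃-sym (ℚₚ.toℚᵘ-fromℚᵘ (ℚᵘ.mkℚᵘ a 0))) (ℚᵘₚ.≃-sym (ℚₚ.toℚᵘ-fromℚᵘ (ℚᵘ.mkℚᵘ b 0))) ⟩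
    ℚ.toℚᵘ (toℚ a) ℚᵘ.* ℚ.toℚᵘ (toℚ b)     ≈⟨ ℚᵘₚ.≃-sym (ℚₚ.toℚᵘ-homo-* (toℚ a) (toℚ b)) ⟩
    ℚ.toℚᵘ (toℚ a ℚ.* toℚ b)               ∎)
    where open Relation.Binary.Reasoning.Setoid ℚᵘₚ.≃-setoid

  toℚ-minus : ∀ a b → toℚ (a ℤ.- b) ≡ toℚ a ℚ.- toℚ b
  toℚ-minus a b = begin
    toℚ (a ℤ.- b)                            ≡⟨ solve 2 (λ x y → x := (x :+ y) :- y) refl (toℚ (a ℤ.- b)) (toℚ b) ⟩
    (toℚ (a ℤ.- b) ℚ.+ toℚ b) ℚ.- toℚ b      ≡⟨ cong (ℚ._- toℚ b) (trans (sym (toℚ-+ (a ℤ.- b) b)) (cong toℚ (lemma a b))) ⟩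
    toℚ a ℚ.- toℚ b                          ∎
    where
    open ≡-Reasoning
    lemma : ∀ a b → (a ℤ.- b) ℤ.+ b ≡ a
    lemma = solve-∀

  Δ : (ℤ → ℚ) → ℤ → ℚ
  Δ f k = f (ℤ.suc k) ℚ.- f k

  -- A vanishing D-th difference on all of ℤ characterises the polynomial functions of degree below
  -- D, and it can be checked for functions not given by a coefficient list.
  Annihilated : ℕ → (ℤ → ℚ) → Set
  Annihilated zero    f = ∀ k → f k ≡ 0ℚ
  Annihilated (suc D) f = Annihilated D (Δ f)

  Ann-≗ : ∀ D {f g} → f ≗ g → Annihilated D g → Annihilated D f
  Ann-≗ zero    p a k = trans (p k) (a k)
  Ann-≗ (suc D) p a   = Ann-≗ D (λ k → cong₂ ℚ._-_ (p (ℤ.suc k)) (p k)) a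

  Ann-zero : ∀ D → Annihilated D (λ _ → 0ℚ)
  Ann-zero zero    k = refl
  Ann-zero (suc D)   = Ann-zero D

  Ann-+ : ∀ D {f g} → Annihilated D f → Annihilated D g → Annihilated D (λ k → f k ℚ.+ g k)
  Ann-+ zero    a b k = cong₂ ℚ._+_ (a k) (b k)
  Ann-+ (suc D) {f} {g} a b = Ann-≗ D
    (λ k → solve 4 (λ x y u v → (x :+ u) :- (y :+ v) := (x :- y) :+ (u :- v)) refl (f (ℤ.suc k)) (f k) (g (ℤ.suc k)) (g k))
    (Ann-+ D a b)

  Ann-* : ∀ D c {f} → Annihilated D f → Annihilated D (λ k → c ℚ.* f k)
  Ann-* zero    c a k = trans (cong (c ℚ.*_) (a k)) (ℚₚ.*-zeroʳ c)
  Ann-* (suc D) c {f} a = Ann-≗ D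
    (λ k → solve 3 (λ c x y → c :* x :- c :* y := c :* (x :- y)) refl c (f (ℤ.suc k)) (f k)) (Ann-* D c a)

  Ann-minus : ∀ D {f g} → Annihilated D f → Annihilated D g → Annihilated D (λ k → f k ℚ.- g k)
  Ann-minus D {f} {g} a b = Ann-≗ D
    (λ k → solve 2 (λ x y → x :- y := x :+ (:- con (+ 1 ℚ./ 1)) :* y) refl (f k) (g k)) (Ann-+ D a (Ann-* D (ℚ.- (+ 1 ℚ./ 1)) b))

  Ann-suc : ∀ D {f} → Annihilated D f → Annihilated (suc D) f
  Ann-suc zero    a k = cong₂ ℚ._-_ (a (ℤ.suc k)) (a k)
  Ann-suc (suc D) a   = Ann-suc D a

  Ann-raise : ∀ m D {f} → Annihilated D f → Annihilated (m ℕ.+ D) f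
  Ann-raise zero    D a = a
  Ann-raise (suc m) D a = Ann-suc (m ℕ.+ D) (Ann-raise m D a)

  Ann-shift : ∀ D {f} → Annihilated D f → Annihilated D (λ k → f (ℤ.suc k))
  Ann-shift zero    a k = a (ℤ.suc k)
  Ann-shift (suc D) a   = Ann-shift D a

  -- By induction the difference vanishes everywhere, so f is constant and negative arguments are
  -- reached by stepping down from 0.
  Ann-unique-zero : ∀ D {f} → Annihilated D f → (∀ n → f (+ n) ≡ 0ℚ) → ∀ k → f k ≡ 0ℚ
  Ann-unique-zero zero    a z k = a k
  Ann-unique-zero (suc D) {f} a z = go
    where
    Δf≡0 : ∀ k → Δ f k ≡ 0ℚ
    Δf≡0 = Ann-unique-zero D a (λ n → cong₂ ℚ._-_ (z (suc n)) (z n))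
    backward : ∀ k → f (ℤ.suc k) ≡ 0ℚ → f k ≡ 0ℚ
    backward k p = begin
      f k                              ≡⟨ solve 2 (λ x y → x := y :- (y :- x)) refl (f k) (f (ℤ.suc k)) ⟩
      f (ℤ.suc k) ℚ.- Δ f k            ≡⟨ cong₂ ℚ._-_ p (Δf≡0 k) ⟩
      0ℚ ℚ.- 0ℚ                        ∎
      where open ≡-Reasoning
    go : ∀ k → f k ≡ 0ℚ
    go (+ n)          = z n
    go -[1+ zero ]    = backward -[1+ 0 ] (z 0)
    go -[1+ suc n ]   = backward -[1+ suc n ] (go -[1+ n ])

  Ann-unique : ∀ D E {f g} → Annihilated D f → Annihilated E g → (∀ n → f (+ n) ≡ g (+ n)) → f ≗ g
  Ann-unique D E {f} {g} a b p k = begin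
    f k                        ≡⟨ solve 2 (λ x y → x := (x :- y) :+ y) refl (f k) (g k) ⟩
    (f k ℚ.- g k) ℚ.+ g k      ≡⟨ cong (ℚ._+ g k) (Ann-unique-zero (E ℕ.+ D)
                                    (Ann-minus (E ℕ.+ D) (Ann-raise E D a) (subst (λ m → Annihilated m g) (ℕₚ.+-comm D E) (Ann-raise D E b)))
                                    (λ n → trans (cong (ℚ._- g (+ n)) (p n)) (ℚₚ.+-inverseʳ (g (+ n)))) k) ⟩
    0ℚ ℚ.+ g k                 ≡⟨ ℚₚ.+-identityˡ (g k) ⟩
    g k                        ∎
    where open ≡-Reasoning

  module _ (ℓ : ℤ → ℤ) (u : ℤ) (ℓ-suc : ∀ k → ℓ (ℤ.suc k) ≡ ℓ k ℤ.+ u) where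

    -- By the Leibniz rule for differences a factor ℓ costs one more difference, because Δℓ is the
    -- constant u.
    Ann-linear : ∀ D {g} → Annihilated D g → Annihilated (suc D) (λ k → toℚ (ℓ k) ℚ.* g k)
    Ann-linear zero {g} a k = trans
      (cong₂ ℚ._-_ (zero-right (ℓ (ℤ.suc k)) (a (ℤ.suc k))) (zero-right (ℓ k) (a k))) refl
      where
      zero-right : ∀ z {q} → q ≡ 0ℚ → toℚ z ℚ.* q ≡ 0ℚ
      zero-right z refl = ℚₚ.*-zeroʳ (toℚ z)
    Ann-linear (suc D) {g} a = Ann-≗ (suc D) leibniz
      (Ann-+ (suc D) {λ k → toℚ (ℓ k) ℚ.* Δ g k} {λ k → toℚ u ℚ.* g (ℤ.suc k)}
        (Ann-linear D a) (Ann-* (suc D) (toℚ u) {λ k → g (ℤ.suc k)} (Ann-shift (suc D) {g} a)))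
      where
      leibniz : ∀ k → Δ (λ k → toℚ (ℓ k) ℚ.* g k) k ≡ toℚ (ℓ k) ℚ.* Δ g k ℚ.+ toℚ u ℚ.* g (ℤ.suc k)
      leibniz k = trans (cong (λ z → z ℚ.* g (ℤ.suc k) ℚ.- toℚ (ℓ k) ℚ.* g k) (trans (cong toℚ (ℓ-suc k)) (toℚ-+ (ℓ k) u)))
        (solve 4 (λ l u x y → (l :+ u) :* x :- l :* y := l :* (x :- y) :+ u :* x) refl (toℚ (ℓ k)) (toℚ u) (g (ℤ.suc k)) (g k))

    -- Horner's scheme has one linear factor per coefficient. The substitution ℓ will be k, 2k, 2k +
    -- 1 or -2k - 4.
    Ann-evalℚ : ∀ p → Annihilated (length p) (λ k → evalℚ p (ℓ k))
    Ann-evalℚ []       k = refl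
    Ann-evalℚ (a ∷ as) = Ann-+ (suc (length as)) {λ _ → a}
      (Ann-≗ (length as) (λ _ → ℚₚ.+-inverseʳ a) (Ann-zero (length as)))
      (Ann-linear (length as) (Ann-evalℚ as))

  -- With zeros at negative indices, multiplication by `1-t` is a difference at every integer,
  -- including index 0.
  hat : Series → ℤ → ℤ
  hat x (+ n)    = coeff x n
  hat x -[1+ n ] = + 0

  hat-cong : ∀ {x y} → x ≈ y → hat x ≗ hat y
  hat-cong p (+ n)    = at p n
  hat-cong p -[1+ n ] = refl

  hat-suc : ∀ x k → hat (1-t * x) (ℤ.suc k) ≡ hat x (ℤ.suc k) ℤ.- hat x k
  hat-suc x (+ n)          = coeff-1-t*-suc x n
  hat-suc x -[1+ zero ]    = trans (coeff-1-t*-zero x) (sym (ℤₚ.+-identityʳ _))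
  hat-suc x -[1+ suc n ]   = refl

  sgn-sgn : ∀ d → sgn d ℤ.* sgn d ≡ + 1
  sgn-sgn zero    = refl
  sgn-sgn (suc d) = trans (lemma (sgn d)) (sgn-sgn d)
    where
    lemma : ∀ s → (ℤ.- s) ℤ.* (ℤ.- s) ≡ s ℤ.* s
    lemma = solve-∀

  sgn-+ : ∀ a b → sgn (a ℕ.+ b) ≡ sgn a ℤ.* sgn b
  sgn-+ zero    b = sym (ℤₚ.*-identityˡ _)
  sgn-+ (suc a) b = trans (cong ℤ.-_ (sgn-+ a b)) (ℤₚ.neg-distribˡ-* (sgn a) (sgn b))

  -- Two-sided extension: if (1-t)^(d+1) x and (1-t)^(d+1) y are mirror images of one another, then the
  -- (d+1)-st difference of x_k + (-1)^d y_{-2-k} vanishes for all k ∈ ℤ.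
  module TwoSided (e : ℕ) (x y v w : Series) (x≈ : [1-t]^ (2 ℕ.+ e) * x ≈ v) (y≈ : [1-t]^ (2 ℕ.+ e) * y ≈ w)
    (v-vanish : ∀ k → suc e ℕ.≤ k → coeff v k ≡ + 0) (w-vanish : ∀ k → suc e ℕ.≤ k → coeff w k ≡ + 0)
    (mirror : ∀ i j → i ℕ.+ j ≡ e → coeff w i ≡ coeff v j) where

    d : ℕ
    d = suc e

    -- The p-th difference of the two-sided extension. Differencing moves the index of the x-part up
    -- by one each time; the y-part runs backwards, so its index stays and its sign flips. The
    -- offset 2 is the exponent d + 1 minus the mirror sum d - 1.
    difference : ℕ → ℤ → ℤ
    difference p k = hat ([1-t]^ p * x) (k ℤ.+ + p) ℤ.+ sgn (d ℕ.+ p) ℤ.* hat ([1-t]^ p * y) (ℤ.- k ℤ.+ ℤ.- + 2)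

    difference-suc : ∀ p k → difference p (ℤ.suc k) ℤ.- difference p k ≡ difference (suc p) k
    difference-suc p k = begin
      (X (ℤ.suc k ℤ.+ + p) ℤ.+ s ℤ.* Y (ℤ.- ℤ.suc k ℤ.+ ℤ.- + 2)) ℤ.- (X (k ℤ.+ + p) ℤ.+ s ℤ.* Y (ℤ.- k ℤ.+ ℤ.- + 2))
        ≡⟨ rearrange (X (ℤ.suc k ℤ.+ + p)) (X (k ℤ.+ + p)) s (Y j) (Y (ℤ.- k ℤ.+ ℤ.- + 2)) ⟩
      (X (ℤ.suc k ℤ.+ + p) ℤ.- X (k ℤ.+ + p)) ℤ.+ (ℤ.- s) ℤ.* (Y (ℤ.- k ℤ.+ ℤ.- + 2) ℤ.- Y j)
        ≡⟨ cong₂ (λ a b → (X a ℤ.- X (k ℤ.+ + p)) ℤ.+ (ℤ.- s) ℤ.* (Y b ℤ.- Y j)) (index₁ k (+ p)) (index₂ k) ⟩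
      (X (ℤ.suc (k ℤ.+ + p)) ℤ.- X (k ℤ.+ + p)) ℤ.+ (ℤ.- s) ℤ.* (Y (ℤ.suc j) ℤ.- Y j)
        ≡⟨ cong₂ (λ a b → a ℤ.+ (ℤ.- s) ℤ.* b)
             (trans (sym (hat-suc ([1-t]^ p * x) (k ℤ.+ + p))) (assoc x (ℤ.suc (k ℤ.+ + p))))
             (trans (sym (hat-suc ([1-t]^ p * y) j)) (assoc y (ℤ.suc j))) ⟩
      hat ([1-t]^ (suc p) * x) (ℤ.suc (k ℤ.+ + p)) ℤ.+ (ℤ.- s) ℤ.* hat ([1-t]^ (suc p) * y) (ℤ.suc j)
        ≡⟨ cong₂ (λ a b → hat ([1-t]^ (suc p) * x) a ℤ.+ sgn b ℤ.* hat ([1-t]^ (suc p) * y) (ℤ.suc j)) (index₃ k (+ p)) (sym (ℕₚ.+-suc d p)) ⟩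
      hat ([1-t]^ (suc p) * x) (k ℤ.+ + suc p) ℤ.+ sgn (d ℕ.+ suc p) ℤ.* hat ([1-t]^ (suc p) * y) (ℤ.suc j)
        ≡⟨ cong (λ a → hat ([1-t]^ (suc p) * x) (k ℤ.+ + suc p) ℤ.+ sgn (d ℕ.+ suc p) ℤ.* hat ([1-t]^ (suc p) * y) a) (sym (index₂ k)) ⟩
      difference (suc p) k ∎
      where
      open ≡-Reasoning
      X Y : ℤ → ℤ
      X = hat ([1-t]^ p * x)
      Y = hat ([1-t]^ p * y)
      s j : ℤ
      s = sgn (d ℕ.+ p)
      j = ℤ.- ℤ.suc k ℤ.+ ℤ.- + 2
      assoc : ∀ z k → hat (1-t * ([1-t]^ p * z)) k ≡ hat ([1-t]^ (suc p) * z) k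
      assoc z = hat-cong (ℤ[[t]].sym (ℤ[[t]].*-assoc 1-t ([1-t]^ p) z))
      rearrange : ∀ a b s u v → (a ℤ.+ s ℤ.* u) ℤ.- (b ℤ.+ s ℤ.* v) ≡ (a ℤ.- b) ℤ.+ (ℤ.- s) ℤ.* (v ℤ.- u)
      rearrange = solve-∀
      index₁ : ∀ k p → (+ 1 ℤ.+ k) ℤ.+ p ≡ + 1 ℤ.+ (k ℤ.+ p)
      index₁ = solve-∀
      index₂ : ∀ k → ℤ.- k ℤ.+ ℤ.- + 2 ≡ + 1 ℤ.+ (ℤ.- (+ 1 ℤ.+ k) ℤ.+ ℤ.- + 2)
      index₂ = solve-∀
      index₃ : ∀ k p → + 1 ℤ.+ (k ℤ.+ p) ≡ k ℤ.+ (+ 1 ℤ.+ p)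
      index₃ = solve-∀

    large : ∀ i j → + i ℤ.+ -[1+ j ] ≡ + e → suc e ℕ.≤ i
    large i j p = subst (suc e ℕ.≤_) (ℤₚ.+-injective (trans (cong (ℤ._+ + suc j) (sym p)) (back (+ i) (+ j))))
      (subst (ℕ._≤ e ℕ.+ suc j) (ℕₚ.+-comm e 1) (ℕₚ.+-monoʳ-≤ e (ℕ.s≤s ℕ.z≤n)))
      where
      back : ∀ i j → (i ℤ.+ ℤ.- (+ 1 ℤ.+ j)) ℤ.+ (+ 1 ℤ.+ j) ≡ i
      back = solve-∀

    hat-mirror : ∀ i j → i ℤ.+ j ≡ + e → hat w i ≡ hat v j
    hat-mirror (+ i)    (+ j)    p = mirror i j (ℤₚ.+-injective p)
    hat-mirror (+ i)    -[1+ j ] p = w-vanish i (large i j p)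
    hat-mirror -[1+ i ] (+ j)    p = sym (v-vanish j (large j i (trans (ℤₚ.+-comm (+ j) -[1+ i ]) p)))

    -- The two arguments of `hat` add up to e, so the values agree by mirror symmetry, and they
    -- cancel because `sgn` at 2d + 1 is -1.
    difference-top : ∀ k → difference (suc d) k ≡ + 0
    difference-top k = begin
      difference (suc d) k
        ≡⟨ cong₂ (λ a b → a ℤ.+ sgn (d ℕ.+ suc d) ℤ.* b) (hat-cong x≈ (k ℤ.+ + suc d)) (hat-cong y≈ (ℤ.- k ℤ.+ ℤ.- + 2)) ⟩
      hat v (k ℤ.+ + suc d) ℤ.+ sgn (d ℕ.+ suc d) ℤ.* hat w (ℤ.- k ℤ.+ ℤ.- + 2)
        ≡⟨ cong₂ (λ a b → hat v (k ℤ.+ + suc d) ℤ.+ a ℤ.* b) sign (hat-mirror (ℤ.- k ℤ.+ ℤ.- + 2) (k ℤ.+ + suc d) (index k (+ e))) ⟩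
      hat v (k ℤ.+ + suc d) ℤ.+ ℤ.- + 1 ℤ.* hat v (k ℤ.+ + suc d)
        ≡⟨ cancel (hat v (k ℤ.+ + suc d)) ⟩
      + 0 ∎
      where
      open ≡-Reasoning
      sign : sgn (d ℕ.+ suc d) ≡ ℤ.- + 1
      sign = trans (cong sgn (ℕₚ.+-suc d d)) (cong ℤ.-_ (trans (sgn-+ d d) (sgn-sgn d)))
      index : ∀ k e → (ℤ.- k ℤ.+ ℤ.- + 2) ℤ.+ (k ℤ.+ (+ 1 ℤ.+ (+ 1 ℤ.+ e))) ≡ e
      index = solve-∀
      cancel : ∀ a → a ℤ.+ ℤ.- + 1 ℤ.* a ≡ + 0
      cancel = solve-∀

    -- The coefficients of x at k ≥ 0 and those of y, up to sign, at k ≤ -2; at k = -1 both parts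
    -- are 0.
    extended : ℤ → ℤ
    extended = difference 0

    Ann-extended : Annihilated (suc d) (toℚ ∘ extended)
    Ann-extended = go (suc d) 0 (ℕₚ.+-identityʳ (suc d))
      where
      go : ∀ m p → m ℕ.+ p ≡ suc d → Annihilated m (toℚ ∘ difference p)
      go zero    p refl k = cong toℚ (difference-top k)
      go (suc m) p q = Ann-≗ m
        (λ k → trans (sym (toℚ-minus (difference p (ℤ.suc k)) (difference p k))) (cong toℚ (difference-suc p k)))
        (go m (suc p) (trans (ℕₚ.+-suc m p) q))

    extended-nonneg : ∀ n → extended (+ n) ≡ coeff x n
    extended-nonneg n = trans (cong₂ (λ a b → hat (1# * x) a ℤ.+ sgn (d ℕ.+ 0) ℤ.* hat (1# * y) b) (ℤₚ.+-identityʳ (+ n)) (negative n))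
      (trans (cong (ℤ._+_ (coeff (1# * x) n)) (ℤₚ.*-zeroʳ (sgn (d ℕ.+ 0)))) (trans (ℤₚ.+-identityʳ _) (coeff-1* x n)))
      where
      negative : ∀ n → ℤ.- + n ℤ.+ ℤ.- + 2 ≡ -[1+ suc n ]
      negative zero    = refl
      negative (suc n) = cong (λ z → -[1+ suc z ]) (ℕₚ.+-comm n 1)

    extended-negative : ∀ n → extended (ℤ.- + n ℤ.+ ℤ.- + 2) ≡ sgn d ℤ.* coeff y n
    extended-negative n = trans (cong₂ (λ a b → hat (1# * x) a ℤ.+ sgn (d ℕ.+ 0) ℤ.* hat (1# * y) b) (negative n) (double (+ n)))
      (trans (ℤₚ.+-identityˡ _) (cong₂ (λ a b → sgn a ℤ.* b) (ℕₚ.+-identityʳ d) (coeff-1* y n)))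
      where
      negative : ∀ n → (ℤ.- + n ℤ.+ ℤ.- + 2) ℤ.+ + 0 ≡ -[1+ suc n ]
      negative zero    = refl
      negative (suc n) = cong (λ z → -[1+ suc z ]) (ℕₚ.+-comm n 1)
      double : ∀ n → ℤ.- (ℤ.- n ℤ.+ ℤ.- + 2) ℤ.+ ℤ.- + 2 ≡ n
      double = solve-∀

    module Reciprocity (podd peven pP : List ℚ)
      (podd≡  : ∀ n → evalℚ podd (+ suc (2 ℕ.* n)) ≡ toℚ (coeff y n))
      (peven≡ : ∀ n → evalℚ peven (+ (2 ℕ.* n)) ≡ toℚ (coeff x n))
      (pP≡    : ∀ n → evalℚ pP (+ n) ≡ toℚ (coeff x n)) where

      peven≗ : ∀ k → evalℚ peven (+ 2 ℤ.* k) ≡ toℚ (extended k)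
      peven≗ = Ann-unique (length peven) (suc d) (Ann-evalℚ (+ 2 ℤ.*_) (+ 2) step peven) Ann-extended
        (λ n → trans (cong (evalℚ peven) (sym (ℤₚ.pos-* 2 n))) (trans (peven≡ n) (cong toℚ (sym (extended-nonneg n)))))
        where
        step : ∀ k → + 2 ℤ.* (+ 1 ℤ.+ k) ≡ + 2 ℤ.* k ℤ.+ + 2
        step = solve-∀

      pP≗ : ∀ k → evalℚ pP k ≡ toℚ (extended k)
      pP≗ = Ann-unique (length pP) (suc d) (Ann-evalℚ (λ k → k) (+ 1) (λ k → ℤₚ.+-comm (+ 1) k) pP) Ann-extended
        (λ n → trans (pP≡ n) (cong toℚ (sym (extended-nonneg n))))

      peven-reflected : ∀ k → evalℚ peven (ℤ.- (+ 2 ℤ.* k) ℤ.+ ℤ.- + 4) ≡ toℚ (extended (ℤ.- k ℤ.+ ℤ.- + 2))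
      peven-reflected k = trans (cong (evalℚ peven) (index k)) (peven≗ (ℤ.- k ℤ.+ ℤ.- + 2))
        where
        index : ∀ k → ℤ.- (+ 2 ℤ.* k) ℤ.+ ℤ.- + 4 ≡ + 2 ℤ.* (ℤ.- k ℤ.+ ℤ.- + 2)
        index = solve-∀

      -- Both sides are polynomial in k, so natural k suffice. There -2k - 4 is twice -k - 2, where
      -- `extended` takes the value of y at k up to the sign.
      podd-reciprocity : ∀ k → evalℚ podd (+ 2 ℤ.* k ℤ.+ + 1) ≡ signℚ d ℚ.* evalℚ peven (ℤ.- (+ 2 ℤ.* k) ℤ.+ ℤ.- + 4)
      podd-reciprocity = Ann-unique (length podd) (length peven)
        (Ann-evalℚ (λ k → + 2 ℤ.* k ℤ.+ + 1) (+ 2) step₁ podd)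
        (Ann-* (length peven) (signℚ d) (Ann-evalℚ (λ k → ℤ.- (+ 2 ℤ.* k) ℤ.+ ℤ.- + 4) (ℤ.- + 2) step₂ peven))
        at-naturals
        where
        step₁ : ∀ k → + 2 ℤ.* (+ 1 ℤ.+ k) ℤ.+ + 1 ≡ (+ 2 ℤ.* k ℤ.+ + 1) ℤ.+ + 2
        step₁ = solve-∀
        step₂ : ∀ k → ℤ.- (+ 2 ℤ.* (+ 1 ℤ.+ k)) ℤ.+ ℤ.- + 4 ≡ (ℤ.- (+ 2 ℤ.* k) ℤ.+ ℤ.- + 4) ℤ.+ ℤ.- + 2
        step₂ = solve-∀
        index : ∀ n → + 2 ℤ.* + n ℤ.+ + 1 ≡ + suc (2 ℕ.* n)
        index n = trans (cong (ℤ._+ + 1) (sym (ℤₚ.pos-* 2 n))) (cong +_ (ℕₚ.+-comm (2 ℕ.* n) 1))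
        cancel-sgn : ∀ n → sgn d ℤ.* (sgn d ℤ.* coeff y n) ≡ coeff y n
        cancel-sgn n = trans (sym (ℤₚ.*-assoc (sgn d) (sgn d) (coeff y n)))
          (trans (cong (ℤ._* coeff y n) (sgn-sgn d)) (ℤₚ.*-identityˡ (coeff y n)))
        at-naturals : ∀ n → evalℚ podd (+ 2 ℤ.* + n ℤ.+ + 1) ≡ signℚ d ℚ.* evalℚ peven (ℤ.- (+ 2 ℤ.* + n) ℤ.+ ℤ.- + 4)
        at-naturals n = begin
          evalℚ podd (+ 2 ℤ.* + n ℤ.+ + 1)                                ≡⟨ trans (cong (evalℚ podd) (index n)) (podd≡ n) ⟩
          toℚ (coeff y n)                                                 ≡⟨ cong toℚ (sym (cancel-sgn n)) ⟩
          toℚ (sgn d ℤ.* (sgn d ℤ.* coeff y n))                           ≡⟨ toℚ-* (sgn d) (sgn d ℤ.* coeff y n) ⟩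
          signℚ d ℚ.* toℚ (sgn d ℤ.* coeff y n)                           ≡⟨ cong (λ z → signℚ d ℚ.* toℚ z) (sym (extended-negative n)) ⟩
          signℚ d ℚ.* toℚ (extended (ℤ.- + n ℤ.+ ℤ.- + 2))                ≡⟨ cong (signℚ d ℚ.*_) (sym (peven-reflected (+ n))) ⟩
          signℚ d ℚ.* evalℚ peven (ℤ.- (+ 2 ℤ.* + n) ℤ.+ ℤ.- + 4)         ∎
          where open ≡-Reasoning

-- The Ehrhart series of a graph on d = e + 1 vertices.

module Conclusion (e : ℕ) (G : Adj (suc e)) (G-sym : ∀ i j → G i j ≡ G j i) (no-isolated : NoIsolatedVertices G) where
  open PowerSeries
  open GammaPositive
  open SubsetSums using (full)
  open LatticePoints
  open LayerEquations.Layers G G-sym using (U)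
  open NumeratorDecomposition
  open Numerators
  open Reciprocities using (module TwoSided)

  evens odds : Series
  evens = U false (full (suc e))
  odds  = U true (full (suc e))

  coeff-evens : ∀ m → coeff evens m ≡ + iFRAC G (2 ℕ.* m)
  coeff-evens m = sym (iFRAC≡latticeCount G (2 ℕ.* m))

  coeff-odds : ∀ m → coeff odds m ≡ + iFRAC G (suc (2 ℕ.* m))
  coeff-odds m = sym (iFRAC≡latticeCount G (suc (2 ℕ.* m)))

  -- The constant term 1 prescribed for an Ehrhart series agrees with the count at dilation 0, where
  -- the origin is the only point.
  ehrCoeff-evens : ∀ i → (∀ m → i (suc m) ≡ iFRAC G (2 ℕ.* suc m)) → ∀ m → ehrCoeff i m ≡ coeff evens m
  ehrCoeff-evens i i≡ zero    = sym (latticeCount-1 G (full (suc e)))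
  ehrCoeff-evens i i≡ (suc m) = trans (cong +_ (i≡ m)) (sym (coeff-evens (suc m)))

  ehrCoeff-double : ∀ m → ehrCoeff (iFRAC G) (m ℕ.+ m) ≡ coeff evens m
  ehrCoeff-double zero    = sym (latticeCount-1 G (full (suc e)))
  ehrCoeff-double (suc m) = trans (cong (λ n → + iFRAC G n) (sym (2*≡ (suc m)))) (sym (coeff-evens (suc m)))

  ehrCoeff-odds : ∀ m → ehrCoeff (iFRAC G) (suc (m ℕ.+ m)) ≡ coeff odds m
  ehrCoeff-odds m = trans (cong (λ n → + iFRAC G (suc n)) (sym (2*≡ m))) (sym (coeff-odds m))

  decomposition : Decomposed G G-sym no-isolated
  decomposition = numerators G G-sym no-isolated

  α β : Series
  α = proj₁ decomposition
  β = proj₁ (proj₂ decomposition)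

  α-su : SymmetricUnimodal (suc e) (coeff α)
  α-su = Pos-SymmetricUnimodal (proj₁ (proj₂ (proj₂ decomposition)))

  β-su : SymmetricUnimodal e (coeff β)
  β-su = Pos-SymmetricUnimodal (proj₁ (proj₂ (proj₂ (proj₂ decomposition))))

  evens-numerator : [1-t]^ (2 ℕ.+ e) * evens ≈ α + t * β
  evens-numerator = proj₁ (proj₂ (proj₂ (proj₂ (proj₂ decomposition))))

  odds-numerator : [1-t]^ (2 ℕ.+ e) * odds ≈ α + β
  odds-numerator = proj₂ (proj₂ (proj₂ (proj₂ (proj₂ decomposition))))

  δP≗ : δP G ≗ coeff (α + t * β)
  δP≗ m = trans
    (mulOneMinusPow-[1-t]^ (2 ℕ.+ e) (ehrCoeff (iP G)) evens (ehrCoeff-evens (iP G) (λ _ → refl)) m)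
    (at evens-numerator m)

  fracNumer-even : ∀ k → fracNumer G (k ℕ.+ k) ≡ δP G k
  fracNumer-even k = trans (mulOneMinusPow-2 (2 ℕ.+ e) (ehrCoeff (iFRAC G)) 0 k z≤n) (trans
    (mulOneMinusPow-[1-t]^ (2 ℕ.+ e) _ evens ehrCoeff-double k) (trans (at evens-numerator k) (sym (δP≗ k))))

  fracNumer-odd : ∀ k → fracNumer G (suc (k ℕ.+ k)) ≡ coeff (α + β) k
  fracNumer-odd k = trans (mulOneMinusPow-2 (2 ℕ.+ e) (ehrCoeff (iFRAC G)) 1 k (s≤s z≤n)) (trans
    (mulOneMinusPow-[1-t]^ (2 ℕ.+ e) _ odds ehrCoeff-odds k) (at odds-numerator k))

  open Interleaving e α β α-su β-su (δP G) δP≗ public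
    using (δ-vanish; ω-vanish; ω-mirror; symmetric; unimodal; first≡second; numerator≡first)

  open TwoSided e evens odds (α + t * β) (α + β) evens-numerator odds-numerator
    (λ k le → trans (sym (δP≗ k)) (δ-vanish k le)) ω-vanish (λ i j p → trans (ω-mirror i j p) (δP≗ j)) public
    using (extended; module Reciprocity)

open import Data.Nat using (ℕ; suc; _≤_; _*_; _∸_)
open import Data.Integer using (ℤ; +_; -_) renaming (_+_ to _+ℤ_; _*_ to _*ℤ_)
open import Data.Rational using (ℚ) renaming (_*_ to _*ℚ_)

theorem3p1 : (d : ℕ) → 1 ≤ d → (G : Adj d) → IsSimpleGraph G → NoIsolatedVertices G →
    (((k : ℕ) → d ≤ k → δP G k ≡ + 0)
    × ((m : ℕ) → fracNumer G m ≡ firstForm d (δP G) m)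
    × ((m : ℕ) → firstForm d (δP G) m ≡ secondForm d (δP G) m)
    × Symmetric (2 * d ∸ 1) (interleave d (δP G))
    × Unimodal (2 * d ∸ 1) (interleave d (δP G)))
    × ((podd peven pP : List ℚ) →
    ((n : ℕ) → evalℚ podd (+ (suc (2 * n))) ≡ ℕtoℚ (iFRAC G (suc (2 * n)))) →
    ((n : ℕ) → evalℚ peven (+ (2 * n)) ≡ ℕtoℚ (iFRAC G (2 * n))) →
    ((n : ℕ) → evalℚ pP (+ n) ≡ ℕtoℚ (iP G n)) →
    (k : ℤ) →
    (evalℚ podd ((+ 2 *ℤ k) +ℤ + 1) ≡ signℚ d *ℚ evalℚ peven ((- (+ 2 *ℤ k)) +ℤ - + 4))
    × (evalℚ peven ((- (+ 2 *ℤ k)) +ℤ - + 4) ≡ evalℚ pP ((- k) +ℤ - + 2)))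
theorem3p1 (suc e) _ G (G-sym , _) no-isolated =
  (δ-vanish , numerator≡first (fracNumer G) fracNumer-even fracNumer-odd , first≡second , symmetric , unimodal) ,
  λ podd peven pP podd≡ peven≡ pP≡ k →
    let open Reciprocity podd peven pP
          (λ n → trans (podd≡ n) (cong (ℚ._/ 1) (sym (coeff-odds n))))
          (λ n → trans (peven≡ n) (cong (ℚ._/ 1) (sym (coeff-evens n))))
          (λ n → trans (pP≡ n) (cong (ℚ._/ 1) (sym (coeff-evens n))))
    in podd-reciprocity k , trans (peven-reflected k) (sym (pP≗ ((- k) +ℤ - + 2)))
  where open Conclusion e G G-sym no-isolated
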